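{- Let $F$ be a propositional formula in CNF with $n$ variables and set of satisfying assignments $R_F\subseteq\{0,1\}^n$, and let $\varepsilon,\delta$ be real numbers with $0<\varepsilon\le1$ and $0<\delta\le1$. Let $c$ be the (random) value returned by the algorithm ApproxMC on inputs $F,\varepsilon,\delta$. Then $$\Pr\left[(1+\varepsilon)^{ -1}\cdot|R_F|\le c\le(1+\varepsilon)\cdot|R_F|\right]\ge 1-\delta.$$
   Context: Hash family. For integers $n\ge1$, $m\ge0$, $H_{xor}(n,m,3)$ is the family of functions $h:\{0,1\}^n\to\{0,1\}^m$ of the form $h(y)[i]=a_{i,0}\oplus\bigoplus_{k=1}^n a_{i,k}\cdot y[k]$ for $1\le i\le m$, with $a_{i,j}\in\{0,1\}$ ($1\le i\le m$, $0\le j\le n$); choosing a function at random from it means choosing all $a_{i,j}$ independently and uniformly. (This family is known to be 3-wise independent.) BoundedSAT$(G,r)$: for a propositional formula $G$ (a conjunction of CNF clauses and xor constraints) and an integer $r\ge0$, returns a set $S$ of satisfying assignments of $G$ with $|S|=\min(r,\#G)$, where $\#G$ is the number of satisfying assignments of $G$. Algorithm ApproxMCCore$(F,\mathit{pivot})$, where $z_1,\dots,z_n$ are the variables of $F$ (random choices uniform and independent): 1. $S=$ BoundedSAT$(F,\mathit{pivot}+1)$. If $|S|\le\mathit{pivot}$, return $|S|$. 2. Otherwise set $l=\lfloor\log_2(\mathit{pivot})\rfloor-1$ and $i=l-1$, and repeat: increase $i$ by $1$; choose $h$ at random from $H_{xor}(n,i-l,3)$; choose $\alpha$ at random from $\{0,1\}^{i-l}$;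 set $S=$ BoundedSAT$(F\wedge(h(z_1,\dots,z_n)=\alpha),\mathit{pivot}+1)$; until ($1\le|S|\le\mathit{pivot}$) or $i=n$. 3. If $|S|>\mathit{pivot}$ or $|S|=0$, return $\bot$ (failure); otherwise return $|S|\cdot2^{i-l}$. Algorithm ApproxMC$(F,\varepsilon,\delta)$: set $\mathit{pivot}=2\left\lceil 3e^{1/2}\left(1+\frac1\varepsilon\right)^2\right\rceil$ and $t=\lceil35\log_2(3/\delta)\rceil$. Call ApproxMCCore$(F,\mathit{pivot})$ $t$ times independently, and let $C$ be the list of all non-$\bot$ values returned. Return the median of $C$ (and $\bot$ if $C$ is empty; the value $\bot$ is regarded as lying outside every interval). -}

module Defs where

open import Data.Bool.Base using (Bool; true; false; if_then_else_; not; _∧_; _xor_; T)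
open import Data.Empty using (⊥)
open import Data.Fin.Base using (Fin)
open import Data.Integer.Base as ℤ using (ℤ; +_; -[1+_])
open import Data.List.Base as List using (List; []; _∷_; _++_; length; filterᵇ; catMaybes)
open import Data.List.Relation.Unary.All using (All)
open import Data.List.Relation.Unary.Unique.Propositional using (Unique)
import Data.List.Sort as Sort
open import Data.Maybe.Base as Maybe using (Maybe; just; nothing)
open import Data.Nat.Base as ℕ using (ℕ; zero; suc; _+_; _*_; _∸_; _^_; _≤ᵇ_; _⊓_)
open import Data.Nat.Logarithm using (⌊log₂_⌋)
open import Data.Nat.Properties using (≤-decTotalOrder; m^n≢0)
open import Data.Product.Base using (Σ-syntax; ∃-syntax; _×_; _,_)
open import Data.Rational.Base as ℚ using (ℚ; 0ℚ; 1ℚ; ½)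
open import Data.Sum.Base using (_⊎_)
open import Data.Vec.Base as Vec using (Vec; []; _∷_; lookup)
open import Relation.Binary.PropositionalEquality.Core using (_≡_)
open import Relation.Nullary.Negation.Core using (¬_)

open Sort ≤-decTotalOrder using (sort)

-- Real numbers are two-sided Dedekind cuts.  The operations are given by their usual cut formulas on arbitrary pairs of
-- predicates (lower, upper) and are meaningful for genuine reals, i.e. under `IsReal`.
record Cut : Set₁ where
  constructor _∣_
  field
    L U : ℚ → Set

open Cut public

record IsReal (x : Cut) : Set where
  field
    L-inhabited : ∃[ q ] L x q
    U-inhabited : ∃[ q ] U x q
    L-rounded   : ∀ q → L x q → ∃[ r ] (q ℚ.< r × L x r)
    U-rounded   : ∀ q → U x q → ∃[ r ] (r ℚ.< q × U x r)
    L-closed    : ∀ q r → q ℚ.< r → L x r → L x q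
    U-closed    : ∀ q r → r ℚ.< q → U x r → U x q
    disjoint    : ∀ q → ¬ (L x q × U x q)
    located     : ∀ q r → q ℚ.< r → L x q ⊎ U x r

infix  4 _<ᶜ_ _≤ᶜ_
infixl 6 _+ᶜ_ _-ᶜ_
infixl 7 _*ᶜ_ _/ᶜ_
infixr 8 _^ᶜ_

_<ᶜ_ _≤ᶜ_ : Cut → Cut → Set
x <ᶜ y = ∃[ q ] (U x q × L y q)
x ≤ᶜ y = ∀ q → L x q → L y q

fromℚ : ℚ → Cut
fromℚ p = (λ q → q ℚ.< p) ∣ (λ q → p ℚ.< q)

fromℤ : ℤ → Cut
fromℤ z = fromℚ (z ℚ./ 1)

fromℕ : ℕ → Cut
fromℕ n = fromℤ (+ n)

_+ᶜ_ : Cut → Cut → Cut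
x +ᶜ y = (λ q → ∃[ a ] ∃[ b ] (L x a × L y b × q ≡ a ℚ.+ b))
       ∣ (λ q → ∃[ a ] ∃[ b ] (U x a × U y b × q ≡ a ℚ.+ b))

_-ᶜ_ : Cut → Cut → Cut
x -ᶜ y = x +ᶜ ((λ q → U y (ℚ.- q)) ∣ (λ q → L y (ℚ.- q)))

-- The product lies strictly between the extreme values of the four products
-- of endpoints of rational intervals (a , b) ∋ x and (c , d) ∋ y.
_*ᶜ_ : Cut → Cut → Cut
x *ᶜ y =
    (λ q → ∃[ a ] ∃[ b ] ∃[ c ] ∃[ d ] (L x a × U x b × L y c × U y d ×
       q ℚ.< a ℚ.* c × q ℚ.< a ℚ.* d × q ℚ.< b ℚ.* c × q ℚ.< b ℚ.* d))
  ∣ (λ q → ∃[ a ] ∃[ b ] ∃[ c ] ∃[ d ] (L x a × U x b × L y c × U y d ×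
       a ℚ.* c ℚ.< q × a ℚ.* d ℚ.< q × b ℚ.* c ℚ.< q × b ℚ.* d ℚ.< q))

_^ᶜ_ : Cut → ℕ → Cut
x ^ᶜ zero  = fromℕ 1
x ^ᶜ suc n = x *ᶜ x ^ᶜ n

-- Only meaningful for x > 0.
inv : Cut → Cut
inv x = (λ q → ∃[ u ] (U x u × q ℚ.* u ℚ.< 1ℚ))
      ∣ (λ q → ∃[ l ] (0ℚ ℚ.< l × L x l × 1ℚ ℚ.< q ℚ.* l))

-- Only meaningful for y > 0.
_/ᶜ_ : Cut → Cut → Cut
x /ᶜ y = x *ᶜ inv y

-- Supremum of a nondecreasing rational sequence.
sup : (ℕ → ℚ) → Cut
sup s = (λ q → ∃[ n ] (q ℚ.< s n))
      ∣ (λ q → ∃[ r ] (r ℚ.< q × (∀ n → s n ℚ.≤ r)))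

expTerm : ℚ → ℕ → ℚ
expTerm x zero    = 1ℚ
expTerm x (suc k) = expTerm x k ℚ.* x ℚ.* (+ 1 ℚ./ suc k)

expSum : ℚ → ℕ → ℚ
expSum x zero    = 0ℚ
expSum x (suc n) = expSum x n ℚ.+ expTerm x n

-- Only meaningful for x ≥ 0, where the partial sums of Σ xᵏ/k! increase.
exp : ℚ → Cut
exp x = sup (expSum x)

2^ℤ : ℤ → ℚ
2^ℤ (+ n)    = + (2 ^ n) ℚ./ 1
2^ℤ -[1+ n ] = ℚ._/_ (+ 1) (2 ^ suc n) {{m^n≢0 2 (suc n)}}

-- p/d < log₂ x  iff  2ᵖ < xᵈ, and dually.  Only meaningful for x > 0.
log₂ : Cut → Cut
log₂ x = (λ q → fromℚ (2^ℤ (ℚ.↥ q)) <ᶜ x ^ᶜ ℚ.↧ₙ q)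
       ∣ (λ q → x ^ᶜ ℚ.↧ₙ q <ᶜ fromℚ (2^ℤ (ℚ.↥ q)))

IsCeiling : Cut → ℕ → Set
IsCeiling x k = (fromℤ (+ k ℤ.- + 1) <ᶜ x) × (x ≤ᶜ fromℕ k)

-- Every flip is an independent fair coin.
data Rand (A : Set) : Set where
  return : A → Rand A
  flip   : (Bool → Rand A) → Rand A

infixl 1 _>>=_

_>>=_ : {A B : Set} → Rand A → (A → Rand B) → Rand B
return a >>= f = f a
flip k   >>= f = flip (λ b → k b >>= f)

coin : Rand Bool
coin = flip return

replicateᴿ : {A : Set} (n : ℕ) → Rand A → Rand (Vec A n)
replicateᴿ zero    m = return []
replicateᴿ (suc n) m = do
  a  ← m
  as ← replicateᴿ n m
  return (a ∷ as)

prob : {A : Set} → Rand A → (A → Bool) → ℚ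
prob (return a) D = if D a then 1ℚ else 0ℚ
prob (flip k)   D = ½ ℚ.* (prob (k false) D ℚ.+ prob (k true) D)

-- Probability of an event that need not be decidable, as a real number:
-- approximated from inside and from outside by decidable events.  For a
-- decidable event this is the cut of the rational number `prob`.
Pr : {A : Set} → Rand A → (A → Set) → Cut
Pr {A} m E =
    (λ q → Σ[ D ∈ (A → Bool) ] ((∀ a → T (D a) → E a) × q ℚ.< prob m D))
  ∣ (λ q → Σ[ D ∈ (A → Bool) ] ((∀ a → E a → T (D a)) × prob m D ℚ.< q))

Assignment : ℕ → Set
Assignment n = Vec Bool n

data Literal (n : ℕ) : Set where
  pos neg : Fin n → Literal n

Clause : ℕ → Set
Clause n = List (Literal n)

CNF : ℕ → Set
CNF n = List (Clause n)

-- (a₀ , a) stands for the affine map y ↦ a₀ ⊕ ⨁ₖ aₖ · yₖ.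
Affine : ℕ → Set
Affine n = Bool × Vec Bool n

-- (f , b) stands for the constraint f(z) = b.
XorConstraint : ℕ → Set
XorConstraint n = Affine n × Bool

record Formula (n : ℕ) : Set where
  constructor _&_
  field
    clauses : CNF n
    xors    : List (XorConstraint n)

fromCNF : ∀ {n} → CNF n → Formula n
fromCNF F = F & []

evalLiteral : ∀ {n} → Assignment n → Literal n → Bool
evalLiteral y (pos v) = lookup y v
evalLiteral y (neg v) = not (lookup y v)

evalCNF : ∀ {n} → Assignment n → CNF n → Bool
evalCNF y = List.all (List.any (evalLiteral y))

evalAffine : ∀ {n} → Affine n → Assignment n → Bool
evalAffine (a₀ , a) y = a₀ xor Vec.foldr′ _xor_ false (Vec.zipWith _∧_ a y)

evalXor : ∀ {n} → Assignment n → XorConstraint n → Bool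
evalXor y (f , b) = not (evalAffine f y xor b)

eval : ∀ {n} → Assignment n → Formula n → Bool
eval y (cs & xs) = evalCNF y cs ∧ List.all (evalXor y) xs

assignments : ∀ n → List (Assignment n)
assignments zero    = [] ∷ []
assignments (suc n) = List.map (false ∷_) (assignments n) ++ List.map (true ∷_) (assignments n)

solutions : ∀ {n} → Formula n → List (Assignment n)
solutions {n} G = filterᵇ (λ y → eval y G) (assignments n)

# : ∀ {n} → Formula n → ℕ
# G = length (solutions G)

record BoundedSAT (n : ℕ) : Set where
  field
    solve  : Formula n → ℕ → List (Assignment n)
    unique : ∀ G r → Unique (solve G r)
    sound  : ∀ G r → All (λ y → T (eval y G)) (solve G r)
    size   : ∀ G r → length (solve G r) ≡ r ⊓ # G

Hash : ℕ → ℕ → Set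
Hash n m = Vec (Affine n) m

randomBits : ∀ m → Rand (Vec Bool m)
randomBits m = replicateᴿ m coin

randomHash : ∀ n m → Rand (Hash n m)
randomHash n m = replicateᴿ m do
  a₀ ← coin
  a  ← randomBits n
  return (a₀ , a)

_hashesTo_ : ∀ {n m} → Hash n m → Vec Bool m → List (XorConstraint n)
h hashesTo α = Vec.toList (Vec.zip h α)

-- `nothing` plays the role of the failure value ⊥.
module Core {n : ℕ} (B : BoundedSAT n) (F : CNF n) (pivot : ℕ) where
  open BoundedSAT B

  l : ℕ
  l = ⌊log₂ pivot ⌋ ∸ 1

  inRange : List (Assignment n) → Bool
  inRange S = (1 ≤ᵇ length S) ∧ (length S ≤ᵇ pivot)

  sample : ℕ → Rand (List (Assignment n))
  sample i = do
    h ← randomHash n (i ∸ l)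
    α ← randomBits (i ∸ l)
    return (solve (F & (h hashesTo α)) (pivot + 1))

  -- The first argument is the number n − i of further iterations allowed;
  -- the result consists of the final values of S and i.
  loop : ℕ → ℕ → Rand (List (Assignment n) × ℕ)
  loop zero i = do
    S ← sample i
    return (S , i)
  loop (suc r) i = do
    S ← sample i
    if inRange S then return (S , i) else loop r (suc i)

  -- Step 2 is only reached when 2ⁿ ≥ #F > pivot, so that l < n.
  approxMCCore : Rand (Maybe ℕ)
  approxMCCore =
    let S₀ = solve (fromCNF F) (pivot + 1) in
    if length S₀ ≤ᵇ pivot
      then return (just (length S₀))
      else do
        (S , i) ← loop (n ∸ l) l
        return (if inRange S then just (length S * 2 ^ (i ∸ l)) else nothing)

open Core public using (approxMCCore)

nth : List ℕ → ℕ → Maybe ℕ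
nth xs k = List.head (List.drop k xs)

-- The mean of the two middle entries of the sorted list (which coincide if
-- its length is odd); `nothing` for the empty list.
median : List ℕ → Maybe ℚ
median xs = Maybe.zipWith (λ a b → + (a + b) ℚ./ 2)
  (nth (sort xs) ((length xs ∸ 1) ℕ./ 2))
  (nth (sort xs) (length xs ℕ./ 2))

IsPivot : Cut → ℕ → Set
IsPivot ε pivot = ∃[ k ]
  (IsCeiling (fromℕ 3 *ᶜ exp ½ *ᶜ (fromℕ 1 +ᶜ fromℕ 1 /ᶜ ε) ^ᶜ 2) k × pivot ≡ 2 * k)

IsIterations : Cut → ℕ → Set
IsIterations δ t = IsCeiling (fromℕ 35 *ᶜ log₂ (fromℕ 3 /ᶜ δ)) t

-- Ceilings of reals are not computable, so ε and δ enter only through the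
-- integers pivot and t that they determine by `IsPivot` and `IsIterations`.
approxMC : ∀ {n} → BoundedSAT n → CNF n → (pivot t : ℕ) → Rand (Maybe ℚ)
approxMC B F pivot t = do
  cs ← replicateᴿ t (approxMCCore B F pivot)
  return (median (catMaybes (Vec.toList cs)))

Within : Cut → ℕ → Maybe ℚ → Set
Within ε N nothing  = ⊥
Within ε N (just c) =
    (inv (fromℕ 1 +ᶜ ε) *ᶜ fromℕ N ≤ᶜ fromℚ c)
  × (fromℚ c ≤ᶜ (fromℕ 1 +ᶜ ε) *ᶜ fromℕ N)

{-# OPTIONS --safe #-}
module Submission where

-- The median of the answers can be wrong only if at least half of the runs answer too low or ⊥, or at least half answer
-- too high or ⊥; so it suffices that each of these two errors has probability at most 2/5 in a single run.  The two errors
-- are bounded separately because the resulting bound for their union is too large for 35 log₂(3/δ) repetitions.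
--
-- Let k = pivot/2 and let μ = #F / 2ᵐ be the mean size of the random cell in the round with m hash bits.  By Parseval the
-- size X of the cell satisfies E (X - μ)² ≤ μ, whence E (X - c)² ≤ μ + (μ - c)² for every centre c, and with
-- β = ε/(1+ε) the choice of pivot gives 1 ≤ (13/64) β² k.  An early round errs with probability at most
-- (13/64)k / (μ + (13/64)k) (Cantelli).  In the first round with μ near k, an interval of half-width β(k + μ)/2 around an
-- off-mean centre controls the error and the event of not stopping at once.  Multiplying the success probabilities from
-- this round backwards, μ doubling each time, never falls below 3/5.

open import Defs
open import Data.Nat.Base using (ℕ)
open import Algebra.Bundles using (CommutativeRing)
open import Data.Bool.Base using (Bool; true; false; if_then_else_; not; _∧_; _xor_; T)
open import Data.Bool.ListAction using (all)
open import Data.Bool.Properties using (∧-assoc; ∧-identityʳ; not-involutive)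
open import Data.Empty using (⊥)
open import Data.Integer.Base as ℤ using (+_; -[1+_])
import Data.Integer.Properties as ℤ
open import Data.List.Base using (List; []; _∷_; _++_; catMaybes; filterᵇ; length; map)
open import Data.List.Properties using (length-++; length-map)
open import Data.List.Relation.Binary.Permutation.Propositional using (_↭_)
open import Data.List.Relation.Binary.Permutation.Propositional.Properties using (filter-↭; ↭-length)
open import Data.List.Relation.Unary.All as All using (All; []; _∷_)
open import Data.List.Relation.Unary.AllPairs using (AllPairs; []; _∷_)
open import Data.List.Relation.Unary.Linked.Properties using (Linked⇒AllPairs)
import Data.List.Sort as Sort
open import Data.Maybe.Base using (Maybe; just; nothing)
open import Data.Nat.Base as ℕ using (zero; suc; ⌊_/2⌋; ⌈_/2⌉)
open import Data.Nat.Coprimality as Coprime using (Coprime; 1-coprimeTo)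
open import Data.Nat.DivMod using (m/n*n≤m; m≡m%n+[m/n]*n; m%n<n)
open import Data.Nat.Induction using (<-rec)
open import Data.Nat.Logarithm using (⌊log₂_⌋; ⌊log₂⌊n/2⌋⌋≡⌊log₂n⌋∸1; ⌊log₂[2*b]⌋≡1+⌊log₂b⌋)
import Data.Nat.Properties as ℕ
open import Data.Product.Base using (∃-syntax; _×_; _,_; proj₁; proj₂)
open import Data.Rational.Base
open import Data.Rational.Properties
open import Data.Rational.Unnormalised.Base as ℚᵘ using (mkℚᵘ)
import Data.Rational.Unnormalised.Properties as ℚᵘ
open import Data.Sum.Base as Sum using (_⊎_; inj₁; inj₂)
open import Data.Vec.Base as Vec using (Vec; []; _∷_)
open import Relation.Binary.Definitions using (tri≈; tri>)
open import Relation.Binary.PropositionalEquality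
open import Relation.Nullary.Decidable using (Dec; yes; no; does; dec⇒maybe; toWitness)
open import Relation.Nullary.Negation using (¬_; contradiction)
open import Tactic.RingSolver using (solve-∀)
open import Tactic.RingSolver.Core.AlmostCommutativeRing using (AlmostCommutativeRing; fromCommutativeRing)
open import Algebra.Properties.CommutativeSemiring.Exp (CommutativeRing.commutativeSemiring +-*-commutativeRing)
  using (_^_; ^-assocʳ; ^-distrib-*)
open Sort ℕ.≤-decTotalOrder using (sort; sort-↭; sort-↗)

-- The two errors behave differently while the mean is still large. A value that is too high needs
-- an accepted cell larger than its mean, which is impossible while the mean exceeds 2k; so at most
-- one early round costs anything. A value that is too low can be returned in every early round, so
-- those losses multiply, and a quantitative invariant has to be carried. The windows for the
-- decisive round, 3/4 ≤ μ/k ≤ 3/2 for low and 2/3 ≤ μ/k ≤ 4/3 for high errors, are closed with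
-- ratio two, so a mean that halves cannot jump over them. The order on the reals is undecidable, so
-- all probability is done in ℚ: ε is replaced by a rational `e` below it, δ by a rational above it,
-- and the event by the decidable `accept`. The cuts built with `exp`, `log₂` and products are never
-- shown to be real numbers; rational enclosures are pushed through their defining formulas instead.

ℚ-ring : AlmostCommutativeRing _ _
ℚ-ring = fromCommutativeRing +-*-commutativeRing (λ x → dec⇒maybe (0ℚ ≟ x))

-- Order and field arithmetic in ℚ

module _ {a b : ℚ} where

  +-nonNeg : 0ℚ ≤ a → 0ℚ ≤ b → 0ℚ ≤ a + b
  +-nonNeg p q = +-mono-≤ p q

  *-nonNeg : 0ℚ ≤ a → 0ℚ ≤ b → 0ℚ ≤ a * b
  *-nonNeg p q = subst (_≤ a * b) (*-zeroʳ a) (*-monoˡ-≤-nonNeg a {{nonNegative p}} q)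

  +-pos : 0ℚ < a → 0ℚ < b → 0ℚ < a + b
  +-pos p q = +-mono-< p q

  *-pos : 0ℚ < a → 0ℚ < b → 0ℚ < a * b
  *-pos p q = subst (_< a * b) (*-zeroʳ a) (*-monoʳ-<-pos a {{positive p}} q)

  ≤⇒0≤- : a ≤ b → 0ℚ ≤ b - a
  ≤⇒0≤- p = subst (_≤ b - a) (+-inverseʳ a) (+-monoˡ-≤ (- a) p)

  <⇒0<- : a < b → 0ℚ < b - a
  <⇒0<- p = subst (_< b - a) (+-inverseʳ a) (+-monoˡ-< (- a) p)

  ≤-diff : ∀ {d} → 0ℚ ≤ d → b ≡ a + d → a ≤ b
  ≤-diff p refl = subst (_≤ a + _) (+-identityʳ a) (+-monoʳ-≤ a p)

  <-diff : ∀ {d} → 0ℚ < d → b ≡ a + d → a < b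
  <-diff p refl = subst (_< a + _) (+-identityʳ a) (+-monoʳ-< a p)

square-nonNeg : ∀ a → 0ℚ ≤ a * a
square-nonNeg a with ≤-total 0ℚ a
... | inj₁ p = *-nonNeg p p
... | inj₂ p = subst (0ℚ ≤_) (eq a) (*-nonNeg (≤⇒0≤- p) (≤⇒0≤- p))
  where
  eq : ∀ a → (0ℚ - a) * (0ℚ - a) ≡ a * a
  eq = solve-∀ ℚ-ring

*-cancelˡ-≤ : ∀ {c a b} → 0ℚ < c → c * a ≤ c * b → a ≤ b
*-cancelˡ-≤ {c} p = *-cancelˡ-≤-pos c {{positive p}}

*-monoˡ-≤ : ∀ {c a b} → 0ℚ ≤ c → a ≤ b → c * a ≤ c * b
*-monoˡ-≤ {c} p = *-monoˡ-≤-nonNeg c {{nonNegative p}}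

*-mono-≤ : ∀ {a b c d} → 0ℚ ≤ a → 0ℚ ≤ c → a ≤ b → c ≤ d → a * c ≤ b * d
*-mono-≤ {a} {b} {c} {d} 0≤a 0≤c p q =
  ≤-trans (*-monoˡ-≤-nonNeg a {{nonNegative 0≤a}} q) (*-monoʳ-≤-nonNeg d {{nonNegative (≤-trans 0≤c q)}} p)

*-monoʳ-< : ∀ {c a b} → 0ℚ < c → a < b → c * a < c * b
*-monoʳ-< {c} p = *-monoʳ-<-pos c {{positive p}}

*-cancelˡ-< : ∀ {c a b} → 0ℚ ≤ c → c * a < c * b → a < b
*-cancelˡ-< {c} p = *-cancelˡ-<-nonNeg c {{nonNegative p}}

0≤½ : 0ℚ ≤ ½
0≤½ = nonNegative⁻¹ ½

0<½ : 0ℚ < ½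
0<½ = positive⁻¹ ½

0≤1 : 0ℚ ≤ 1ℚ
0≤1 = nonNegative⁻¹ 1ℚ

0<1 : 0ℚ < 1ℚ
0<1 = positive⁻¹ 1ℚ

reciprocal : ∀ {a} → 0ℚ < a → ∃[ b ] (0ℚ < b × b * a ≡ 1ℚ)
reciprocal {a} p = 1/ a , positive⁻¹ _ {{1/pos⇒pos a}} , *-inverseˡ a
  where
  instance
    _ = positive p
    _ = pos⇒nonZero a

^-nonNeg : ∀ {a} → 0ℚ ≤ a → ∀ n → 0ℚ ≤ a ^ n
^-nonNeg p zero = 0≤1
^-nonNeg p (suc n) = *-nonNeg p (^-nonNeg p n)

^-pos : ∀ {a} → 0ℚ < a → ∀ n → 0ℚ < a ^ n
^-pos p zero = 0<1
^-pos p (suc n) = *-pos p (^-pos p n)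

^-mono-≤ : ∀ {a b} → 0ℚ ≤ a → a ≤ b → ∀ n → a ^ n ≤ b ^ n
^-mono-≤ p q zero = ≤-refl
^-mono-≤ p q (suc n) = *-mono-≤ p (^-nonNeg p n) q (^-mono-≤ p q n)

^-cancel-< : ∀ {a b} → 0ℚ ≤ b → ∀ n → a ^ n < b ^ n → a < b
^-cancel-< {a} {b} 0≤b n p with b ≤? a
... | yes q = contradiction (<-≤-trans p (^-mono-≤ 0≤b q n)) (<-irrefl refl)
... | no q = ≰⇒> q

^-mono-< : ∀ {a b} → 0ℚ ≤ a → a < b → ∀ n → a ^ suc n < b ^ suc n
^-mono-< {a} {b} p q n = ≤-<-trans (*-monoˡ-≤ p (^-mono-≤ p (<⇒≤ q) n))
  (*-monoˡ-<-pos (b ^ n) {{positive (^-pos (≤-<-trans p q) n)}} q)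

^-cancel-≤ : ∀ {a b} → 0ℚ ≤ b → ∀ n → a ^ suc n ≤ b ^ suc n → a ≤ b
^-cancel-≤ {a} {b} 0≤b n p with a ≤? b
... | yes q = q
... | no q = contradiction (≤-<-trans p (^-mono-< 0≤b (≰⇒> q) n)) (<-irrefl refl)

1^ : ∀ n → 1ℚ ^ n ≡ 1ℚ
1^ zero = refl
1^ (suc n) = trans (*-identityˡ _) (1^ n)

-- Natural numbers inside ℚ

fromNat : ℕ → ℚ
fromNat n = + n / 1

toℚᵘ-fromNat : ∀ n → toℚᵘ (fromNat n) ℚᵘ.≃ mkℚᵘ (+ n) 0
toℚᵘ-fromNat n = toℚᵘ-fromℚᵘ (mkℚᵘ (+ n) 0)

fromNat-+ : ∀ m n → fromNat (m ℕ.+ n) ≡ fromNat m + fromNat n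
fromNat-+ m n = toℚᵘ-injective (begin
  toℚᵘ (fromNat (m ℕ.+ n))                ≈⟨ toℚᵘ-fromNat (m ℕ.+ n) ⟩
  mkℚᵘ (+ (m ℕ.+ n)) 0                    ≈⟨ ℚᵘ.*≡* (cong (ℤ._* + 1) (cong₂ ℤ._+_ (sym (ℤ.*-identityʳ (+ m))) (sym (ℤ.*-identityʳ (+ n))))) ⟩
  mkℚᵘ (+ m) 0 ℚᵘ.+ mkℚᵘ (+ n) 0          ≈⟨ ℚᵘ.+-cong (toℚᵘ-fromNat m) (toℚᵘ-fromNat n) ⟨
  toℚᵘ (fromNat m) ℚᵘ.+ toℚᵘ (fromNat n)  ≈⟨ toℚᵘ-homo-+ (fromNat m) (fromNat n) ⟨
  toℚᵘ (fromNat m + fromNat n)            ∎)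
  where open ℚᵘ.≃-Reasoning

fromNat-* : ∀ m n → fromNat (m ℕ.* n) ≡ fromNat m * fromNat n
fromNat-* m n = toℚᵘ-injective (begin
  toℚᵘ (fromNat (m ℕ.* n))                ≈⟨ toℚᵘ-fromNat (m ℕ.* n) ⟩
  mkℚᵘ (+ (m ℕ.* n)) 0                    ≈⟨ ℚᵘ.*≡* (cong (ℤ._* + 1) (ℤ.pos-* m n)) ⟩
  mkℚᵘ (+ m) 0 ℚᵘ.* mkℚᵘ (+ n) 0          ≈⟨ ℚᵘ.*-cong (toℚᵘ-fromNat m) (toℚᵘ-fromNat n) ⟨
  toℚᵘ (fromNat m) ℚᵘ.* toℚᵘ (fromNat n)  ≈⟨ toℚᵘ-homo-* (fromNat m) (fromNat n) ⟨
  toℚᵘ (fromNat m * fromNat n)            ∎)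
  where open ℚᵘ.≃-Reasoning

fromNat-^ : ∀ m n → fromNat (m ℕ.^ n) ≡ fromNat m ^ n
fromNat-^ m zero = refl
fromNat-^ m (suc n) = trans (fromNat-* m (m ℕ.^ n)) (cong (fromNat m *_) (fromNat-^ m n))

fromNat-suc : ∀ n → fromNat (suc n) ≡ 1ℚ + fromNat n
fromNat-suc = fromNat-+ 1

/-*-cancel : ∀ m n → (+ m / suc n) * fromNat (suc n) ≡ fromNat m
/-*-cancel m n = toℚᵘ-injective (begin
  toℚᵘ ((+ m / suc n) * fromNat (suc n))               ≈⟨ toℚᵘ-homo-* (+ m / suc n) (fromNat (suc n)) ⟩
  toℚᵘ (+ m / suc n) ℚᵘ.* toℚᵘ (fromNat (suc n))       ≈⟨ ℚᵘ.*-cong (toℚᵘ-fromℚᵘ (mkℚᵘ (+ m) n)) (toℚᵘ-fromNat (suc n)) ⟩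
  mkℚᵘ (+ m) n ℚᵘ.* mkℚᵘ (+ suc n) 0                   ≈⟨ ℚᵘ.*≡* (trans (ℤ.*-identityʳ _) (cong (λ z → + m ℤ.* + z) (sym (ℕ.*-identityʳ (suc n))))) ⟩
  mkℚᵘ (+ m) 0                                         ≈⟨ toℚᵘ-fromNat m ⟨
  toℚᵘ (fromNat m)                                     ∎)
  where open ℚᵘ.≃-Reasoning

fromNat-mono-≤ : ∀ {m n} → m ℕ.≤ n → fromNat m ≤ fromNat n
fromNat-mono-≤ {m} {n} p = toℚᵘ-cancel-≤ (begin
  toℚᵘ (fromNat m)  ≃⟨ toℚᵘ-fromNat m ⟩
  mkℚᵘ (+ m) 0      ≤⟨ ℚᵘ.*≤* (ℤ.*-monoʳ-≤-nonNeg (+ 1) (ℤ.+≤+ p)) ⟩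
  mkℚᵘ (+ n) 0      ≃⟨ toℚᵘ-fromNat n ⟨
  toℚᵘ (fromNat n)  ∎)
  where open ℚᵘ.≤-Reasoning

fromNat-mono-< : ∀ {m n} → m ℕ.< n → fromNat m < fromNat n
fromNat-mono-< {m} {n} p = <-≤-trans (<-diff 0<1 (trans (fromNat-suc m) (+-comm 1ℚ (fromNat m)))) (fromNat-mono-≤ p)

fromNat-cancel-≤ : ∀ {m n} → fromNat m ≤ fromNat n → m ℕ.≤ n
fromNat-cancel-≤ {m} {n} p with m ℕ.≤? n
... | yes q = q
... | no q = contradiction (<-≤-trans (fromNat-mono-< (ℕ.≰⇒> q)) p) (<-irrefl refl)

fromNat-cancel-< : ∀ {m n} → fromNat m < fromNat n → m ℕ.< n
fromNat-cancel-< {m} {n} p with m ℕ.<? n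
... | yes q = q
... | no q = contradiction (<-≤-trans p (fromNat-mono-≤ (ℕ.≮⇒≥ q))) (<-irrefl refl)

fromNat-nonNeg : ∀ n → 0ℚ ≤ fromNat n
fromNat-nonNeg n = fromNat-mono-≤ (ℕ.z≤n {n})

archimedean : ∀ q → ∃[ n ] (q ≤ fromNat n)
archimedean q@(mkℚ (+ m) d _) = m , toℚᵘ-cancel-≤ (begin
  mkℚᵘ (+ m) d      ≤⟨ ℚᵘ.*≤* (ℤ.*-monoˡ-≤-nonNeg (+ m) (ℤ.+≤+ (ℕ.s≤s (ℕ.z≤n {d})))) ⟩
  mkℚᵘ (+ m) 0      ≃⟨ toℚᵘ-fromNat m ⟨
  toℚᵘ (fromNat m)  ∎)
  where open ℚᵘ.≤-Reasoning
archimedean q@(mkℚ -[1+ m ] d _) = 0 , <⇒≤ (negative⁻¹ q)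

-- The source of every small perturbation in the arguments about cuts; the witness is 1/(2 + M/η).
small : ∀ M η → 0ℚ ≤ M → 0ℚ < η → ∃[ s ] (0ℚ < s × s ≤ ½ × s * M ≤ η)
small M η 0≤M 0<η = go (reciprocal 0<η)
  where
  go : ∃[ ι ] (0ℚ < ι × ι * η ≡ 1ℚ) → ∃[ s ] (0ℚ < s × s ≤ ½ × s * M ≤ η)
  go (ι , 0<ι , ιη≡1) = go′ (reciprocal (<-≤-trans (+-pos 0<1 0<1) (≤-diff 0≤Mι refl)))
    where
    0≤Mι : 0ℚ ≤ M * ι
    0≤Mι = *-nonNeg 0≤M (<⇒≤ 0<ι)
    e₁ : ∀ s m → ½ * (s * (1ℚ + 1ℚ + m)) ≡ s + ½ * (s * m)
    e₁ = solve-∀ ℚ-ring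
    e₂ : ∀ s M ι η → s * (1ℚ + 1ℚ + M * ι) * η ≡ s * M * (ι * η) + (1ℚ + 1ℚ) * s * η
    e₂ = solve-∀ ℚ-ring
    go′ : ∃[ s ] (0ℚ < s × s * (1ℚ + 1ℚ + M * ι) ≡ 1ℚ) → ∃[ s ] (0ℚ < s × s ≤ ½ × s * M ≤ η)
    go′ (s , 0<s , eq) = s , 0<s
      , ≤-diff (*-nonNeg 0≤½ (*-nonNeg (<⇒≤ 0<s) 0≤Mι))
          (trans (sym (*-identityʳ ½)) (trans (cong (½ *_) (sym eq)) (e₁ s (M * ι))))
      , ≤-diff (*-nonNeg (*-nonNeg (+-nonNeg 0≤1 0≤1) (<⇒≤ 0<s)) (<⇒≤ 0<η))
          (trans (sym (*-identityˡ η)) (trans (cong (_* η) (sym eq)) (trans (e₂ s M ι η)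
            (cong (_+ (1ℚ + 1ℚ) * s * η) (trans (cong (s * M *_) ιη≡1) (*-identityʳ (s * M)))))))

-- Polynomial inequalities governing the rounds

-- The last hypothesis is a second-moment bound for half-width h = β (μ + w) about a centre at
-- distance β w from the mean. In h² - (β w)² the term w² cancels, leaving β² μ (μ + 2w); the
-- variance μ is absorbed by 1 ≤ (13/64) β² k, and β² divides out.
master-inequality : ∀ {β k μ w u E} → 0ℚ < β → 1ℚ ≤ + 13 / 64 * (β * β * k) → 0ℚ ≤ μ → u ≤ 1ℚ →
  β * (μ + w) * (β * (μ + w)) * E ≤ β * (μ + w) * (β * (μ + w)) * u + (1ℚ - u) * (μ + β * w * (β * w)) →
  (1ℚ - u) * (μ * (μ + (1ℚ + 1ℚ) * w - + 13 / 64 * k)) ≤ (μ + w) * (μ + w) * (1ℚ - E)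
master-inequality {β} {k} {μ} {w} {u} {E} 0<β βk 0≤μ u≤1 h = *-cancelˡ-≤ (*-pos 0<β 0<β)
  (≤-diff (+-nonNeg (≤⇒0≤- h) (*-nonNeg (≤⇒0≤- u≤1) (*-nonNeg 0≤μ (≤⇒0≤- βk)))) (eq β k μ w u E))
  where
  eq : ∀ β k μ w u E → β * β * ((μ + w) * (μ + w) * (1ℚ - E)) ≡
    β * β * ((1ℚ - u) * (μ * (μ + (1ℚ + 1ℚ) * w - + 13 / 64 * k)))
    + (β * (μ + w) * (β * (μ + w)) * u + (1ℚ - u) * (μ + β * w * (β * w)) - β * (μ + w) * (β * (μ + w)) * E
       + (1ℚ - u) * (μ * (+ 13 / 64 * (β * β * k) - 1ℚ)))
  eq = solve-∀ ℚ-ring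

-- A lower bound on the probability G that the answer is not too low, for the loop entered at mean μ.  In x = k/μ it reads G ≥ 3/5 (1 + 13x/64 + x²/64);
-- the quadratic was chosen to absorb the product of the factors 1 + 13x/(64·2ʲ), j ≥ 1, lost in the rounds that precede.
LowInvariant : ℚ → ℚ → ℚ → Set
LowInvariant k μ G = + 3 / 320 * (fromNat 64 * (μ * μ) + fromNat 13 * (k * μ) + k * k) ≤ μ * μ * G

-- Once the hypothesis on `G` is used, what remains is a quartic form in k and μ. Written in x = 4μ
-- - 3k and y = 3k - 2μ, both nonnegative on the window, it has only nonnegative coefficients.
low-base : ∀ {k μ G} → 0ℚ < k → fromNat 3 * k ≤ fromNat 4 * μ → fromNat 2 * μ ≤ fromNat 3 * k →
  + 51 / 16 * (k * μ) ≤ (k + μ) * (k + μ) * G → LowInvariant k μ G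
low-base {k} {μ} {G} 0<k lo hi h = *-cancelˡ-≤ (*-pos 0<k+μ 0<k+μ)
  (≤-diff (+-nonNeg (*-nonNeg (square-nonNeg μ) (≤⇒0≤- h))
     (*-nonNeg (nonNegative⁻¹ (+ 1 / 138240)) (+-nonNeg (+-nonNeg (+-nonNeg (+-nonNeg
        (*-nonNeg (fromNat-nonNeg 1910) (*-nonNeg 0≤xx 0≤xx))
        (*-nonNeg (fromNat-nonNeg 10690) (*-nonNeg 0≤xx 0≤xy)))
        (*-nonNeg (fromNat-nonNeg 16158) (*-nonNeg 0≤xx 0≤yy)))
        (*-nonNeg (fromNat-nonNeg 7462) (*-nonNeg 0≤xy 0≤yy)))
        (*-nonNeg (fromNat-nonNeg 68) (*-nonNeg 0≤yy 0≤yy)))))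
     (eq k μ G))
  where
  0<μ : 0ℚ < μ
  0<μ = *-cancelˡ-< (fromNat-nonNeg 4) (<-≤-trans (*-pos (fromNat-mono-< {0} {3} (ℕ.s≤s ℕ.z≤n)) 0<k) lo)
  0<k+μ = +-pos 0<k 0<μ
  0≤xx = *-nonNeg (≤⇒0≤- lo) (≤⇒0≤- lo)
  0≤xy = *-nonNeg (≤⇒0≤- lo) (≤⇒0≤- hi)
  0≤yy = *-nonNeg (≤⇒0≤- hi) (≤⇒0≤- hi)
  eq : ∀ k μ G → let x = fromNat 4 * μ - fromNat 3 * k ; y = fromNat 3 * k - fromNat 2 * μ in
    (k + μ) * (k + μ) * (μ * μ * G) ≡
    (k + μ) * (k + μ) * (+ 3 / 320 * (fromNat 64 * (μ * μ) + fromNat 13 * (k * μ) + k * k))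
    + (μ * μ * ((k + μ) * (k + μ) * G - + 51 / 16 * (k * μ))
       + + 1 / 138240 * (fromNat 1910 * (x * x * (x * x)) + fromNat 10690 * (x * x * (x * y))
          + fromNat 16158 * (x * x * (y * y)) + fromNat 7462 * (x * y * (y * y)) + fromNat 68 * (y * y * (y * y))))
  eq = solve-∀ ℚ-ring

-- Halving μ doubles x = k/μ. With Q(x) = 1 + 13x/64 + x²/64, the difference Q(2x) - (1 + 13x/64)
-- Q(x) is x² (23 - 13x)/4096, which is nonnegative since x ≤ 2/3.
low-step : ∀ {k μ G G′} → 0ℚ < k → fromNat 3 * k ≤ fromNat 2 * μ → LowInvariant k (μ * ½) G′ →
  μ * G′ ≤ (μ + + 13 / 64 * k) * G → LowInvariant k μ G
low-step {k} {μ} {G} {G′} 0<k lo inv h = *-cancelˡ-≤ (+-pos 0<μ (*-pos (positive⁻¹ (+ 13 / 64)) 0<k))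
  (≤-diff (+-nonNeg (+-nonNeg (*-nonNeg (square-nonNeg μ) (≤⇒0≤- h))
      (*-nonNeg (*-nonNeg (fromNat-nonNeg 4) (<⇒≤ 0<μ)) (≤⇒0≤- inv)))
      (*-nonNeg (square-nonNeg k) (+-nonNeg (*-nonNeg (nonNegative⁻¹ (+ 69 / 40960)) (≤⇒0≤- lo))
         (*-nonNeg (nonNegative⁻¹ (+ 129 / 40960)) (<⇒≤ 0<k)))))
     (eq k μ G G′))
  where
  0<μ : 0ℚ < μ
  0<μ = *-cancelˡ-< (fromNat-nonNeg 2) (<-≤-trans (*-pos (fromNat-mono-< {0} {3} (ℕ.s≤s ℕ.z≤n)) 0<k) lo)
  eq : ∀ k μ G G′ → (μ + + 13 / 64 * k) * (μ * μ * G) ≡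
    (μ + + 13 / 64 * k) * (+ 3 / 320 * (fromNat 64 * (μ * μ) + fromNat 13 * (k * μ) + k * k))
    + (μ * μ * ((μ + + 13 / 64 * k) * G - μ * G′)
      + fromNat 4 * μ * (μ * ½ * (μ * ½) * G′ - + 3 / 320 * (fromNat 64 * (μ * ½ * (μ * ½)) + fromNat 13 * (k * (μ * ½)) + k * k))
      + k * k * (+ 69 / 40960 * (fromNat 2 * μ - fromNat 3 * k) + + 129 / 40960 * k))
  eq = solve-∀ ℚ-ring

low-final : ∀ {k μ G} → 0ℚ ≤ k → 0ℚ < μ → LowInvariant k μ G → + 3 / 5 ≤ G
low-final {k} {μ} {G} 0≤k 0<μ inv = *-cancelˡ-≤ (*-pos 0<μ 0<μ)
  (≤-diff (+-nonNeg (≤⇒0≤- inv) (*-nonNeg (nonNegative⁻¹ (+ 3 / 320))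
     (+-nonNeg (*-nonNeg (fromNat-nonNeg 13) (*-nonNeg 0≤k (<⇒≤ 0<μ))) (*-nonNeg 0≤k 0≤k)))) (eq k μ G))
  where
  eq : ∀ k μ G → μ * μ * G ≡ μ * μ * (+ 3 / 5)
    + (μ * μ * G - + 3 / 320 * (fromNat 64 * (μ * μ) + fromNat 13 * (k * μ) + k * k)
      + + 3 / 320 * (fromNat 13 * (k * μ) + k * k))
  eq = solve-∀ ℚ-ring

-- Proving 3/4 instead of 3/5 leaves room for the one earlier round that can still answer too high.
high-base : ∀ {k μ G} → 0ℚ < k → fromNat 2 * k ≤ fromNat 3 * μ → fromNat 3 * μ ≤ fromNat 4 * k →
  + 51 / 16 * (k * μ) ≤ (k + μ) * (k + μ) * G → + 3 / 4 ≤ G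
high-base {k} {μ} {G} 0<k lo hi h = *-cancelˡ-≤ (*-pos 0<k+μ 0<k+μ)
  (≤-diff (+-nonNeg (≤⇒0≤- h) (+-nonNeg (*-nonNeg (nonNegative⁻¹ (+ 1 / 12)) (*-nonNeg (≤⇒0≤- lo) (≤⇒0≤- hi)))
      (*-nonNeg (<⇒≤ 0<k) (+-nonNeg (*-nonNeg (nonNegative⁻¹ (+ 1 / 16)) (≤⇒0≤- lo)) (*-nonNeg (nonNegative⁻¹ (+ 1 / 24)) (<⇒≤ 0<k))))))
     (eq k μ G))
  where
  0<μ : 0ℚ < μ
  0<μ = *-cancelˡ-< (fromNat-nonNeg 3) (<-≤-trans (*-pos (fromNat-mono-< {0} {2} (ℕ.s≤s ℕ.z≤n)) 0<k) lo)
  0<k+μ = +-pos 0<k 0<μ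
  eq : ∀ k μ G → (k + μ) * (k + μ) * G ≡ (k + μ) * (k + μ) * (+ 3 / 4)
    + ((k + μ) * (k + μ) * G - + 51 / 16 * (k * μ)
      + (+ 1 / 12 * ((fromNat 3 * μ - fromNat 2 * k) * (fromNat 4 * k - fromNat 3 * μ))
        + k * (+ 1 / 16 * (fromNat 3 * μ - fromNat 2 * k) + + 1 / 24 * k)))
  eq = solve-∀ ℚ-ring

high-step : ∀ {k μ G G′} → 0ℚ < k → fromNat 4 * k ≤ fromNat 3 * μ → + 3 / 4 ≤ G′ →
  μ * G′ ≤ (μ + + 13 / 64 * k) * G → + 3 / 5 ≤ G
high-step {k} {μ} {G} {G′} 0<k lo inv h = *-cancelˡ-≤ (+-pos 0<μ (*-pos (positive⁻¹ (+ 13 / 64)) 0<k))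
  (≤-diff (+-nonNeg (+-nonNeg (≤⇒0≤- h) (*-nonNeg (<⇒≤ 0<μ) (≤⇒0≤- inv)))
     (+-nonNeg (*-nonNeg (nonNegative⁻¹ (+ 1 / 20)) (≤⇒0≤- lo)) (*-nonNeg (nonNegative⁻¹ (+ 5 / 64)) (<⇒≤ 0<k)))) (eq k μ G G′))
  where
  0<μ : 0ℚ < μ
  0<μ = *-cancelˡ-< (fromNat-nonNeg 3) (<-≤-trans (*-pos (fromNat-mono-< {0} {4} (ℕ.s≤s ℕ.z≤n)) 0<k) lo)
  eq : ∀ k μ G G′ → (μ + + 13 / 64 * k) * G ≡ (μ + + 13 / 64 * k) * (+ 3 / 5)
    + ((μ + + 13 / 64 * k) * G - μ * G′ + μ * (G′ - + 3 / 4)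
      + (+ 1 / 20 * (fromNat 3 * μ - fromNat 4 * k) + + 5 / 64 * k))
  eq = solve-∀ ℚ-ring

-- Expectations

𝔼 : ∀ {A} → Rand A → (A → ℚ) → ℚ
𝔼 (return a) g = g a
𝔼 (flip k)   g = ½ * (𝔼 (k false) g + 𝔼 (k true) g)

indicator : Bool → ℚ
indicator b = if b then 1ℚ else 0ℚ

module _ {A : Set} where

  prob≡𝔼 : ∀ (m : Rand A) D → prob m D ≡ 𝔼 m (λ a → indicator (D a))
  prob≡𝔼 (return a) D = refl
  prob≡𝔼 (flip k)   D = cong (½ *_) (cong₂ _+_ (prob≡𝔼 (k false) D) (prob≡𝔼 (k true) D))

  𝔼->>= : ∀ {B} (m : Rand A) (f : A → Rand B) g → 𝔼 (m >>= f) g ≡ 𝔼 m (λ a → 𝔼 (f a) g)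
  𝔼->>= (return a) f g = refl
  𝔼->>= (flip k)   f g = cong (½ *_) (cong₂ _+_ (𝔼->>= (k false) f g) (𝔼->>= (k true) f g))

  𝔼-cong : ∀ (m : Rand A) {f g} → (∀ a → f a ≡ g a) → 𝔼 m f ≡ 𝔼 m g
  𝔼-cong (return a) p = p a
  𝔼-cong (flip k)   p = cong (½ *_) (cong₂ _+_ (𝔼-cong (k false) p) (𝔼-cong (k true) p))

  𝔼-mono : ∀ (m : Rand A) {f g} → (∀ a → f a ≤ g a) → 𝔼 m f ≤ 𝔼 m g
  𝔼-mono (return a) p = p a
  𝔼-mono (flip k)   p = *-monoˡ-≤ 0≤½ (+-mono-≤ (𝔼-mono (k false) p) (𝔼-mono (k true) p))

  𝔼-+ : ∀ (m : Rand A) f g → 𝔼 m (λ a → f a + g a) ≡ 𝔼 m f + 𝔼 m g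
  𝔼-+ (return a) f g = refl
  𝔼-+ (flip k)   f g = trans (cong (½ *_) (cong₂ _+_ (𝔼-+ (k false) f g) (𝔼-+ (k true) f g)))
    (eq (𝔼 (k false) f) (𝔼 (k false) g) (𝔼 (k true) f) (𝔼 (k true) g))
    where
    eq : ∀ a b c d → ½ * (a + b + (c + d)) ≡ ½ * (a + c) + ½ * (b + d)
    eq = solve-∀ ℚ-ring

  𝔼-* : ∀ (m : Rand A) c f → 𝔼 m (λ a → c * f a) ≡ c * 𝔼 m f
  𝔼-* (return a) c f = refl
  𝔼-* (flip k)   c f = trans (cong (½ *_) (cong₂ _+_ (𝔼-* (k false) c f) (𝔼-* (k true) c f)))
    (eq c (𝔼 (k false) f) (𝔼 (k true) f))
    where
    eq : ∀ c x y → ½ * (c * x + c * y) ≡ c * (½ * (x + y))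
    eq = solve-∀ ℚ-ring

  𝔼-const : ∀ (m : Rand A) c → 𝔼 m (λ _ → c) ≡ c
  𝔼-const (return a) c = refl
  𝔼-const (flip k)   c = trans (cong (½ *_) (cong₂ _+_ (𝔼-const (k false) c) (𝔼-const (k true) c))) (eq c)
    where
    eq : ∀ c → ½ * (c + c) ≡ c
    eq = solve-∀ ℚ-ring

  𝔼-affine : ∀ (m : Rand A) c d f → 𝔼 m (λ a → c + d * f a) ≡ c + d * 𝔼 m f
  𝔼-affine m c d f = trans (𝔼-+ m (λ _ → c) (λ a → d * f a)) (cong₂ _+_ (𝔼-const m c) (𝔼-* m d f))

𝔼-swap : ∀ {A B} (m : Rand A) (m′ : Rand B) (g : A → B → ℚ) →
  𝔼 m (λ a → 𝔼 m′ (g a)) ≡ 𝔼 m′ (λ b → 𝔼 m (λ a → g a b))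
𝔼-swap (return a) m′ g = refl
𝔼-swap (flip k)   m′ g = begin
  ½ * (𝔼 (k false) (λ a → 𝔼 m′ (g a)) + 𝔼 (k true) (λ a → 𝔼 m′ (g a)))
    ≡⟨ cong (½ *_) (cong₂ _+_ (𝔼-swap (k false) m′ g) (𝔼-swap (k true) m′ g)) ⟩
  ½ * (𝔼 m′ (λ b → 𝔼 (k false) (λ a → g a b)) + 𝔼 m′ (λ b → 𝔼 (k true) (λ a → g a b)))
    ≡⟨ cong (½ *_) (𝔼-+ m′ _ _) ⟨
  ½ * 𝔼 m′ (λ b → 𝔼 (k false) (λ a → g a b) + 𝔼 (k true) (λ a → g a b))
    ≡⟨ 𝔼-* m′ ½ _ ⟨
  𝔼 m′ (λ b → 𝔼 (flip k) (λ a → g a b))  ∎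
  where open ≡-Reasoning

𝔼-replicateᴿ-suc : ∀ {A} (m : Rand A) n g →
  𝔼 (replicateᴿ (suc n) m) g ≡ 𝔼 m (λ a → 𝔼 (replicateᴿ n m) (λ as → g (a ∷ as)))
𝔼-replicateᴿ-suc m n g = trans (𝔼->>= m _ g) (𝔼-cong m (λ a → 𝔼->>= (replicateᴿ n m) _ g))

-- Counting assignments

countᵇ : ∀ {A : Set} → (A → Bool) → List A → ℕ
countᵇ P xs = length (filterᵇ P xs)

module _ {A : Set} where

  countᵇ-cong : ∀ {P Q : A → Bool} → (∀ x → P x ≡ Q x) → ∀ xs → countᵇ P xs ≡ countᵇ Q xs
  countᵇ-cong p [] = refl
  countᵇ-cong {P} {Q} p (x ∷ xs) with P x | Q x | p x
  ... | true  | _ | refl = cong suc (countᵇ-cong p xs)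
  ... | false | _ | refl = countᵇ-cong p xs

  countᵇ-++ : ∀ (P : A → Bool) xs ys → countᵇ P (xs ++ ys) ≡ countᵇ P xs ℕ.+ countᵇ P ys
  countᵇ-++ P [] ys = refl
  countᵇ-++ P (x ∷ xs) ys with P x
  ... | true  = cong suc (countᵇ-++ P xs ys)
  ... | false = countᵇ-++ P xs ys

  countᵇ-map : ∀ {B : Set} (P : B → Bool) (f : A → B) xs → countᵇ P (map f xs) ≡ countᵇ (λ x → P (f x)) xs
  countᵇ-map P f [] = refl
  countᵇ-map P f (x ∷ xs) with P (f x)
  ... | true  = cong suc (countᵇ-map P f xs)
  ... | false = countᵇ-map P f xs

  countᵇ-not : ∀ (P Q : A → Bool) xs →
    countᵇ (λ x → P x ∧ Q x) xs ℕ.+ countᵇ (λ x → P x ∧ not (Q x)) xs ≡ countᵇ P xs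
  countᵇ-not P Q [] = refl
  countᵇ-not P Q (x ∷ xs) with P x | Q x
  ... | true  | true  = cong suc (countᵇ-not P Q xs)
  ... | true  | false = trans (ℕ.+-suc _ _) (cong suc (countᵇ-not P Q xs))
  ... | false | _     = countᵇ-not P Q xs

card : ∀ {n} → (Assignment n → Bool) → ℚ
card P = fromNat (countᵇ P (assignments _))

card-cong : ∀ {n} {P Q : Assignment n → Bool} → (∀ y → P y ≡ Q y) → card P ≡ card Q
card-cong p = cong fromNat (countᵇ-cong p (assignments _))

card-zero : ∀ (P : Assignment 0 → Bool) → card P ≡ indicator (P [])
card-zero P = trans (cong fromNat (count (P []) refl)) (embed (P []))
  where
  count : ∀ b → P [] ≡ b → countᵇ P ([] ∷ []) ≡ (if b then 1 else 0)
  count b refl with P []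
  ... | true  = refl
  ... | false = refl
  embed : ∀ b → fromNat (if b then 1 else 0) ≡ indicator b
  embed true  = refl
  embed false = refl

card-suc : ∀ {n} (P : Assignment (suc n) → Bool) → card P ≡ card (λ y → P (false ∷ y)) + card (λ y → P (true ∷ y))
card-suc {n} P = trans (cong fromNat (trans (countᵇ-++ P (map (false ∷_) ys) _)
    (cong₂ ℕ._+_ (countᵇ-map P (false ∷_) ys) (countᵇ-map P (true ∷_) ys))))
  (fromNat-+ (countᵇ (λ y → P (false ∷ y)) ys) (countᵇ (λ y → P (true ∷ y)) ys))
  where ys = assignments n

-- Pairwise independence of the hash family

_·_ : ∀ {n} → Vec Bool n → Assignment n → Bool
a · y = Vec.foldr′ _xor_ false (Vec.zipWith _∧_ a y)

half : ∀ {n} → (Assignment n → Bool) → Bool → Vec Bool n → ℚ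
half P s a = card (λ y → P y ∧ (s xor a · y))

-- The Walsh-Hadamard coefficient at `a` of the indicator of `P`: in `half`, the flag `true` selects
-- the assignments with a · y = 0.
bias : ∀ {n} → (Assignment n → Bool) → Vec Bool n → ℚ
bias P a = half P true a - half P false a

half-+ : ∀ {n} (P : Assignment n → Bool) a → half P false a + half P true a ≡ card P
half-+ P a = trans
  (sym (fromNat-+ (countᵇ (λ y → P y ∧ a · y) (assignments _)) (countᵇ (λ y → P y ∧ not (a · y)) (assignments _))))
  (cong fromNat (countᵇ-not P (a ·_) (assignments _)))

bias-false : ∀ {n} (P : Assignment (suc n) → Bool) a →
  bias P (false ∷ a) ≡ bias (λ y → P (false ∷ y)) a + bias (λ y → P (true ∷ y)) a
bias-false P a = trans (cong₂ _-_ (card-suc (λ y → P y ∧ not ((false ∷ a) · y))) (card-suc (λ y → P y ∧ (false ∷ a) · y)))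
  (eq (half P₀ true a) (half P₁ true a) (half P₀ false a) (half P₁ false a))
  where
  P₀ P₁ : Assignment _ → Bool
  P₀ y = P (false ∷ y)
  P₁ y = P (true ∷ y)
  eq : ∀ p q r s → p + q - (r + s) ≡ p - r + (q - s)
  eq = solve-∀ ℚ-ring

bias-true : ∀ {n} (P : Assignment (suc n) → Bool) a →
  bias P (true ∷ a) ≡ bias (λ y → P (false ∷ y)) a - bias (λ y → P (true ∷ y)) a
bias-true P a = trans (cong₂ _-_
    (trans (card-suc (λ y → P y ∧ not ((true ∷ a) · y)))
      (cong (λ z → half P₀ true a + z) (card-cong (λ y → cong (P₁ y ∧_) (not-involutive (a · y))))))
    (card-suc (λ y → P y ∧ (true ∷ a) · y)))
  (eq (half P₀ true a) (half P₁ false a) (half P₀ false a) (half P₁ true a))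
  where
  P₀ P₁ : Assignment _ → Bool
  P₀ y = P (false ∷ y)
  P₁ y = P (true ∷ y)
  eq : ∀ p q r s → p + q - (r + s) ≡ p - r - (s - q)
  eq = solve-∀ ℚ-ring

-- Prefixing a bit to `a` replaces the coefficients of the two halves of `P` by their sum or
-- difference, so the induction step is the parallelogram law.
parseval : ∀ {n} (P : Assignment n → Bool) → 𝔼 (randomBits n) (λ a → bias P a * bias P a) ≡ card P
parseval {zero} P = trans
  (cong (λ x → x * x) (cong₂ _-_ (card-zero (λ y → P y ∧ not ([] · y))) (card-zero (λ y → P y ∧ [] · y))))
  (trans (eq (P [])) (sym (card-zero P)))
  where
  eq : ∀ b → (indicator (b ∧ true) - indicator (b ∧ false)) * (indicator (b ∧ true) - indicator (b ∧ false)) ≡ indicator b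
  eq false = refl
  eq true  = refl
parseval {suc n} P = begin
  𝔼 (randomBits (suc n)) (λ a → bias P a * bias P a)
    ≡⟨ 𝔼-replicateᴿ-suc coin n _ ⟩
  ½ * (𝔼 (randomBits n) (λ a → bias P (false ∷ a) * bias P (false ∷ a)) + 𝔼 (randomBits n) (λ a → bias P (true ∷ a) * bias P (true ∷ a)))
    ≡⟨ cong (½ *_) (cong₂ _+_ (𝔼-cong (randomBits n) (λ a → cong (λ x → x * x) (bias-false P a)))
                              (𝔼-cong (randomBits n) (λ a → cong (λ x → x * x) (bias-true P a)))) ⟩
  ½ * (𝔼 (randomBits n) (λ a → (bias P₀ a + bias P₁ a) * (bias P₀ a + bias P₁ a))
       + 𝔼 (randomBits n) (λ a → (bias P₀ a - bias P₁ a) * (bias P₀ a - bias P₁ a)))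
    ≡⟨ cong (½ *_) (𝔼-+ (randomBits n) _ _) ⟨
  ½ * 𝔼 (randomBits n) (λ a → (bias P₀ a + bias P₁ a) * (bias P₀ a + bias P₁ a) + (bias P₀ a - bias P₁ a) * (bias P₀ a - bias P₁ a))
    ≡⟨ 𝔼-* (randomBits n) ½ _ ⟨
  𝔼 (randomBits n) (λ a → ½ * ((bias P₀ a + bias P₁ a) * (bias P₀ a + bias P₁ a) + (bias P₀ a - bias P₁ a) * (bias P₀ a - bias P₁ a)))
    ≡⟨ 𝔼-cong (randomBits n) (λ a → eq (bias P₀ a) (bias P₁ a)) ⟩
  𝔼 (randomBits n) (λ a → bias P₀ a * bias P₀ a + bias P₁ a * bias P₁ a)
    ≡⟨ 𝔼-+ (randomBits n) _ _ ⟩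
  𝔼 (randomBits n) (λ a → bias P₀ a * bias P₀ a) + 𝔼 (randomBits n) (λ a → bias P₁ a * bias P₁ a)
    ≡⟨ cong₂ _+_ (parseval P₀) (parseval P₁) ⟩
  card P₀ + card P₁
    ≡⟨ card-suc P ⟨
  card P ∎
  where
  open ≡-Reasoning
  P₀ P₁ : Assignment n → Bool
  P₀ y = P (false ∷ y)
  P₁ y = P (true ∷ y)
  eq : ∀ x y → ½ * ((x + y) * (x + y) + (x - y) * (x - y)) ≡ x * x + y * y
  eq = solve-∀ ℚ-ring

randomAffine : ∀ n → Rand (Affine n)
randomAffine n = do
  a₀ ← coin
  a  ← randomBits n
  return (a₀ , a)

restrict : ∀ {n} → (Assignment n → Bool) → XorConstraint n → Assignment n → Bool
restrict P x y = P y ∧ evalXor y x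

restrict-half : ∀ {n} (P : Assignment n → Bool) a₀ a b → card (restrict P ((a₀ , a) , b)) ≡ half P (not (a₀ xor b)) a
restrict-half P a₀ a b = card-cong (λ y → cong (P y ∧_) (eq a₀ b (a · y)))
  where
  eq : ∀ a₀ b z → not ((a₀ xor z) xor b) ≡ not (a₀ xor b) xor z
  eq false false false = refl
  eq false false true  = refl
  eq false true  false = refl
  eq false true  true  = refl
  eq true  false false = refl
  eq true  false true  = refl
  eq true  true  false = refl
  eq true  true  true  = refl

-- The fair offset a₀ makes both halves equally likely, whatever the target bit `b` is.
𝔼-randomAffine : ∀ {n} (P : Assignment n → Bool) b (φ : ℚ → ℚ) →
  𝔼 (randomAffine n) (λ f → φ (card (restrict P (f , b)))) ≡
  𝔼 (randomBits n) (λ a → ½ * (φ (half P true a) + φ (half P false a)))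
𝔼-randomAffine {n} P b φ = begin
  ½ * (𝔼 (randomBits n >>= λ a → return (false , a)) g + 𝔼 (randomBits n >>= λ a → return (true , a)) g)
    ≡⟨ cong (½ *_) (cong₂ _+_ (𝔼->>= (randomBits n) _ g) (𝔼->>= (randomBits n) _ g)) ⟩
  ½ * (𝔼 (randomBits n) (λ a → g (false , a)) + 𝔼 (randomBits n) (λ a → g (true , a)))
    ≡⟨ cong (½ *_) (𝔼-+ (randomBits n) _ _) ⟨
  ½ * 𝔼 (randomBits n) (λ a → g (false , a) + g (true , a))
    ≡⟨ 𝔼-* (randomBits n) ½ _ ⟨
  𝔼 (randomBits n) (λ a → ½ * (g (false , a) + g (true , a)))
    ≡⟨ 𝔼-cong (randomBits n) (λ a → cong (½ *_) (eq b a)) ⟩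
  𝔼 (randomBits n) (λ a → ½ * (φ (half P true a) + φ (half P false a))) ∎
  where
  open ≡-Reasoning
  g : Affine n → ℚ
  g f = φ (card (restrict P (f , b)))
  eq : ∀ b a → φ (card (restrict P ((false , a) , b))) + φ (card (restrict P ((true , a) , b))) ≡ φ (half P true a) + φ (half P false a)
  eq false a = cong₂ (λ x y → φ x + φ y) (restrict-half P false a false) (restrict-half P true a false)
  eq true a = trans (cong₂ (λ x y → φ x + φ y) (restrict-half P false a true) (restrict-half P true a true))
                (+-comm (φ (half P false a)) (φ (half P true a)))

-- The halves are (N ± bias)/2, so averaging over them leaves only the square of the bias random,
-- and Parseval evaluates its mean. A general quadratic is treated because the induction over the
-- rows produces one.
row-moment : ∀ {n} (P : Assignment n → Bool) b u v w → let N = card P in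
  𝔼 (randomAffine n) (λ f → let X = card (restrict P (f , b)) in u * (X * X) + v * X + w) ≡
  u * ((N * N + N) * (½ * ½)) + v * (N * ½) + w
row-moment {n} P b u v w = begin
  𝔼 (randomAffine n) (λ f → φ (card (restrict P (f , b))))
    ≡⟨ 𝔼-randomAffine P b φ ⟩
  𝔼 (randomBits n) (λ a → ½ * (φ (half P true a) + φ (half P false a)))
    ≡⟨ 𝔼-cong (randomBits n) (λ a → trans (eq₁ (half P true a) (half P false a) u v w)
          (cong (λ N → u * (N * N * (½ * ½)) + v * (N * ½) + w + u * (½ * ½) * (bias P a * bias P a)) (half-+ P a))) ⟩
  𝔼 (randomBits n) (λ a → u * (N * N * (½ * ½)) + v * (N * ½) + w + u * (½ * ½) * (bias P a * bias P a))
    ≡⟨ 𝔼-affine (randomBits n) (u * (N * N * (½ * ½)) + v * (N * ½) + w) (u * (½ * ½)) (λ a → bias P a * bias P a) ⟩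
  u * (N * N * (½ * ½)) + v * (N * ½) + w + u * (½ * ½) * 𝔼 (randomBits n) (λ a → bias P a * bias P a)
    ≡⟨ cong (λ z → u * (N * N * (½ * ½)) + v * (N * ½) + w + u * (½ * ½) * z) (parseval P) ⟩
  u * (N * N * (½ * ½)) + v * (N * ½) + w + u * (½ * ½) * N
    ≡⟨ eq₂ N u v w ⟩
  u * ((N * N + N) * (½ * ½)) + v * (N * ½) + w ∎
  where
  open ≡-Reasoning
  N = card P
  φ : ℚ → ℚ
  φ X = u * (X * X) + v * X + w
  eq₁ : ∀ x y u v w → ½ * (u * (x * x) + v * x + w + (u * (y * y) + v * y + w)) ≡
    u * ((y + x) * (y + x) * (½ * ½)) + v * ((y + x) * ½) + w + u * (½ * ½) * ((x - y) * (x - y))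
  eq₁ = solve-∀ ℚ-ring
  eq₂ : ∀ N u v w → u * (N * N * (½ * ½)) + v * (N * ½) + w + u * (½ * ½) * N ≡ u * ((N * N + N) * (½ * ½)) + v * (N * ½) + w
  eq₂ = solve-∀ ℚ-ring

-- Given the first row, the remaining rows act on the restricted set, whose size enters the
-- induction hypothesis as a quadratic; hence the generality in `P`. The equation is exact for every
-- fixed target `α`.
hash-moment : ∀ {n} m (α : Vec Bool m) (P : Assignment n → Bool) c → let μ = card P * ½ ^ m in
  𝔼 (randomHash n m) (λ h → let d = card (λ y → P y ∧ all (evalXor y) (h hashesTo α)) - c in d * d) ≡
  (μ - c) * (μ - c) + μ * (1ℚ - ½ ^ m)
hash-moment zero [] P c = trans (cong (λ z → (z - c) * (z - c)) (card-cong (λ y → ∧-identityʳ (P y)))) (eq (card P) c)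
  where
  eq : ∀ N c → (N - c) * (N - c) ≡ (N * 1ℚ - c) * (N * 1ℚ - c) + N * 1ℚ * (1ℚ - 1ℚ)
  eq = solve-∀ ℚ-ring
hash-moment {n} (suc m) (b ∷ α) P c = begin
  𝔼 (randomHash n (suc m)) (λ h → let d = card (λ y → P y ∧ all (evalXor y) (h hashesTo (b ∷ α))) - c in d * d)
    ≡⟨ 𝔼-replicateᴿ-suc (randomAffine n) m _ ⟩
  𝔼 (randomAffine n) (λ f → 𝔼 (randomHash n m) (λ h → let d = card (λ y → P y ∧ (evalXor y (f , b) ∧ all (evalXor y) (h hashesTo α))) - c in d * d))
    ≡⟨ 𝔼-cong (randomAffine n) (λ f → 𝔼-cong (randomHash n m) (λ h → cong (λ z → (z - c) * (z - c))
         (card-cong (λ y → sym (∧-assoc (P y) (evalXor y (f , b)) _))))) ⟩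
  𝔼 (randomAffine n) (λ f → 𝔼 (randomHash n m) (λ h → let d = card (λ y → restrict P (f , b) y ∧ all (evalXor y) (h hashesTo α)) - c in d * d))
    ≡⟨ 𝔼-cong (randomAffine n) (λ f → trans (hash-moment m α (restrict P (f , b)) c) (eq₁ (card (restrict P (f , b))) p c)) ⟩
  𝔼 (randomAffine n) (λ f → let X = card (restrict P (f , b)) in
      p * p * (X * X) + (p * (1ℚ - p) - c * p - c * p) * X + c * c)
    ≡⟨ row-moment P b (p * p) (p * (1ℚ - p) - c * p - c * p) (c * c) ⟩
  p * p * ((N * N + N) * (½ * ½)) + (p * (1ℚ - p) - c * p - c * p) * (N * ½) + c * c
    ≡⟨ eq₂ N p c ⟩
  (N * (½ * p) - c) * (N * (½ * p) - c) + N * (½ * p) * (1ℚ - ½ * p) ∎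
  where
  open ≡-Reasoning
  N = card P
  p = ½ ^ m
  eq₁ : ∀ X p c → (X * p - c) * (X * p - c) + X * p * (1ℚ - p) ≡ p * p * (X * X) + (p * (1ℚ - p) - c * p - c * p) * X + c * c
  eq₁ = solve-∀ ℚ-ring
  eq₂ : ∀ N p c → p * p * ((N * N + N) * (½ * ½)) + (p * (1ℚ - p) - c * p - c * p) * (N * ½) + c * c ≡
    (N * (½ * p) - c) * (N * (½ * p) - c) + N * (½ * p) * (1ℚ - ½ * p)
  eq₂ = solve-∀ ℚ-ring

-- Second moment and deviations of the cell in one round

squares : ∀ {h x} → 0ℚ ≤ h → h ≤ x → h * h ≤ x * x
squares 0≤h h≤x = *-mono-≤ 0≤h 0≤h h≤x h≤x

squares-neg : ∀ {h x c} → 0ℚ ≤ h → h ≤ c - x → h * h ≤ (x - c) * (x - c)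
squares-neg {h} {x} {c} 0≤h p = subst (h * h ≤_) (eq x c) (squares 0≤h p)
  where
  eq : ∀ x c → (c - x) * (c - x) ≡ (x - c) * (x - c)
  eq = solve-∀ ℚ-ring

half-powers : ∀ m → fromNat (2 ℕ.^ m) * ½ ^ m ≡ 1ℚ
half-powers m = begin
  fromNat (2 ℕ.^ m) * ½ ^ m  ≡⟨ cong (_* ½ ^ m) (fromNat-^ 2 m) ⟩
  fromNat 2 ^ m * ½ ^ m      ≡⟨ ^-distrib-* (fromNat 2) ½ m ⟨
  1ℚ ^ m                     ≡⟨ 1^ m ⟩
  1ℚ                         ∎
  where open ≡-Reasoning

0≤half-power : ∀ m → 0ℚ ≤ ½ ^ m
0≤half-power = ^-nonNeg 0≤½

module Analysis {n : ℕ} (B : BoundedSAT n) (F : CNF n) (k : ℕ) where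

  open BoundedSAT B
  open Core B F (2 ℕ.* k)

  pivot = 2 ℕ.* k

  K N : ℚ
  K = fromNat k
  N = card (λ y → evalCNF y F)

  0≤N : 0ℚ ≤ N
  0≤N = fromNat-nonNeg (countᵇ (λ y → evalCNF y F) (assignments n))

  μ : ℕ → ℚ
  μ i = N * ½ ^ (i ℕ.∸ l)

  0≤μ : ∀ i → 0ℚ ≤ μ i
  0≤μ i = *-nonNeg 0≤N (0≤half-power (i ℕ.∸ l))

  μ-suc : ∀ {i} → l ℕ.≤ i → μ (suc i) ≡ μ i * ½
  μ-suc {i} p = trans (cong (λ m → N * ½ ^ m) (ℕ.+-∸-assoc 1 p)) (eq N (½ ^ (i ℕ.∸ l)))
    where
    eq : ∀ a b → a * (½ * b) ≡ a * b * ½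
    eq = solve-∀ ℚ-ring

  𝔼-sample : ∀ i f → 𝔼 (sample i) f ≡
    𝔼 (randomHash n (i ℕ.∸ l)) (λ h → 𝔼 (randomBits (i ℕ.∸ l)) (λ α → f (solve (F & (h hashesTo α)) (pivot ℕ.+ 1))))
  𝔼-sample i f = trans (𝔼->>= (randomHash n (i ℕ.∸ l)) _ f)
    (𝔼-cong (randomHash n (i ℕ.∸ l)) (λ h → 𝔼->>= (randomBits (i ℕ.∸ l)) _ f))

  sample-second-moment : ∀ i {f : List (Assignment n) → ℚ} {a b c} → 0ℚ ≤ b →
    (∀ S X → length S ≡ (pivot ℕ.+ 1) ℕ.⊓ X → f S ≤ a + b * ((fromNat X - c) * (fromNat X - c))) →
    𝔼 (sample i) f ≤ a + b * ((μ i - c) * (μ i - c) + μ i)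
  sample-second-moment i {f} {a} {b} {c} 0≤b bound = begin
    𝔼 (sample i) f
      ≡⟨ 𝔼-sample i f ⟩
    𝔼 hash (λ h → 𝔼 bits (λ α → f (solve (F & (h hashesTo α)) (pivot ℕ.+ 1))))
      ≤⟨ 𝔼-mono hash (λ h → 𝔼-mono bits (λ α → bound _ _ (size (F & (h hashesTo α)) (pivot ℕ.+ 1)))) ⟩
    𝔼 hash (λ h → 𝔼 bits (λ α → a + b * d² h α))
      -- The hash is averaged first, for fixed `α`, because its moment is the same for every target.
      ≡⟨ 𝔼-swap hash bits (λ h α → a + b * d² h α) ⟩
    𝔼 bits (λ α → 𝔼 hash (λ h → a + b * d² h α))
      ≡⟨ 𝔼-cong bits (λ α → trans (𝔼-affine hash a b (λ h → d² h α)) (cong (λ z → a + b * z) (hash-moment m α (λ y → evalCNF y F) c))) ⟩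
    𝔼 bits (λ α → a + b * ((μ i - c) * (μ i - c) + μ i * (1ℚ - ½ ^ m)))
      ≡⟨ 𝔼-const bits _ ⟩
    a + b * ((μ i - c) * (μ i - c) + μ i * (1ℚ - ½ ^ m))
      ≤⟨ ≤-diff (*-nonNeg 0≤b (*-nonNeg (0≤μ i) (0≤half-power m))) (eq a b (μ i) c (½ ^ m)) ⟩
    a + b * ((μ i - c) * (μ i - c) + μ i) ∎
    where
    open ≤-Reasoning
    m = i ℕ.∸ l
    hash = randomHash n m
    bits = randomBits m
    d² : Hash n m → Vec Bool m → ℚ
    d² h α = let d = card (λ y → evalCNF y F ∧ all (evalXor y) (h hashesTo α)) - c in d * d
    eq : ∀ a b μ c p → a + b * ((μ - c) * (μ - c) + μ) ≡ a + b * ((μ - c) * (μ - c) + μ * (1ℚ - p)) + b * (μ * p)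
    eq = solve-∀ ℚ-ring

  -- The solver truncates at pivot + 1, so only an accepted sample reveals the true cell size `X`; a
  -- rejected one still tells empty cells from overfull ones.
  data Outcome (S : List (Assignment n)) (X : ℕ) : Set where
    accepted : inRange S ≡ true → length S ≡ X → X ℕ.≤ pivot → Outcome S X
    empty    : inRange S ≡ false → X ≡ 0 → Outcome S X
    overfull : inRange S ≡ false → pivot ℕ.≤ X → Outcome S X

  outcome : ∀ S X → length S ≡ (pivot ℕ.+ 1) ℕ.⊓ X → Outcome S X
  outcome S X eq with inRange S in p | ℕ.<-cmp X 0 | X ℕ.≤? pivot
  ... | true  | _ | yes X≤ = accepted p (trans eq (ℕ.m≥n⇒m⊓n≡n (ℕ.≤-trans X≤ (ℕ.m≤m+n pivot 1)))) X≤
  ... | true  | _ | no X≰ = contradiction (length≤ p) (ℕ.<⇒≱ (subst (pivot ℕ.<_) (sym |S|≡1+pivot) (ℕ.≤-reflexive (ℕ.+-comm 1 pivot))))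
    where
    |S|≡1+pivot : length S ≡ pivot ℕ.+ 1
    |S|≡1+pivot = trans eq (ℕ.m≤n⇒m⊓n≡m (subst (ℕ._≤ X) (ℕ.+-comm 1 pivot) (ℕ.≰⇒> X≰)))
    length≤ : inRange S ≡ true → length S ℕ.≤ pivot
    length≤ q with 1 ℕ.≤ᵇ length S | length S ℕ.≤ᵇ pivot in r
    ... | true | true = ℕ.≤ᵇ⇒≤ _ _ (subst T (sym r) _)
  ... | false | tri≈ _ X≡0 _ | _ = empty p X≡0
  ... | false | tri> _ _ X>0 | yes X≤ = contradiction (trans (sym p) (cong₂ _∧_ (T⇒≡ (ℕ.≤⇒≤ᵇ 1≤)) (T⇒≡ (ℕ.≤⇒≤ᵇ ≤pivot)))) (λ ())
    where
    |S|≡X : length S ≡ X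
    |S|≡X = trans eq (ℕ.m≥n⇒m⊓n≡n (ℕ.≤-trans X≤ (ℕ.m≤m+n pivot 1)))
    1≤ : 1 ℕ.≤ length S
    1≤ = subst (1 ℕ.≤_) (sym |S|≡X) X>0
    ≤pivot : length S ℕ.≤ pivot
    ≤pivot = subst (ℕ._≤ pivot) (sym |S|≡X) X≤
    T⇒≡ : ∀ {b} → T b → b ≡ true
    T⇒≡ {true} _ = refl
  ... | false | tri> _ _ _ | no X≰ = overfull p (ℕ.<⇒≤ (ℕ.≰⇒> X≰))

  module Deviation {β : ℚ} (0<β : 0ℚ < β) (1≤β²k : 1ℚ ≤ + 13 / 64 * (β * β * K)) where

    -- The events of interest lie outside an open interval of half-width β (μ + w) whose centre is off the mean by β w;
    -- the choice of w trades the two one-sided deviations against each other.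
    quadratic-bound : ∀ i {f : List (Assignment n) → ℚ} {u w c} → u ≤ 1ℚ →
      (μ i - c) * (μ i - c) ≡ β * w * (β * w) →
      let h = β * (μ i + w) in
      (∀ S X → length S ≡ (pivot ℕ.+ 1) ℕ.⊓ X → f S ≤ u ⊎ (f S ≤ 1ℚ × h * h ≤ (fromNat X - c) * (fromNat X - c))) →
      (1ℚ - u) * (μ i * (μ i + (1ℚ + 1ℚ) * w - + 13 / 64 * K)) ≤ (μ i + w) * (μ i + w) * (1ℚ - 𝔼 (sample i) f)
    quadratic-bound i {f} {u} {w} {c} u≤1 centre dev = master-inequality 0<β 1≤β²k (0≤μ i) u≤1 (begin
      h * h * 𝔼 (sample i) f
        ≡⟨ 𝔼-* (sample i) (h * h) f ⟨
      𝔼 (sample i) (λ S → h * h * f S)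
        ≤⟨ sample-second-moment i {λ S → h * h * f S} {h * h * u} {1ℚ - u} {c} (≤⇒0≤- u≤1) (λ S X eq → pointwise X (dev S X eq)) ⟩
      h * h * u + (1ℚ - u) * ((μ i - c) * (μ i - c) + μ i)
        ≡⟨ cong (λ z → h * h * u + (1ℚ - u) * z) (trans (cong (_+ μ i) centre) (+-comm _ (μ i))) ⟩
      h * h * u + (1ℚ - u) * (μ i + β * w * (β * w)) ∎)
      where
      open ≤-Reasoning
      h = β * (μ i + w)
      e₁ : ∀ p u → p ≡ p * u + (1ℚ - u) * p
      e₁ = solve-∀ ℚ-ring
      pointwise : ∀ {S} X → f S ≤ u ⊎ (f S ≤ 1ℚ × h * h ≤ (fromNat X - c) * (fromNat X - c)) →
        h * h * f S ≤ h * h * u + (1ℚ - u) * ((fromNat X - c) * (fromNat X - c))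
      pointwise X (inj₁ p) = ≤-trans (*-monoˡ-≤ (square-nonNeg h) p)
        (≤-diff (*-nonNeg (≤⇒0≤- u≤1) (square-nonNeg (fromNat X - c))) refl)
      pointwise {S} X (inj₂ (p , q)) = begin
        h * h * f S                    ≤⟨ *-monoˡ-≤ (square-nonNeg h) p ⟩
        h * h * 1ℚ                     ≡⟨ *-identityʳ (h * h) ⟩
        h * h                          ≡⟨ e₁ (h * h) u ⟩
        h * h * u + (1ℚ - u) * (h * h) ≤⟨ +-monoʳ-≤ (h * h * u) (*-monoˡ-≤ (≤⇒0≤- u≤1) q) ⟩
        h * h * u + (1ℚ - u) * ((fromNat X - c) * (fromNat X - c)) ∎

    -- The choice w = 13/64 K maximises the success bound of `quadratic-bound`: a factor μ + w
    -- cancels, and the loss is the one-sided factor μ/(μ + w).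
    cantelli : ∀ i {f : List (Assignment n) → ℚ} {u c} → 0ℚ < μ i → u ≤ 1ℚ → let w = + 13 / 64 * K ; h = β * (μ i + w) in
      (μ i - c) * (μ i - c) ≡ β * w * (β * w) →
      (∀ S X → length S ≡ (pivot ℕ.+ 1) ℕ.⊓ X → f S ≤ u ⊎ (f S ≤ 1ℚ × h * h ≤ (fromNat X - c) * (fromNat X - c))) →
      μ i * (1ℚ - u) ≤ (μ i + w) * (1ℚ - 𝔼 (sample i) f)
    cantelli i {f} {u} {c} 0<μ u≤1 centre dev = *-cancelˡ-≤ 0<μ+w
      (subst₂ _≤_ (e₁ (μ i) w u) (*-assoc (μ i + w) (μ i + w) _) (quadratic-bound i u≤1 centre dev))
      where
      w = + 13 / 64 * K
      0<μ+w : 0ℚ < μ i + w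
      0<μ+w = <-≤-trans 0<μ (≤-diff (*-nonNeg (nonNegative⁻¹ (+ 13 / 64)) (fromNat-nonNeg k)) refl)
      e₁ : ∀ μ w u → (1ℚ - u) * (μ * (μ + (1ℚ + 1ℚ) * w - w)) ≡ (μ + w) * (μ * (1ℚ - u))
      e₁ = solve-∀ ℚ-ring

    -- With w = (K - μ)/2 the interval runs from (1 - β) μ to μ + β K, or in the mirrored case from
    -- μ - β K to (1 + β) μ, and μ + 2w - 13/64 K becomes 51/64 K.
    centred-bound : ∀ i {f : List (Assignment n) → ℚ} {c} → let w = ½ * (K - μ i) ; h = β * (μ i + w) in
      (μ i - c) * (μ i - c) ≡ β * w * (β * w) →
      (∀ S X → length S ≡ (pivot ℕ.+ 1) ℕ.⊓ X → f S ≤ 0ℚ ⊎ (f S ≤ 1ℚ × h * h ≤ (fromNat X - c) * (fromNat X - c))) →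
      + 51 / 16 * (K * μ i) ≤ (K + μ i) * (K + μ i) * (1ℚ - 𝔼 (sample i) f)
    centred-bound i {f} {c} centre dev =
      subst₂ _≤_ (e₁ K (μ i)) (e₂ K (μ i) (1ℚ - 𝔼 (sample i) f)) (*-monoˡ-≤ (fromNat-nonNeg 4) (quadratic-bound i 0≤1 centre dev))
      where
      e₁ : ∀ k μ → fromNat 4 * ((1ℚ - 0ℚ) * (μ * (μ + (1ℚ + 1ℚ) * (½ * (k - μ)) - + 13 / 64 * k))) ≡ + 51 / 16 * (k * μ)
      e₁ = solve-∀ ℚ-ring
      e₂ : ∀ k μ G → fromNat 4 * ((μ + ½ * (k - μ)) * (μ + ½ * (k - μ)) * G) ≡ (k + μ) * (k + μ) * G
      e₂ = solve-∀ ℚ-ring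

-- The failure value ⊥ counts as an error on either side.
below above : ℚ → ℚ → Maybe ℕ → Bool
below e N nothing  = true
below e N (just v) = does ((1ℚ + e) * fromNat v <? N)
above e N nothing  = true
above e N (just v) = does ((1ℚ + e) * N <? fromNat v)

indicator≤1 : ∀ b → indicator b ≤ 1ℚ
indicator≤1 false = 0≤1
indicator≤1 true  = ≤-refl

0≤indicator : ∀ b → 0ℚ ≤ indicator b
0≤indicator false = ≤-refl
0≤indicator true  = 0≤1

indicator-dec : ∀ {P : Set} (P? : Dec P) → indicator (does P?) ≤ 0ℚ ⊎ P
indicator-dec (yes p) = inj₂ p
indicator-dec (no _)  = inj₁ ≤-refl

-- The loop, followed backwards from its decisive round

module Loop {n : ℕ} (B : BoundedSAT n) (F : CNF n) (k : ℕ) (0<k : 0 ℕ.< k)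
  {e β : ℚ} (0<e : 0ℚ < e) (β-def : (1ℚ + e) * β ≡ e) (β≤½ : β ≤ ½) (0<β : 0ℚ < β)
  (1≤β²k : 1ℚ ≤ + 13 / 64 * (β * β * fromNat k)) where

  open BoundedSAT B
  open Core B F (2 ℕ.* k)
  open Analysis B F k
  open Deviation 0<β 1≤β²k

  0<K : 0ℚ < K
  0<K = fromNat-mono-< 0<k

  pivot≡ : fromNat pivot ≡ fromNat 2 * K
  pivot≡ = fromNat-* 2 k

  0<1+e : 0ℚ < 1ℚ + e
  0<1+e = +-pos 0<1 0<e

  β≤e : β ≤ e
  β≤e = ≤-diff (*-nonNeg (<⇒≤ 0<e) (<⇒≤ 0<β)) (trans (sym β-def) (eq e β))
    where
    eq : ∀ e β → (1ℚ + e) * β ≡ β + e * β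
    eq = solve-∀ ℚ-ring

  -- This identity is the reason for β = e/(1 + e): a returned value is too low by more than the
  -- factor 1 + e exactly when its cell is smaller than (1 - β) μ.
  [1+e][1-β]≡1 : (1ℚ + e) * (1ℚ - β) ≡ 1ℚ
  [1+e][1-β]≡1 = trans (e₁ e β) (trans (cong (λ z → 1ℚ + e - z) β-def) (e₂ e))
    where
    e₁ : ∀ e β → (1ℚ + e) * (1ℚ - β) ≡ 1ℚ + e - (1ℚ + e) * β
    e₁ = solve-∀ ℚ-ring
    e₂ : ∀ e → 1ℚ + e - e ≡ 1ℚ
    e₂ = solve-∀ ℚ-ring

  μ-scale : ∀ i → μ i * fromNat (2 ℕ.^ (i ℕ.∸ l)) ≡ N
  μ-scale i = begin
    N * ½ ^ m * fromNat (2 ℕ.^ m)    ≡⟨ eq N (½ ^ m) (fromNat (2 ℕ.^ m)) ⟩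
    N * (fromNat (2 ℕ.^ m) * ½ ^ m)  ≡⟨ cong (N *_) (half-powers m) ⟩
    N * 1ℚ                           ≡⟨ *-identityʳ N ⟩
    N                                ∎
    where
    open ≡-Reasoning
    m = i ℕ.∸ l
    eq : ∀ N p q → N * p * q ≡ N * (q * p)
    eq = solve-∀ ℚ-ring

  value : ℕ → ℕ → Maybe ℕ
  value X i = just (X ℕ.* 2 ℕ.^ (i ℕ.∸ l))

  below-dev : ∀ i X → indicator (below e N (value X i)) ≤ 0ℚ ⊎ fromNat X ≤ (1ℚ - β) * μ i
  below-dev i X = Sum.map₂ (λ p → <⇒≤ (*-cancelˡ-< {1ℚ + e} {fromNat X} {(1ℚ - β) * μ i} (<⇒≤ 0<1+e)
      (*-cancelˡ-< {fromNat M} {(1ℚ + e) * fromNat X} {(1ℚ + e) * ((1ℚ - β) * μ i)} (fromNat-nonNeg M) (subst₂ _<_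
      (trans (cong ((1ℚ + e) *_) (fromNat-* X M)) (e₁ (1ℚ + e) (fromNat X) (fromNat M)))
      (trans (sym (*-identityʳ N)) (trans (cong₂ _*_ (sym (μ-scale i)) (sym [1+e][1-β]≡1)) (e₂ e β (μ i) (fromNat M)))) p))))
    (indicator-dec ((1ℚ + e) * fromNat (X ℕ.* M) <? N))
    where
    M = 2 ℕ.^ (i ℕ.∸ l)
    e₁ : ∀ a x m → a * (x * m) ≡ m * (a * x)
    e₁ = solve-∀ ℚ-ring
    e₂ : ∀ e β μ m → μ * m * ((1ℚ + e) * (1ℚ - β)) ≡ m * ((1ℚ + e) * ((1ℚ - β) * μ))
    e₂ = solve-∀ ℚ-ring

  -- The deviation is weakened from e to β ≤ e, so that both errors are measured with the same β.
  above-dev : ∀ i X → indicator (above e N (value X i)) ≤ 0ℚ ⊎ (1ℚ + β) * μ i ≤ fromNat X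
  above-dev i X = Sum.map₂ (λ p → ≤-trans (≤-diff (*-nonNeg (≤⇒0≤- β≤e) (0≤μ i)) (e₀ e β (μ i)))
      (<⇒≤ (*-cancelˡ-< {fromNat M} {(1ℚ + e) * μ i} {fromNat X} (fromNat-nonNeg M) (subst₂ _<_
        (trans (cong ((1ℚ + e) *_) (sym (μ-scale i))) (e₁ (1ℚ + e) (μ i) (fromNat M)))
        (trans (fromNat-* X M) (*-comm (fromNat X) (fromNat M))) p))))
    (indicator-dec ((1ℚ + e) * N <? fromNat (X ℕ.* M)))
    where
    M = 2 ℕ.^ (i ℕ.∸ l)
    e₀ : ∀ e β μ → (1ℚ + e) * μ ≡ (1ℚ + β) * μ + (e - β) * μ
    e₀ = solve-∀ ℚ-ring
    e₁ : ∀ a x m → a * (x * m) ≡ m * (a * x)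
    e₁ = solve-∀ ℚ-ring

  finalValue : List (Assignment n) × ℕ → Maybe ℕ
  finalValue (S , i) = if inRange S then value (length S) i else nothing

  module _ (bad : Maybe ℕ → Bool) (bad-nothing : bad nothing ≡ true) where

    badProbability : ℕ → ℕ → ℚ
    badProbability r i = 𝔼 (loop r i) (λ x → indicator (bad (finalValue x)))

    -- With no iterations left a rejected sample becomes ⊥, which is an error with certainty.
    continuation : ℕ → ℕ → ℚ
    continuation zero    i = 1ℚ
    continuation (suc r) i = badProbability r (suc i)

    after : ℕ → ℕ → List (Assignment n) → ℚ
    after r i S = if inRange S then indicator (bad (value (length S) i)) else continuation r i

    badProbability-unfold : ∀ r i → badProbability r i ≡ 𝔼 (sample i) (after r i)
    badProbability-unfold zero i = trans (𝔼->>= (sample i) _ _) (𝔼-cong (sample i) (λ S → eq S (inRange S)))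
      where
      eq : ∀ S b → indicator (bad (if b then value (length S) i else nothing)) ≡
        (if b then indicator (bad (value (length S) i)) else 1ℚ)
      eq S true  = refl
      eq S false = cong indicator bad-nothing
    badProbability-unfold (suc r) i = trans (𝔼->>= (sample i) _ _) (𝔼-cong (sample i) (λ S → eq S (inRange S) refl))
      where
      -- `finalValue` tests `S` a second time, so the branch has to remember the result of the first
      -- test.
      eq : ∀ S b → inRange S ≡ b → 𝔼 (if b then return (S , i) else loop r (suc i)) (λ x → indicator (bad (finalValue x))) ≡
        (if b then indicator (bad (value (length S) i)) else badProbability r (suc i))
      eq S true  p = cong (λ b → indicator (bad (if b then value (length S) i else nothing))) p
      eq S false p = refl

    badProbability≤1 : ∀ r i → badProbability r i ≤ 1ℚ
    badProbability≤1 r i = subst (badProbability r i ≤_) (𝔼-const (loop r i) 1ℚ)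
      (𝔼-mono (loop r i) (λ x → indicator≤1 (bad (finalValue x))))

    0≤badProbability : ∀ r i → 0ℚ ≤ badProbability r i
    0≤badProbability r i = subst (_≤ badProbability r i) (𝔼-const (loop r i) 0ℚ)
      (𝔼-mono (loop r i) (λ x → 0≤indicator (bad (finalValue x))))

    continuation≤1 : ∀ r i → continuation r i ≤ 1ℚ
    continuation≤1 zero i = ≤-refl
    continuation≤1 (suc r) i = badProbability≤1 r (suc i)

    after-accepted : ∀ r i {S X} → inRange S ≡ true → length S ≡ X → after r i S ≡ indicator (bad (value X i))
    after-accepted r i {S} p refl = cong (λ b → if b then indicator (bad (value (length S) i)) else continuation r i) p

    after-rejected : ∀ r i {S} → inRange S ≡ false → after r i S ≡ continuation r i
    after-rejected r i {S} p = cong (λ b → if b then indicator (bad (value (length S) i)) else continuation r i) p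

    -- One round with the tail of the loop bounded trivially: every rejected sample must then count as a deviation.
    round-base : ∀ r i {h c} →
      (∀ X → indicator (bad (value X i)) ≤ 0ℚ ⊎ h * h ≤ (fromNat X - c) * (fromNat X - c)) →
      h * h ≤ (0ℚ - c) * (0ℚ - c) →
      (∀ X → pivot ℕ.≤ X → h * h ≤ (fromNat X - c) * (fromNat X - c)) →
      ∀ S X → length S ≡ (pivot ℕ.+ 1) ℕ.⊓ X →
      after r i S ≤ 0ℚ ⊎ (after r i S ≤ 1ℚ × h * h ≤ (fromNat X - c) * (fromNat X - c))
    round-base r i {h} {c} acc emp over S X eq = go (outcome S X eq)
      where
      rejected : inRange S ≡ false → after r i S ≤ 1ℚ
      rejected p = subst (_≤ 1ℚ) (sym (after-rejected r i {S} p)) (continuation≤1 r i)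
      go : Outcome S X → after r i S ≤ 0ℚ ⊎ (after r i S ≤ 1ℚ × h * h ≤ (fromNat X - c) * (fromNat X - c))
      go (empty p refl)   = inj₂ (rejected p , emp)
      go (overfull p q)   = inj₂ (rejected p , over X q)
      go (accepted p q _) = Sum.map (subst (_≤ 0ℚ) (sym (after-accepted r i {S} p q)))
        (λ z → subst (_≤ 1ℚ) (sym (after-accepted r i {S} p q)) (indicator≤1 (bad (value X i))) , z) (acc X)

    -- A rejected sample costs exactly the error probability `u` of the tail, and an accepted one
    -- costs 0 ≤ u unless it deviates; so rejection never has to count as a deviation here.
    round-step : ∀ r i {h c} →
      (∀ X → indicator (bad (value X i)) ≤ 0ℚ ⊎ h * h ≤ (fromNat X - c) * (fromNat X - c)) →
      ∀ S X → length S ≡ (pivot ℕ.+ 1) ℕ.⊓ X → let u = badProbability r (suc i) in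
      after (suc r) i S ≤ u ⊎ (after (suc r) i S ≤ 1ℚ × h * h ≤ (fromNat X - c) * (fromNat X - c))
    round-step r i {h} {c} acc S X eq = go (outcome S X eq)
      where
      u = badProbability r (suc i)
      go : Outcome S X → after (suc r) i S ≤ u ⊎ (after (suc r) i S ≤ 1ℚ × h * h ≤ (fromNat X - c) * (fromNat X - c))
      go (empty p _)      = inj₁ (≤-reflexive (after-rejected (suc r) i {S} p))
      go (overfull p _)   = inj₁ (≤-reflexive (after-rejected (suc r) i {S} p))
      go (accepted p q _) = Sum.map
        (λ z → ≤-trans (subst (_≤ 0ℚ) (sym (after-accepted (suc r) i {S} p q)) z) (0≤badProbability r (suc i)))
        (λ z → subst (_≤ 1ℚ) (sym (after-accepted (suc r) i {S} p q)) (indicator≤1 (bad (value X i))) , z) (acc X)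

  lower-tail : ∀ i {w} → 0ℚ ≤ μ i + w → let h = β * (μ i + w) ; c = μ i + β * w in
    ∀ X → indicator (below e N (value X i)) ≤ 0ℚ ⊎ h * h ≤ (fromNat X - c) * (fromNat X - c)
  lower-tail i {w} 0≤ X = Sum.map₂
    (λ p → squares-neg {β * (μ i + w)} {fromNat X} {μ i + β * w} (*-nonNeg (<⇒≤ 0<β) 0≤) (≤-diff (≤⇒0≤- p) (eq β (μ i) w (fromNat X)))) (below-dev i X)
    where
    eq : ∀ β μ w x → μ + β * w - x ≡ β * (μ + w) + ((1ℚ - β) * μ - x)
    eq = solve-∀ ℚ-ring

  upper-tail : ∀ i {w} → 0ℚ ≤ μ i + w → let h = β * (μ i + w) ; c = μ i - β * w in
    ∀ X → indicator (above e N (value X i)) ≤ 0ℚ ⊎ h * h ≤ (fromNat X - c) * (fromNat X - c)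
  upper-tail i {w} 0≤ X = Sum.map₂
    (λ p → squares {β * (μ i + w)} {fromNat X - (μ i - β * w)} (*-nonNeg (<⇒≤ 0<β) 0≤) (≤-diff (≤⇒0≤- p) (eq β (μ i) w (fromNat X)))) (above-dev i X)
    where
    eq : ∀ β μ w x → x - (μ - β * w) ≡ β * (μ + w) + (x - (1ℚ + β) * μ)
    eq = solve-∀ ℚ-ring

  lower-centre : ∀ i w → (μ i - (μ i + β * w)) * (μ i - (μ i + β * w)) ≡ β * w * (β * w)
  lower-centre i w = eq (μ i) β w
    where
    eq : ∀ μ β w → (μ - (μ + β * w)) * (μ - (μ + β * w)) ≡ β * w * (β * w)
    eq = solve-∀ ℚ-ring

  upper-centre : ∀ i w → (μ i - (μ i - β * w)) * (μ i - (μ i - β * w)) ≡ β * w * (β * w)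
  upper-centre i w = eq (μ i) β w
    where
    eq : ∀ μ β w → (μ - (μ - β * w)) * (μ - (μ - β * w)) ≡ β * w * (β * w)
    eq = solve-∀ ℚ-ring

  0<2 : 0ℚ < fromNat 2
  0<2 = positive⁻¹ (fromNat 2)
  0<3 : 0ℚ < fromNat 3
  0<3 = positive⁻¹ (fromNat 3)
  0<4 : 0ℚ < fromNat 4
  0<4 = positive⁻¹ (fromNat 4)

  pos-from : ∀ {a b x} → 0ℚ < a → 0ℚ ≤ b → a * K ≤ b * x → 0ℚ < x
  pos-from {a} {b} 0<a 0≤b p = *-cancelˡ-< 0≤b (<-≤-trans (subst (_< a * K) (sym (*-zeroʳ b)) (*-pos 0<a 0<K)) p)

  0≤midpoint : ∀ i → 0ℚ ≤ μ i + ½ * (K - μ i)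
  0≤midpoint i = ≤-diff (*-nonNeg 0≤½ (+-nonNeg (0≤μ i) (<⇒≤ 0<K))) (eq (μ i) K)
    where
    eq : ∀ μ k → μ + ½ * (k - μ) ≡ 0ℚ + ½ * (μ + k)
    eq = solve-∀ ℚ-ring

  0≤μ+ρK : ∀ i → 0ℚ ≤ μ i + + 13 / 64 * K
  0≤μ+ρK i = +-nonNeg (0≤μ i) (*-nonNeg (nonNegative⁻¹ (+ 13 / 64)) (<⇒≤ 0<K))

  tooLow tooHigh : ℕ → ℕ → ℚ
  tooLow = badProbability (below e N) refl
  tooHigh = badProbability (above e N) refl

  -- The upper end μ + β K of the interval stays below 2K because μ ≤ 3/2 K and β ≤ 1/2, and its
  -- lower end (1 - β) μ is nonnegative; so overfull and empty cells both count as deviations.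
  below-base : ∀ r i → fromNat 3 * K ≤ fromNat 4 * μ i → fromNat 2 * μ i ≤ fromNat 3 * K → LowInvariant K (μ i) (1ℚ - tooLow r i)
  below-base r i lo hi = low-base {K} {μ i} {1ℚ - tooLow r i} 0<K lo hi (subst (λ z → + 51 / 16 * (K * μ i) ≤ (K + μ i) * (K + μ i) * (1ℚ - z))
      (sym (badProbability-unfold (below e N) refl r i))
      (centred-bound i (lower-centre i w) (round-base (below e N) refl r i {h} {c} (lower-tail i (0≤midpoint i)) emp over)))
    where
    w = ½ * (K - μ i)
    h = β * (μ i + w)
    c = μ i + β * w
    0≤h : 0ℚ ≤ h
    0≤h = *-nonNeg (<⇒≤ 0<β) (0≤midpoint i)
    emp : h * h ≤ (0ℚ - c) * (0ℚ - c)
    emp = squares-neg {h} {0ℚ} {c} 0≤h (≤-diff (*-nonNeg (+-nonNeg (≤⇒0≤- β≤½) 0≤½) (0≤μ i)) (eq β (μ i) w))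
      where
      eq : ∀ β μ w → μ + β * w - 0ℚ ≡ β * (μ + w) + (½ - β + ½) * μ
      eq = solve-∀ ℚ-ring
    over : ∀ X → pivot ℕ.≤ X → h * h ≤ (fromNat X - c) * (fromNat X - c)
    over X p = squares {h} {fromNat X - c} 0≤h (≤-diff (+-nonNeg (≤⇒0≤- 2K≤X) (+-nonNeg (*-nonNeg 0≤½ (≤⇒0≤- hi)) (*-nonNeg (≤⇒0≤- β≤½) (<⇒≤ 0<K))))
        (eq β (μ i) K (fromNat X)))
      where
      2K≤X : fromNat 2 * K ≤ fromNat X
      2K≤X = subst (_≤ fromNat X) pivot≡ (fromNat-mono-≤ p)
      eq : ∀ β μ k x → x - (μ + β * (½ * (k - μ))) ≡
        β * (μ + ½ * (k - μ)) + (x - fromNat 2 * k + (½ * (fromNat 3 * k - fromNat 2 * μ) + (½ - β) * k))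
      eq = solve-∀ ℚ-ring

  -- With β ≤ 1/2 the window keeps both ends, μ - β K and (1 + β) μ, between 0 and 2K. Its limit 4/3
  -- is where 3/2 μ reaches 2K.
  above-base : ∀ r i → fromNat 2 * K ≤ fromNat 3 * μ i → fromNat 3 * μ i ≤ fromNat 4 * K → + 3 / 4 ≤ 1ℚ - tooHigh r i
  above-base r i lo hi = high-base {K} {μ i} {1ℚ - tooHigh r i} 0<K lo hi (subst (λ z → + 51 / 16 * (K * μ i) ≤ (K + μ i) * (K + μ i) * (1ℚ - z))
      (sym (badProbability-unfold (above e N) refl r i))
      (centred-bound i (upper-centre i w) (round-base (above e N) refl r i {h} {c} (upper-tail i (0≤midpoint i)) emp over)))
    where
    w = ½ * (K - μ i)
    h = β * (μ i + w)
    c = μ i - β * w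
    0≤h : 0ℚ ≤ h
    0≤h = *-nonNeg (<⇒≤ 0<β) (0≤midpoint i)
    emp : h * h ≤ (0ℚ - c) * (0ℚ - c)
    emp = squares-neg {h} {0ℚ} {c} 0≤h (≤-diff (+-nonNeg (*-nonNeg (nonNegative⁻¹ (+ 1 / 3)) (≤⇒0≤- lo))
        (+-nonNeg (*-nonNeg (nonNegative⁻¹ (+ 1 / 6)) (<⇒≤ 0<K)) (*-nonNeg (≤⇒0≤- β≤½) (<⇒≤ 0<K)))) (eq β (μ i) K))
      where
      eq : ∀ β μ k → μ - β * (½ * (k - μ)) - 0ℚ ≡ β * (μ + ½ * (k - μ)) + (+ 1 / 3 * (fromNat 3 * μ - fromNat 2 * k) + (+ 1 / 6 * k + (½ - β) * k))
      eq = solve-∀ ℚ-ring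
    over : ∀ X → pivot ℕ.≤ X → h * h ≤ (fromNat X - c) * (fromNat X - c)
    over X p = squares {h} {fromNat X - c} 0≤h (≤-diff (+-nonNeg (≤⇒0≤- 2K≤X) (+-nonNeg (*-nonNeg 0≤½ (≤⇒0≤- hi)) (*-nonNeg (≤⇒0≤- β≤½) (0≤μ i))))
        (eq β (μ i) K (fromNat X)))
      where
      2K≤X : fromNat 2 * K ≤ fromNat X
      2K≤X = subst (_≤ fromNat X) pivot≡ (fromNat-mono-≤ p)
      eq : ∀ β μ k x → x - (μ - β * (½ * (k - μ))) ≡
        β * (μ + ½ * (k - μ)) + (x - fromNat 2 * k + (½ * (fromNat 4 * k - fromNat 3 * μ) + (½ - β) * μ))
      eq = solve-∀ ℚ-ring

  below-round : ∀ r i → 0ℚ < μ i → μ i * (1ℚ - tooLow r (suc i)) ≤ (μ i + + 13 / 64 * K) * (1ℚ - tooLow (suc r) i)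
  below-round r i 0<μ = subst (λ z → μ i * (1ℚ - tooLow r (suc i)) ≤ (μ i + + 13 / 64 * K) * (1ℚ - z))
    (sym (badProbability-unfold (below e N) refl (suc r) i))
    (cantelli i 0<μ (badProbability≤1 (below e N) refl r (suc i)) (lower-centre i (+ 13 / 64 * K))
      (round-step (below e N) refl r i {β * (μ i + + 13 / 64 * K)} {μ i + β * (+ 13 / 64 * K)} (lower-tail i (0≤μ+ρK i))))

  above-round : ∀ r i → 0ℚ < μ i → μ i * (1ℚ - tooHigh r (suc i)) ≤ (μ i + + 13 / 64 * K) * (1ℚ - tooHigh (suc r) i)
  above-round r i 0<μ = subst (λ z → μ i * (1ℚ - tooHigh r (suc i)) ≤ (μ i + + 13 / 64 * K) * (1ℚ - z))
    (sym (badProbability-unfold (above e N) refl (suc r) i))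
    (cantelli i 0<μ (badProbability≤1 (above e N) refl r (suc i)) (upper-centre i (+ 13 / 64 * K))
      (round-step (above e N) refl r i {β * (μ i + + 13 / 64 * K)} {μ i - β * (+ 13 / 64 * K)} (upper-tail i (0≤μ+ρK i))))

  -- An accepted cell has at most 2K < μ elements, so its value lies below the true count and the
  -- round adds no error.
  above-far : ∀ r i → fromNat 2 * K < μ i → tooHigh (suc r) i ≤ tooHigh r (suc i)
  above-far r i far = subst (_≤ tooHigh r (suc i)) (sym (badProbability-unfold (above e N) refl (suc r) i))
    (subst (𝔼 (sample i) (after (above e N) refl (suc r) i) ≤_) (eq₁ (tooHigh r (suc i)) ((μ i - 0ℚ) * (μ i - 0ℚ) + μ i))
      -- With b = 0 the moment bound degenerates to a pointwise estimate.
      (sample-second-moment i {a = tooHigh r (suc i)} {b = 0ℚ} {c = 0ℚ} ≤-refl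
        (λ S X eq → subst (after (above e N) refl (suc r) i S ≤_) (sym (eq₁ (tooHigh r (suc i)) ((fromNat X - 0ℚ) * (fromNat X - 0ℚ)))) (pointwise S X (outcome S X eq)))))
    where
    eq₁ : ∀ a z → a + 0ℚ * z ≡ a
    eq₁ = solve-∀ ℚ-ring
    pointwise : ∀ S X → Outcome S X → after (above e N) refl (suc r) i S ≤ tooHigh r (suc i)
    pointwise S X (empty p _) = ≤-reflexive (after-rejected (above e N) refl (suc r) i {S} p)
    pointwise S X (overfull p _) = ≤-reflexive (after-rejected (above e N) refl (suc r) i {S} p)
    pointwise S X (accepted p q X≤pivot) = Sum.[
        (λ z → ≤-trans (subst (_≤ 0ℚ) (sym (after-accepted (above e N) refl (suc r) i {S} p q)) z) (0≤badProbability (above e N) refl r (suc i)))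
      , (λ z → contradiction (<-≤-trans far (≤-trans (≤-diff (*-nonNeg (<⇒≤ 0<β) (0≤μ i)) (eq₂ β (μ i)))
                 (≤-trans z (subst (fromNat X ≤_) pivot≡ (fromNat-mono-≤ X≤pivot))))) (<-irrefl refl)) ] (above-dev i X)
      where
      eq₂ : ∀ β μ → (1ℚ + β) * μ ≡ μ + β * μ
      eq₂ = solve-∀ ℚ-ring

  μ-double : ∀ {i} → l ℕ.≤ i → fromNat 2 * μ (suc i) ≡ μ i
  μ-double {i} l≤i = trans (cong (fromNat 2 *_) (μ-suc l≤i)) (eq (μ i))
    where
    eq : ∀ μ → fromNat 2 * (μ * ½) ≡ μ
    eq = solve-∀ ℚ-ring

  end-suc : ∀ {r i} → l ℕ.≤ i → μ i * ½ ^ suc r ≤ K → μ (suc i) * ½ ^ r ≤ K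
  end-suc {r} {i} l≤i = subst (_≤ K) (trans (sym (*-assoc (μ i) ½ (½ ^ r))) (cong (_* ½ ^ r) (sym (μ-suc l≤i))))

  end-zero : ∀ i → μ i * ½ ^ 0 ≤ K → μ i ≤ K
  end-zero i = subst (_≤ K) (*-identityʳ (μ i))

  -- The last hypothesis says that the mean drops to `K` within the remaining iterations, so the
  -- window is met before they run out; each round above it is paid for by `low-step`.
  below-loop : ∀ r i → l ℕ.≤ i → fromNat 3 * K ≤ fromNat 4 * μ i → μ i * ½ ^ r ≤ K → LowInvariant K (μ i) (1ℚ - tooLow r i)
  below-loop r i l≤i lo end = go r (fromNat 2 * μ i ≤? fromNat 3 * K) end
    where
    go : ∀ r → Dec (fromNat 2 * μ i ≤ fromNat 3 * K) → μ i * ½ ^ r ≤ K → LowInvariant K (μ i) (1ℚ - tooLow r i)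
    go r (yes hi) _ = below-base r i lo hi
    go zero (no ¬hi) end = contradiction
      (≤-diff (+-nonNeg (*-nonNeg (<⇒≤ 0<2) (≤⇒0≤- (end-zero i end))) (<⇒≤ 0<K)) (eq K (μ i))) ¬hi
      where
      eq : ∀ k μ → fromNat 3 * k ≡ fromNat 2 * μ + (fromNat 2 * (k - μ) + k)
      eq = solve-∀ ℚ-ring
    go (suc r) (no ¬hi) end = low-step {K} {μ i} {1ℚ - tooLow (suc r) i} {1ℚ - tooLow r (suc i)} 0<K hi
      (subst (λ z → LowInvariant K z (1ℚ - tooLow r (suc i))) (μ-suc l≤i)
        (below-loop r (suc i) (ℕ.m≤n⇒m≤1+n l≤i)
          (subst (fromNat 3 * K ≤_) (trans (cong (fromNat 2 *_) (sym (μ-double l≤i))) (eq (μ (suc i)))) hi)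
          (end-suc {r} l≤i end)))
      (below-round r i (pos-from {fromNat 3} {fromNat 2} {μ i} 0<3 (fromNat-nonNeg 2) hi))
      where
      hi = <⇒≤ (≰⇒> ¬hi)
      eq : ∀ μ → fromNat 2 * (fromNat 2 * μ) ≡ fromNat 4 * μ
      eq = solve-∀ ℚ-ring

  -- The second component strengthens the induction: up to 8/3 K the next round lies in the window,
  -- and one Cantelli factor reduces its 3/4 to no less than 3/5; beyond 8/3 K the bound 3/5 is
  -- inherited without loss.
  above-loop : ∀ r i → l ℕ.≤ i → fromNat 2 * K ≤ fromNat 3 * μ i → μ i * ½ ^ r ≤ K →
    + 3 / 5 ≤ 1ℚ - tooHigh r i × (fromNat 3 * μ i ≤ fromNat 4 * K → + 3 / 4 ≤ 1ℚ - tooHigh r i)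
  above-loop r i l≤i lo end = go r (fromNat 3 * μ i ≤? fromNat 4 * K) end
    where
    go : ∀ r → Dec (fromNat 3 * μ i ≤ fromNat 4 * K) → μ i * ½ ^ r ≤ K →
      + 3 / 5 ≤ 1ℚ - tooHigh r i × (fromNat 3 * μ i ≤ fromNat 4 * K → + 3 / 4 ≤ 1ℚ - tooHigh r i)
    go r (yes hi) _ = ≤-trans (toWitness {a? = + 3 / 5 ≤? + 3 / 4} _) (above-base r i lo hi) , above-base r i lo
    go zero (no ¬hi) end = contradiction
      (≤-diff (+-nonNeg (*-nonNeg (<⇒≤ 0<3) (≤⇒0≤- (end-zero i end))) (<⇒≤ 0<K)) (eq K (μ i))) ¬hi
      where
      eq : ∀ k μ → fromNat 4 * k ≡ fromNat 3 * μ + (fromNat 3 * (k - μ) + k)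
      eq = solve-∀ ℚ-ring
    go (suc r) (no ¬hi) end = step (fromNat 3 * μ i ≤? fromNat 8 * K) , λ hi → contradiction hi ¬hi
      where
      hi : fromNat 4 * K ≤ fromNat 3 * μ i
      hi = <⇒≤ (≰⇒> ¬hi)
      rescale : fromNat 3 * μ i ≡ fromNat 2 * (fromNat 3 * μ (suc i))
      rescale = trans (cong (fromNat 3 *_) (sym (μ-double l≤i))) (eq (μ (suc i)))
        where
        eq : ∀ μ → fromNat 3 * (fromNat 2 * μ) ≡ fromNat 2 * (fromNat 3 * μ)
        eq = solve-∀ ℚ-ring
      IH = above-loop r (suc i) (ℕ.m≤n⇒m≤1+n l≤i)
        (*-cancelˡ-≤ {fromNat 2} {fromNat 2 * K} {fromNat 3 * μ (suc i)} 0<2 (subst₂ _≤_ (eq K) rescale hi)) (end-suc {r} l≤i end)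
        where
        eq : ∀ k → fromNat 4 * k ≡ fromNat 2 * (fromNat 2 * k)
        eq = solve-∀ ℚ-ring
      step : Dec (fromNat 3 * μ i ≤ fromNat 8 * K) → + 3 / 5 ≤ 1ℚ - tooHigh (suc r) i
      step (yes near) = high-step {K} {μ i} {1ℚ - tooHigh (suc r) i} {1ℚ - tooHigh r (suc i)} 0<K hi
          (proj₂ IH (*-cancelˡ-≤ {fromNat 2} {fromNat 3 * μ (suc i)} {fromNat 4 * K} 0<2 (subst₂ _≤_ rescale (eq K) near)))
          (above-round r i (pos-from {fromNat 4} {fromNat 3} {μ i} 0<4 (fromNat-nonNeg 3) hi))
        where
        eq : ∀ k → fromNat 8 * k ≡ fromNat 2 * (fromNat 4 * k)
        eq = solve-∀ ℚ-ring
      step (no ¬near) = ≤-trans (proj₁ IH) (+-monoʳ-≤ 1ℚ (neg-antimono-≤ (above-far r i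
          (*-cancelˡ-< {fromNat 3} {fromNat 2 * K} {μ i} (<⇒≤ 0<3) (≤-<-trans (≤-diff (*-nonNeg (<⇒≤ 0<2) (<⇒≤ 0<K)) (eq K)) (≰⇒> ¬near))))))
        where
        eq : ∀ k → fromNat 8 * k ≡ fromNat 3 * (fromNat 2 * k) + fromNat 2 * k
        eq = solve-∀ ℚ-ring

-- From the loop to a single run of the core algorithm

2^⌊log₂⌋≤ : ∀ k → 0 ℕ.< k → 2 ℕ.^ ⌊log₂ k ⌋ ℕ.≤ k
2^⌊log₂⌋≤ = <-rec _ step
  where
  open ℕ.≤-Reasoning
  step : ∀ k → (∀ {j} → j ℕ.< k → 0 ℕ.< j → 2 ℕ.^ ⌊log₂ j ⌋ ℕ.≤ j) → 0 ℕ.< k → 2 ℕ.^ ⌊log₂ k ⌋ ℕ.≤ k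
  step 1 rec _ = ℕ.≤-refl
  step k@(suc (suc k-2)) rec _ = begin
    2 ℕ.^ ⌊log₂ k ⌋                    ≤⟨ ℕ.^-monoʳ-≤ 2 (ℕ.m≤n+m∸n ⌊log₂ k ⌋ 1) ⟩
    2 ℕ.^ suc (⌊log₂ k ⌋ ℕ.∸ 1)        ≡⟨ cong (λ j → 2 ℕ.^ suc j) (⌊log₂⌊n/2⌋⌋≡⌊log₂n⌋∸1 k) ⟨
    2 ℕ.* 2 ℕ.^ ⌊log₂ ⌊ k /2⌋ ⌋        ≤⟨ ℕ.*-monoʳ-≤ 2 (rec (ℕ.⌊n/2⌋<n (suc k-2)) (ℕ.s≤s ℕ.z≤n)) ⟩
    2 ℕ.* ⌊ k /2⌋                      ≡⟨ cong (⌊ k /2⌋ ℕ.+_) (ℕ.+-identityʳ ⌊ k /2⌋) ⟩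
    ⌊ k /2⌋ ℕ.+ ⌊ k /2⌋                ≤⟨ ℕ.+-monoʳ-≤ ⌊ k /2⌋ (ℕ.⌊n/2⌋≤⌈n/2⌉ k) ⟩
    ⌊ k /2⌋ ℕ.+ ⌈ k /2⌉                ≡⟨ ℕ.⌊n/2⌋+⌈n/2⌉≡n k ⟩
    k                                  ∎

countᵇ≤length : ∀ {A : Set} (P : A → Bool) xs → countᵇ P xs ℕ.≤ length xs
countᵇ≤length P [] = ℕ.z≤n
countᵇ≤length P (x ∷ xs) with P x
... | true  = ℕ.s≤s (countᵇ≤length P xs)
... | false = ℕ.m≤n⇒m≤1+n (countᵇ≤length P xs)

length-assignments : ∀ n → length (assignments n) ≡ 2 ℕ.^ n
length-assignments zero = refl
length-assignments (suc n) = trans (length-++ (map (false ∷_) (assignments n)))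
  (cong₂ ℕ._+_ (trans (length-map (false ∷_) (assignments n)) (length-assignments n))
    (trans (trans (length-map (true ∷_) (assignments n)) (length-assignments n)) (sym (ℕ.+-identityʳ (2 ℕ.^ n)))))

card-solutions : ∀ {n} (F : CNF n) → card (λ y → evalCNF y F) ≡ fromNat (# (fromCNF F))
card-solutions F = card-cong (λ y → sym (∧-identityʳ (evalCNF y F)))

module CoreBound {n : ℕ} (B : BoundedSAT n) (F : CNF n) (k : ℕ) (0<k : 0 ℕ.< k)
  {e β : ℚ} (0<e : 0ℚ < e) (β-def : (1ℚ + e) * β ≡ e) (β≤½ : β ≤ ½) (0<β : 0ℚ < β)
  (1≤β²k : 1ℚ ≤ + 13 / 64 * (β * β * fromNat k)) where

  open BoundedSAT B
  open Core B F (2 ℕ.* k) hiding (approxMCCore)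
  open Analysis B F k
  open Loop B F k 0<k {e} {β} 0<e β-def β≤½ 0<β 1≤β²k

  2^l≤k : 2 ℕ.^ l ℕ.≤ k
  2^l≤k = subst (λ j → 2 ℕ.^ (j ℕ.∸ 1) ℕ.≤ k) (sym (⌊log₂[2*b]⌋≡1+⌊log₂b⌋ k {{ℕ.>-nonZero 0<k}})) (2^⌊log₂⌋≤ k 0<k)

  #F≤ : countᵇ (λ y → evalCNF y F) (assignments n) ℕ.≤ k ℕ.* 2 ℕ.^ (n ℕ.∸ l)
  #F≤ = begin
    countᵇ (λ y → evalCNF y F) (assignments n)  ≤⟨ countᵇ≤length (λ y → evalCNF y F) (assignments n) ⟩
    length (assignments n)                      ≡⟨ length-assignments n ⟩
    -- An inequality, since the subtraction n ∸ l is truncated.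
    2 ℕ.^ n                                     ≤⟨ ℕ.^-monoʳ-≤ 2 (ℕ.m≤n+m∸n n l) ⟩
    2 ℕ.^ (l ℕ.+ (n ℕ.∸ l))                     ≡⟨ ℕ.^-distribˡ-+-* 2 l (n ℕ.∸ l) ⟩
    2 ℕ.^ l ℕ.* 2 ℕ.^ (n ℕ.∸ l)                 ≤⟨ ℕ.*-monoˡ-≤ (2 ℕ.^ (n ℕ.∸ l)) 2^l≤k ⟩
    k ℕ.* 2 ℕ.^ (n ℕ.∸ l)                       ∎
    where open ℕ.≤-Reasoning

  μ-start : μ l ≡ N
  μ-start = trans (cong (λ m → N * ½ ^ m) (ℕ.n∸n≡0 l)) (*-identityʳ N)

  -- This is what the starting index `l` provides: as 2ˡ ≤ k, the mean cell size in the last round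
  -- is at most k even if every assignment satisfies `F`.
  μ-end : μ l * ½ ^ (n ℕ.∸ l) ≤ K
  μ-end = begin
    μ l * ½ ^ m                  ≡⟨ cong (_* ½ ^ m) μ-start ⟩
    N * ½ ^ m                    ≤⟨ *-monoʳ-≤-nonNeg (½ ^ m) {{nonNegative (0≤half-power m)}} (fromNat-mono-≤ #F≤) ⟩
    fromNat (k ℕ.* 2 ℕ.^ m) * ½ ^ m      ≡⟨ cong (_* ½ ^ m) (fromNat-* k (2 ℕ.^ m)) ⟩
    K * fromNat (2 ℕ.^ m) * ½ ^ m        ≡⟨ *-assoc K _ _ ⟩
    K * (fromNat (2 ℕ.^ m) * ½ ^ m)      ≡⟨ cong (K *_) (half-powers m) ⟩
    K * 1ℚ                               ≡⟨ *-identityʳ K ⟩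
    K                                    ∎
    where
    open ≤-Reasoning
    m = n ℕ.∸ l

  S₀ : List (Assignment n)
  S₀ = BoundedSAT.solve B (fromCNF F) (pivot ℕ.+ 1)

  -- Common to both errors: either the initial call finds all solutions and the answer is exact, or
  -- the loop starts with a mean of at least 2K, above both windows.
  core-bound : ∀ bad (bad-nothing : bad nothing ≡ true) →
    indicator (bad (just (# (fromCNF F)))) ≤ 0ℚ →
    (fromNat 2 * K ≤ μ l → badProbability bad bad-nothing (n ℕ.∸ l) l ≤ + 2 / 5) →
    𝔼 (approxMCCore B F pivot) (λ v → indicator (bad v)) ≤ + 2 / 5
  core-bound bad bad-nothing exact many = aux (length S₀ ℕ.≤ᵇ pivot) refl
    where
    finish : List (Assignment n) × ℕ → Rand (Maybe ℕ)
    finish (S , i) = return (if inRange S then just (length S ℕ.* 2 ℕ.^ (i ℕ.∸ l)) else nothing)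
    aux : ∀ b → (length S₀ ℕ.≤ᵇ pivot) ≡ b →
      𝔼 (if b then return (just (length S₀)) else (loop (n ℕ.∸ l) l >>= finish)) (λ v → indicator (bad v)) ≤ + 2 / 5
    aux true p = ≤-trans (subst (λ v → indicator (bad (just v)) ≤ 0ℚ) (sym |S₀|≡#F) exact) (nonNegative⁻¹ (+ 2 / 5))
      where
      |S₀|≤pivot : length S₀ ℕ.≤ pivot
      |S₀|≤pivot = ℕ.≤ᵇ⇒≤ (length S₀) pivot (subst T (sym p) _)
      |S₀|≡#F : length S₀ ≡ # (fromCNF F)
      |S₀|≡#F = Sum.[
          (λ q → contradiction (subst (ℕ._≤ pivot) (trans (size (fromCNF F) (pivot ℕ.+ 1)) q) |S₀|≤pivot)
            (ℕ.<⇒≱ (ℕ.≤-reflexive (ℕ.+-comm 1 pivot))))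
        , (λ q → trans (size (fromCNF F) (pivot ℕ.+ 1)) q) ]′
        (ℕ.⊓-sel (pivot ℕ.+ 1) (# (fromCNF F)))
    aux false p = subst (_≤ + 2 / 5) (sym (trans (𝔼->>= (loop (n ℕ.∸ l) l) finish _)
        (𝔼-cong (loop (n ℕ.∸ l) l) (λ { (S , i) → refl })))) (many (subst₂ _≤_ pivot≡ (trans (sym (card-solutions F)) (sym μ-start)) (fromNat-mono-≤ pivot≤#F)))
      where
      pivot≤#F : pivot ℕ.≤ # (fromCNF F)
      pivot≤#F = ℕ.≮⇒≥ (λ q → contradiction
        (ℕ.≤⇒≤ᵇ (subst (ℕ._≤ pivot) (sym (size (fromCNF F) (pivot ℕ.+ 1)))
          (ℕ.≤-trans (ℕ.m⊓n≤n (pivot ℕ.+ 1) (# (fromCNF F))) (ℕ.<⇒≤ q))))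
        (subst (λ b → ¬ T b) (sym p) (λ ())))

  3/5≤⇒≤2/5 : ∀ {p} → + 3 / 5 ≤ 1ℚ - p → p ≤ + 2 / 5
  3/5≤⇒≤2/5 {p} h = ≤-diff (≤⇒0≤- h) (eq p)
    where
    eq : ∀ p → + 2 / 5 ≡ p + (1ℚ - p - + 3 / 5)
    eq = solve-∀ ℚ-ring

  core-below : 𝔼 (approxMCCore B F pivot) (λ v → indicator (below e N v)) ≤ + 2 / 5
  core-below = core-bound (below e N) refl exact
    (λ many → 3/5≤⇒≤2/5 (low-final {K} {μ l} {1ℚ - tooLow (n ℕ.∸ l) l} (<⇒≤ 0<K)
      (pos-from {fromNat 2} {1ℚ} {μ l} 0<2 0≤1 (subst (fromNat 2 * K ≤_) (sym (*-identityˡ (μ l))) many))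
      (below-loop (n ℕ.∸ l) l ℕ.≤-refl
        (≤-diff (+-nonNeg (*-nonNeg (fromNat-nonNeg 4) (≤⇒0≤- many)) (*-nonNeg (fromNat-nonNeg 5) (<⇒≤ 0<K))) (eq K (μ l))) μ-end)))
    where
    eq : ∀ k μ → fromNat 4 * μ ≡ fromNat 3 * k + (fromNat 4 * (μ - fromNat 2 * k) + fromNat 5 * k)
    eq = solve-∀ ℚ-ring
    exact : indicator (below e N (just (# (fromCNF F)))) ≤ 0ℚ
    exact = Sum.[ (λ p → p)
      , (λ p → contradiction (<-≤-trans p (≤-diff (*-nonNeg (<⇒≤ 0<e) 0≤N) (eq₁ e N)))
          (subst (λ z → ¬ ((1ℚ + e) * z < (1ℚ + e) * N)) (card-solutions F) (<-irrefl refl))) ]′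
      (indicator-dec ((1ℚ + e) * fromNat (# (fromCNF F)) <? N))
      where
      eq₁ : ∀ e N → (1ℚ + e) * N ≡ N + e * N
      eq₁ = solve-∀ ℚ-ring

  core-above : 𝔼 (approxMCCore B F pivot) (λ v → indicator (above e N v)) ≤ + 2 / 5
  core-above = core-bound (above e N) refl exact
    (λ many → 3/5≤⇒≤2/5 (proj₁ (above-loop (n ℕ.∸ l) l ℕ.≤-refl
        (≤-diff (+-nonNeg (*-nonNeg (fromNat-nonNeg 3) (≤⇒0≤- many)) (*-nonNeg (fromNat-nonNeg 4) (<⇒≤ 0<K))) (eq K (μ l))) μ-end)))
    where
    eq : ∀ k μ → fromNat 3 * μ ≡ fromNat 2 * k + (fromNat 3 * (μ - fromNat 2 * k) + fromNat 4 * k)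
    eq = solve-∀ ℚ-ring
    exact : indicator (above e N (just (# (fromCNF F)))) ≤ 0ℚ
    exact = Sum.[ (λ p → p)
      , (λ p → contradiction (≤-<-trans (≤-diff (*-nonNeg (<⇒≤ 0<e) 0≤N) (eq₁ e N)) p)
          (subst (λ z → ¬ (N < z)) (card-solutions F) (<-irrefl refl))) ]′
      (indicator-dec ((1ℚ + e) * N <? fromNat (# (fromCNF F))))
      where
      eq₁ : ∀ e N → (1ℚ + e) * N ≡ N + e * N
      eq₁ = solve-∀ ℚ-ring

-- Amplification by independent repetition

module _ {A : Set} (bad : A → Bool) where

  -- A bad run has weight 6/5 and a good one 5/6, near the optimal √(3/2) and its inverse; if bad runs have
  -- probability at most 2/5, the mean weight is at most 49/50.
  weight : ∀ {t} → Vec A t → ℚ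
  weight []       = 1ℚ
  weight (a ∷ as) = (+ 5 / 6 + + 11 / 30 * indicator (bad a)) * weight as

  good : A → Bool
  good a = not (bad a)

  -- The weight is 6/5 to the power bad minus good; this form avoids negative exponents.
  weight-balance : ∀ {t} (as : Vec A t) →
    weight as * (+ 6 / 5) ^ countᵇ good (Vec.toList as) ≡ (+ 6 / 5) ^ countᵇ bad (Vec.toList as)
  weight-balance [] = refl
  weight-balance (a ∷ as) with bad a
  ... | true  = trans (eq (weight as) ((+ 6 / 5) ^ countᵇ good (Vec.toList as))) (cong (+ 6 / 5 *_) (weight-balance as))
    where
    eq : ∀ w p → (+ 5 / 6 + + 11 / 30 * 1ℚ) * w * p ≡ + 6 / 5 * (w * p)
    eq = solve-∀ ℚ-ring
  ... | false = trans (eq (weight as) ((+ 6 / 5) ^ countᵇ good (Vec.toList as))) (weight-balance as)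
    where
    eq : ∀ w p → (+ 5 / 6 + + 11 / 30 * 0ℚ) * w * (+ 6 / 5 * p) ≡ w * p
    eq = solve-∀ ℚ-ring

  1≤weight : ∀ {t} (as : Vec A t) → countᵇ good (Vec.toList as) ℕ.≤ countᵇ bad (Vec.toList as) → 1ℚ ≤ weight as
  1≤weight as p = *-cancelˡ-≤ (^-pos 0<6/5 g) (subst₂ _≤_ (sym (*-identityʳ _)) (trans (sym (weight-balance as)) (*-comm (weight as) _))
      (^-monoʳ-≤ p))
    where
    g = countᵇ good (Vec.toList as)
    0<6/5 : 0ℚ < + 6 / 5
    0<6/5 = positive⁻¹ (+ 6 / 5)
    ^-monoʳ-≤ : ∀ {m n} → m ℕ.≤ n → (+ 6 / 5) ^ m ≤ (+ 6 / 5) ^ n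
    ^-monoʳ-≤ {n = n} ℕ.z≤n = subst (_≤ (+ 6 / 5) ^ n) (1^ n) (^-mono-≤ 0≤1 (toWitness {a? = 1ℚ ≤? + 6 / 5} _) n)
    ^-monoʳ-≤ (ℕ.s≤s q) = *-monoˡ-≤ (<⇒≤ 0<6/5) (^-monoʳ-≤ q)

  0≤weight : ∀ {t} (as : Vec A t) → 0ℚ ≤ weight as
  0≤weight [] = 0≤1
  0≤weight (a ∷ as) = *-nonNeg (+-nonNeg (nonNegative⁻¹ (+ 5 / 6)) (*-nonNeg (nonNegative⁻¹ (+ 11 / 30)) (0≤indicator (bad a)))) (0≤weight as)

  𝔼-weight : ∀ (m : Rand A) → 𝔼 m (λ a → indicator (bad a)) ≤ + 2 / 5 →
    ∀ t → 𝔼 (replicateᴿ t m) weight ≤ (+ 49 / 50) ^ t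
  𝔼-weight m p zero = ≤-refl
  𝔼-weight m p (suc t) = begin
    𝔼 (replicateᴿ (suc t) m) weight
      ≡⟨ 𝔼-replicateᴿ-suc m t weight ⟩
    𝔼 m (λ a → 𝔼 (replicateᴿ t m) (λ as → w a * weight as))
      ≡⟨ 𝔼-cong m (λ a → trans (𝔼-* (replicateᴿ t m) (w a) weight) (*-comm (w a) r)) ⟩
    𝔼 m (λ a → r * w a)
      ≡⟨ 𝔼-* m r w ⟩
    r * 𝔼 m w
      ≡⟨ cong (r *_) (𝔼-affine m (+ 5 / 6) (+ 11 / 30) (λ a → indicator (bad a))) ⟩
    r * (+ 5 / 6 + + 11 / 30 * 𝔼 m (λ a → indicator (bad a)))
      ≤⟨ *-monoˡ-≤ 0≤r (+-monoʳ-≤ (+ 5 / 6) (*-monoˡ-≤ (nonNegative⁻¹ (+ 11 / 30)) p)) ⟩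
    r * (+ 5 / 6 + + 11 / 30 * (+ 2 / 5))
      ≡⟨ *-comm r _ ⟩
    + 49 / 50 * r
      ≤⟨ *-monoˡ-≤ (nonNegative⁻¹ (+ 49 / 50)) (𝔼-weight m p t) ⟩
    (+ 49 / 50) ^ suc t ∎
    where
    open ≤-Reasoning
    w : A → ℚ
    w a = + 5 / 6 + + 11 / 30 * indicator (bad a)
    r = 𝔼 (replicateᴿ t m) weight
    0≤r : 0ℚ ≤ r
    0≤r = subst (_≤ r) (𝔼-const (replicateᴿ t m) 0ℚ) (𝔼-mono (replicateᴿ t m) 0≤weight)

-- Medians

countᵇ-true : ∀ {A : Set} (P : A → Bool) {xs} → All (λ x → T (P x)) xs → countᵇ P xs ≡ length xs
countᵇ-true P [] = refl
countᵇ-true P {x ∷ xs} (p ∷ ps) with P x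
... | true = cong suc (countᵇ-true P ps)

countᵇ-∷ : ∀ {A : Set} (P : A → Bool) x xs → T (P x) → countᵇ P (x ∷ xs) ≡ suc (countᵇ P xs)
countᵇ-∷ P x xs p with P x
... | true = refl

countᵇ-∷-≤ : ∀ {A : Set} (P : A → Bool) x xs → countᵇ P xs ℕ.≤ countᵇ P (x ∷ xs)
countᵇ-∷-≤ P x xs with P x
... | true  = ℕ.n≤1+n _
... | false = ℕ.≤-refl

countᵇ-↭ : ∀ {A : Set} (P : A → Bool) {xs ys} → xs ↭ ys → countᵇ P xs ≡ countᵇ P ys
countᵇ-↭ P p = ↭-length (filter-↭ _ p)

nth-exists : ∀ xs {j} → j ℕ.< length xs → ∃[ y ] (nth xs j ≡ just y)
nth-exists (x ∷ xs) {zero}  _ = x , refl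
nth-exists (x ∷ xs) {suc j} (ℕ.s≤s p) = nth-exists xs p

nth-All : ∀ {P : ℕ → Set} {xs} → All P xs → ∀ j {y} → nth xs j ≡ just y → P y
nth-All (p ∷ ps) zero    refl = p
nth-All (p ∷ ps) (suc j) eq   = nth-All ps j eq

nth-lower : ∀ (P : ℕ → Bool) → (∀ {x y} → x ℕ.≤ y → T (P y) → T (P x)) → ∀ {ys} → AllPairs ℕ._≤_ ys →
  ∀ j {y} → nth ys j ≡ just y → T (P y) → j ℕ.< countᵇ P ys
nth-lower P down {x ∷ ys} (x≤ ∷ s) zero refl Py = subst (0 ℕ.<_) (sym (countᵇ-∷ P x ys Py)) (ℕ.s≤s ℕ.z≤n)
nth-lower P down {x ∷ ys} (x≤ ∷ s) (suc j) eq Py = subst (suc j ℕ.<_)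
  (sym (countᵇ-∷ P x ys (down (nth-All x≤ j eq) Py))) (ℕ.s≤s (nth-lower P down s j eq Py))

nth-upper : ∀ (P : ℕ → Bool) → (∀ {x y} → x ℕ.≤ y → T (P x) → T (P y)) → ∀ {ys} → AllPairs ℕ._≤_ ys →
  ∀ j {y} → nth ys j ≡ just y → T (P y) → length ys ℕ.≤ j ℕ.+ countᵇ P ys
nth-upper P up {x ∷ ys} (x≤ ∷ s) zero refl Py = ℕ.≤-reflexive (sym (countᵇ-true P (Py ∷ All.map (λ x≤y → up x≤y Py) x≤)))
nth-upper P up {x ∷ ys} (x≤ ∷ s) (suc j) eq Py = ℕ.s≤s (ℕ.≤-trans (nth-upper P up s j eq Py) (ℕ.+-monoʳ-≤ j (countᵇ-∷-≤ P x ys)))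

-- The zero-based middle positions: at most half of the `L` entries come before j and at most half
-- after it.
Central : ℕ → ℕ → Set
Central L j = L ℕ.≤ 2 ℕ.* suc j × 2 ℕ.* j ℕ.≤ L

median-central : ∀ L → 0 ℕ.< L → Central L ((L ℕ.∸ 1) ℕ./ 2) × Central L (L ℕ./ 2)
median-central (suc L) _ = (lower L , ℕ.m≤n⇒m≤1+n (double L)) , (ℕ.≤-trans (ℕ.n≤1+n _) (lower (suc L)) , double (suc L))
  where
  double : ∀ m → 2 ℕ.* (m ℕ./ 2) ℕ.≤ m
  double m = subst (ℕ._≤ m) (ℕ.*-comm (m ℕ./ 2) 2) (m/n*n≤m m 2)
  lower : ∀ m → m ℕ.< 2 ℕ.* suc (m ℕ./ 2)
  lower m = begin-strict
    m                              ≡⟨ m≡m%n+[m/n]*n m 2 ⟩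
    m ℕ.% 2 ℕ.+ (m ℕ./ 2) ℕ.* 2    <⟨ ℕ.+-monoˡ-< ((m ℕ./ 2) ℕ.* 2) (m%n<n m 2) ⟩
    2 ℕ.+ (m ℕ./ 2) ℕ.* 2          ≡⟨ ℕ.*-comm (suc (m ℕ./ 2)) 2 ⟩
    2 ℕ.* suc (m ℕ./ 2)            ∎
    where open ℕ.≤-Reasoning

-- In a sorted list a downward closed property that holds at j holds at all j + 1 positions up to j,
-- hence for at least half of the entries.
central-lower : ∀ (P : ℕ → Bool) → (∀ {x y} → x ℕ.≤ y → T (P y) → T (P x)) → ∀ {xs} →
  2 ℕ.* countᵇ P xs ℕ.< length xs → ∀ j → Central (length xs) j → ∀ {y} → nth (sort xs) j ≡ just y → ¬ T (P y)
central-lower P down {xs} few j (c , _) eq Py = ℕ.<-irrefl refl (begin-strict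
  length xs                      ≤⟨ c ⟩
  2 ℕ.* suc j                    ≤⟨ ℕ.*-monoʳ-≤ 2 (nth-lower P down (Linked⇒AllPairs ℕ.≤-trans (sort-↗ xs)) j eq Py) ⟩
  2 ℕ.* countᵇ P (sort xs)       ≡⟨ cong (2 ℕ.*_) (countᵇ-↭ P (sort-↭ xs)) ⟩
  2 ℕ.* countᵇ P xs              <⟨ few ⟩
  length xs                      ∎)
  where open ℕ.≤-Reasoning

central-upper : ∀ (P : ℕ → Bool) → (∀ {x y} → x ℕ.≤ y → T (P x) → T (P y)) → ∀ {xs} →
  2 ℕ.* countᵇ P xs ℕ.< length xs → ∀ j → Central (length xs) j → ∀ {y} → nth (sort xs) j ≡ just y → ¬ T (P y)
central-upper P up {xs} few j (_ , c) eq Py = ℕ.<-irrefl refl (begin-strict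
  2 ℕ.* len                        ≤⟨ ℕ.*-monoʳ-≤ 2 size≤ ⟩
  2 ℕ.* (j ℕ.+ countᵇ P xs)      ≡⟨ ℕ.*-distribˡ-+ 2 j (countᵇ P xs) ⟩
  2 ℕ.* j ℕ.+ 2 ℕ.* countᵇ P xs  <⟨ ℕ.+-mono-≤-< c few ⟩
  len ℕ.+ len                        ≡⟨ cong (len ℕ.+_) (ℕ.+-identityʳ len) ⟨
  2 ℕ.* len                        ∎)
  where
  open ℕ.≤-Reasoning
  len = length xs
  size≤ : len ℕ.≤ j ℕ.+ countᵇ P xs
  size≤ = subst₂ (λ a b → a ℕ.≤ j ℕ.+ b) (↭-length (sort-↭ xs)) (countᵇ-↭ P (sort-↭ xs))
    (nth-upper P up (Linked⇒AllPairs ℕ.≤-trans (sort-↗ xs)) j eq Py)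

central<length : ∀ xs → 0 ℕ.< length xs → ∀ j → Central (length xs) j → j ℕ.< length (sort xs)
central<length xs 0<L j (_ , c) = subst (j ℕ.<_) (sym (↭-length (sort-↭ xs))) (lemma j c)
  where
  lemma : ∀ j → 2 ℕ.* j ℕ.≤ length xs → j ℕ.< length xs
  lemma zero    _ = 0<L
  lemma (suc j) c = ℕ.<-≤-trans (ℕ.m<m+n (suc j) (ℕ.s≤s ℕ.z≤n)) c

-- Quantifying over `R` hands over what is known of central entries for both middle entries at once,
-- without recording their positions in the result.
median-between : ∀ xs → 0 ℕ.< length xs → ∃[ a ] ∃[ b ] (median xs ≡ just (+ (a ℕ.+ b) / 2) ×
  (∀ (R : ℕ → Set) → (∀ j → Central (length xs) j → ∀ {y} → nth (sort xs) j ≡ just y → R y) → R a × R b))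
median-between xs 0<L with nth (sort xs) ((length xs ℕ.∸ 1) ℕ./ 2) in p | nth (sort xs) (length xs ℕ./ 2) in q
... | just a  | just b  = a , b , refl , λ R r → r _ (proj₁ (median-central _ 0<L)) p , r _ (proj₂ (median-central _ 0<L)) q
... | nothing | _       = contradiction (trans (sym p) (proj₂ (nth-exists (sort xs) (central<length xs 0<L _ (proj₁ (median-central _ 0<L)))))) (λ ())
... | just _  | nothing = contradiction (trans (sym q) (proj₂ (nth-exists (sort xs) (central<length xs 0<L _ (proj₂ (median-central _ 0<L)))))) (λ ())

module _ (bad : Maybe ℕ → Bool) (bad-nothing : bad nothing ≡ true) where

  countᵇ-catMaybes-good : ∀ cs → countᵇ (λ v → not (bad v)) cs ≡ countᵇ (λ v → not (bad (just v))) (catMaybes cs)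
  countᵇ-catMaybes-good [] = refl
  countᵇ-catMaybes-good (nothing ∷ cs) rewrite bad-nothing = countᵇ-catMaybes-good cs
  countᵇ-catMaybes-good (just v ∷ cs) with bad (just v)
  ... | true  = countᵇ-catMaybes-good cs
  ... | false = cong suc (countᵇ-catMaybes-good cs)

  countᵇ-catMaybes-bad : ∀ cs → countᵇ (λ v → bad (just v)) (catMaybes cs) ℕ.≤ countᵇ bad cs
  countᵇ-catMaybes-bad [] = ℕ.z≤n
  countᵇ-catMaybes-bad (nothing ∷ cs) = ℕ.≤-trans (countᵇ-catMaybes-bad cs) (countᵇ-∷-≤ bad nothing cs)
  countᵇ-catMaybes-bad (just v ∷ cs) with bad (just v)
  ... | true  = ℕ.s≤s (countᵇ-catMaybes-bad cs)
  ... | false = countᵇ-catMaybes-bad cs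

  -- The reason for counting ⊥ as an error on either side: discarding it removes only bad entries
  -- and keeps all good ones.
  minority : ∀ cs → countᵇ bad cs ℕ.< countᵇ (λ v → not (bad v)) cs →
    2 ℕ.* countᵇ (λ v → bad (just v)) (catMaybes cs) ℕ.< length (catMaybes cs)
  minority cs p = begin-strict
    2 ℕ.* b  ≡⟨ cong (b ℕ.+_) (ℕ.+-identityʳ b) ⟩
    b ℕ.+ b  <⟨ ℕ.+-monoʳ-< b (ℕ.≤-<-trans (countᵇ-catMaybes-bad cs) (subst (countᵇ bad cs ℕ.<_) (countᵇ-catMaybes-good cs) p)) ⟩
    b ℕ.+ countᵇ (λ v → not (bad (just v))) xs  ≡⟨ countᵇ-not (λ _ → true) (λ v → bad (just v)) xs ⟩
    countᵇ (λ _ → true) xs  ≡⟨ countᵇ-true (λ _ → true) (All.universal (λ _ → _) xs) ⟩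
    length xs ∎
    where
    open ℕ.≤-Reasoning
    xs = catMaybes cs
    b = countᵇ (λ v → bad (just v)) xs

-- The decidable success event and its probability

does⇒ : ∀ {P : Set} (P? : Dec P) → T (does P?) → P
does⇒ (yes p) _ = p

⇒does : ∀ {P : Set} (P? : Dec P) → P → does P? ≡ true
⇒does (yes _) _ = refl
⇒does (no ¬p) p = contradiction p ¬p

⇒T-does : ∀ {P : Set} (P? : Dec P) → P → T (does P?)
⇒T-does P? p = subst T (sym (⇒does P? p)) _

-- A rational form of the guarantee, used with `e` below ε; being decidable, it can serve as an
-- inner approximation in `Pr`.
accept : ℚ → ℚ → Maybe ℚ → Bool
accept e N nothing  = false
accept e N (just c) = does (N ≤? (1ℚ + e) * c) ∧ does (c ≤? (1ℚ + e) * N)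

module _ {e N : ℚ} (0<e : 0ℚ < e) where

  0≤1+e : 0ℚ ≤ 1ℚ + e
  0≤1+e = +-nonNeg 0≤1 (<⇒≤ 0<e)

  below-down : ∀ {x y} → x ℕ.≤ y → T (below e N (just y)) → T (below e N (just x))
  below-down {x} {y} x≤y p = ⇒T-does ((1ℚ + e) * fromNat x <? N)
    (≤-<-trans (*-monoˡ-≤ 0≤1+e (fromNat-mono-≤ x≤y)) (does⇒ ((1ℚ + e) * fromNat y <? N) p))

  above-up : ∀ {x y} → x ℕ.≤ y → T (above e N (just x)) → T (above e N (just y))
  above-up {x} {y} x≤y p = ⇒T-does ((1ℚ + e) * N <? fromNat y)
    (<-≤-trans (does⇒ ((1ℚ + e) * N <? fromNat x) p) (fromNat-mono-≤ x≤y))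

  accept-mean : ∀ a b → ¬ T (below e N (just a)) × ¬ T (above e N (just a)) → ¬ T (below e N (just b)) × ¬ T (above e N (just b)) →
    accept e N (just (+ (a ℕ.+ b) / 2)) ≡ true
  accept-mean a b (la , ha) (lb , hb) = cong₂ _∧_
    (⇒does (N ≤? (1ℚ + e) * c) (*-cancelˡ-≤ 0<2 (subst₂ _≤_ (e₁ N)
      (trans (e₂ (1ℚ + e) (fromNat a) (fromNat b)) (trans (cong ((1ℚ + e) *_) (sym c*2)) (e₃ (1ℚ + e) c (fromNat 2))))
      (+-mono-≤ (≮⇒≥ (λ p → la (⇒T-does ((1ℚ + e) * fromNat a <? N) p))) (≮⇒≥ (λ p → lb (⇒T-does ((1ℚ + e) * fromNat b <? N) p)))))))
    (⇒does (c ≤? (1ℚ + e) * N) (*-cancelˡ-≤ 0<2 (subst₂ _≤_ (trans (sym c*2) (*-comm c (fromNat 2))) (e₁ ((1ℚ + e) * N))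
      (+-mono-≤ (≮⇒≥ (λ p → ha (⇒T-does ((1ℚ + e) * N <? fromNat a) p))) (≮⇒≥ (λ p → hb (⇒T-does ((1ℚ + e) * N <? fromNat b) p)))))))
    where
    c = + (a ℕ.+ b) / 2
    0<2 : 0ℚ < fromNat 2
    0<2 = positive⁻¹ (fromNat 2)
    c*2 : c * fromNat 2 ≡ fromNat a + fromNat b
    c*2 = trans (/-*-cancel (a ℕ.+ b) 1) (fromNat-+ a b)
    e₁ : ∀ N → N + N ≡ fromNat 2 * N
    e₁ = solve-∀ ℚ-ring
    e₂ : ∀ u a b → u * a + u * b ≡ u * (a + b)
    e₂ = solve-∀ ℚ-ring
    e₃ : ∀ u c d → u * (c * d) ≡ d * (u * c)
    e₃ = solve-∀ ℚ-ring

  majority-accepts : ∀ cs →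
    countᵇ (below e N) cs ℕ.< countᵇ (good (below e N)) cs →
    countᵇ (above e N) cs ℕ.< countᵇ (good (above e N)) cs →
    accept e N (median (catMaybes cs)) ≡ true
  majority-accepts cs lo hi = go (median-between xs (ℕ.≤-<-trans ℕ.z≤n few-below))
    where
    xs = catMaybes cs
    few-below = minority (below e N) refl cs lo
    few-above = minority (above e N) refl cs hi
    Fine : ℕ → Set
    Fine y = ¬ T (below e N (just y)) × ¬ T (above e N (just y))
    fine : ∀ j → Central (length xs) j → ∀ {y} → nth (sort xs) j ≡ just y → Fine y
    fine j c eq = central-lower (λ v → below e N (just v)) below-down few-below j c eq
                , central-upper (λ v → above e N (just v)) above-up few-above j c eq
    go : ∃[ a ] ∃[ b ] (median xs ≡ just (+ (a ℕ.+ b) / 2) ×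
      (∀ (R : ℕ → Set) → (∀ j → Central (length xs) j → ∀ {y} → nth (sort xs) j ≡ just y → R y) → R a × R b)) →
      accept e N (median xs) ≡ true
    go (a , b , eq , central) = trans (cong (accept e N) eq)
      (accept-mean a b (proj₁ (central Fine fine)) (proj₂ (central Fine fine)))

  -- Markov's inequality for both weights and the union bound are merged into one pointwise
  -- estimate: success + wL + wH is at least 1, because a wrong median puts one of the errors into
  -- at least half of the runs.
  amplification : ∀ (core : Rand (Maybe ℕ)) t →
    𝔼 core (λ v → indicator (below e N v)) ≤ + 2 / 5 →
    𝔼 core (λ v → indicator (above e N v)) ≤ + 2 / 5 →
    1ℚ - ((+ 49 / 50) ^ t + (+ 49 / 50) ^ t) ≤
    prob (replicateᴿ t core >>= λ cs → return (median (catMaybes (Vec.toList cs)))) (accept e N)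
  amplification core t lo hi = begin
    1ℚ - (q + q)
      ≤⟨ +-monoʳ-≤ 1ℚ (neg-antimono-≤ (+-mono-≤ (𝔼-weight (below e N) core lo t) (𝔼-weight (above e N) core hi t))) ⟩
    1ℚ - (𝔼 runs wL + 𝔼 runs wH)
      ≤⟨ ≤-diff (≤⇒0≤- sum-bound) (eq (𝔼 runs wL) (𝔼 runs wH) (𝔼 runs success)) ⟩
    𝔼 runs success
      ≡⟨ 𝔼->>= runs _ _ ⟨
    𝔼 (runs >>= λ cs → return (median (catMaybes (Vec.toList cs)))) (λ v → indicator (accept e N v))
      ≡⟨ prob≡𝔼 (runs >>= λ cs → return (median (catMaybes (Vec.toList cs)))) (accept e N) ⟨
    prob (runs >>= λ cs → return (median (catMaybes (Vec.toList cs)))) (accept e N) ∎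
    where
    open ≤-Reasoning
    q = (+ 49 / 50) ^ t
    runs = replicateᴿ t core
    wL wH success : Vec (Maybe ℕ) t → ℚ
    wL = weight (below e N)
    wH = weight (above e N)
    success cs = indicator (accept e N (median (catMaybes (Vec.toList cs))))
    eq : ∀ a b s → s ≡ 1ℚ - (a + b) + (s + (a + b) - 1ℚ)
    eq = solve-∀ ℚ-ring
    pointwise : ∀ cs → 1ℚ ≤ success cs + (wL cs + wH cs)
    pointwise cs = go (countᵇ (good (below e N)) xs ℕ.≤? countᵇ (below e N) xs) (countᵇ (good (above e N)) xs ℕ.≤? countᵇ (above e N) xs)
      where
      xs = Vec.toList cs
      0≤s : 0ℚ ≤ success cs
      0≤s = 0≤indicator (accept e N (median (catMaybes xs)))
      go : Dec (countᵇ (good (below e N)) xs ℕ.≤ countᵇ (below e N) xs) →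
           Dec (countᵇ (good (above e N)) xs ℕ.≤ countᵇ (above e N) xs) → 1ℚ ≤ success cs + (wL cs + wH cs)
      go (yes p) _ = ≤-trans (1≤weight (below e N) cs p) (≤-diff (+-nonNeg 0≤s (0≤weight (above e N) cs)) (eq₁ (success cs) (wL cs) (wH cs)))
        where
        eq₁ : ∀ s a b → s + (a + b) ≡ a + (s + b)
        eq₁ = solve-∀ ℚ-ring
      go (no _) (yes p) = ≤-trans (1≤weight (above e N) cs p) (≤-diff (+-nonNeg 0≤s (0≤weight (below e N) cs)) (eq₁ (success cs) (wL cs) (wH cs)))
        where
        eq₁ : ∀ s a b → s + (a + b) ≡ b + (s + a)
        eq₁ = solve-∀ ℚ-ring
      go (no p) (no p′) = ≤-diff (+-nonNeg (0≤weight (below e N) cs) (0≤weight (above e N) cs))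
        (cong (λ b → indicator b + (wL cs + wH cs)) (majority-accepts xs (ℕ.≰⇒> p) (ℕ.≰⇒> p′)))
    sum-bound : 1ℚ ≤ 𝔼 runs success + (𝔼 runs wL + 𝔼 runs wH)
    sum-bound = subst₂ _≤_ (𝔼-const runs 1ℚ)
      (trans (𝔼-+ runs success (λ cs → wL cs + wH cs)) (cong (λ z → 𝔼 runs success + z) (𝔼-+ runs wL wH)))
      (𝔼-mono runs pointwise)

-- Real numbers

LB UB : Cut → ℚ → Set
LB x a = ∀ q → q < a → L x q
UB x b = ∀ q → b < q → U x q

-- Stands in for real arithmetic: positive rational intervals pass through each cut formula without
-- a proof that the result is real. Bounds may be attained, so a rational has a degenerate interval.
record Enclosed (x : Cut) (a b : ℚ) : Set where
  field
    0<lower     : 0ℚ < a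
    lower≤upper : a ≤ b
    lowerBound  : LB x a
    upperBound  : UB x b

  0<upper : 0ℚ < b
  0<upper = <-≤-trans 0<lower lower≤upper

open Enclosed

fromℚ-enclosed : ∀ {p} → 0ℚ < p → Enclosed (fromℚ p) p p
fromℚ-enclosed 0<p = record { 0<lower = 0<p ; lower≤upper = ≤-refl ; lowerBound = λ _ r → r ; upperBound = λ _ r → r }

midgap : ∀ {a b} → a < b → 0ℚ < ½ * (b - a)
midgap p = *-pos 0<½ (<⇒0<- p)

+-enclosed : ∀ {x y a b c d} → Enclosed x a b → Enclosed y c d → Enclosed (x +ᶜ y) (a + c) (b + d)
+-enclosed {x} {y} {a} {b} {c} {d} X Y = record
  { 0<lower = +-pos (0<lower X) (0<lower Y)
  ; lower≤upper = +-mono-≤ (lower≤upper X) (lower≤upper Y)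
  ; lowerBound = λ q p → let η = ½ * (a + c - q) in a - η , c - η
      , lowerBound X _ (<-diff (midgap p) (eq₁ a η)) , lowerBound Y _ (<-diff (midgap p) (eq₁ c η)) , eq₂ a c q
  ; upperBound = λ q p → let η = ½ * (q - (b + d)) in b + η , d + η
      , upperBound X _ (<-diff (midgap p) refl) , upperBound Y _ (<-diff (midgap p) refl) , eq₃ b d q
  }
  where
  eq₁ : ∀ a η → a ≡ a - η + η
  eq₁ = solve-∀ ℚ-ring
  eq₂ : ∀ a c q → q ≡ a - ½ * (a + c - q) + (c - ½ * (a + c - q))
  eq₂ = solve-∀ ℚ-ring
  eq₃ : ∀ b d q → q ≡ b + ½ * (q - (b + d)) + (d + ½ * (q - (b + d)))
  eq₃ = solve-∀ ℚ-ring

*-enclosed : ∀ {x y a b c d} → Enclosed x a b → Enclosed y c d → Enclosed (x *ᶜ y) (a * c) (b * d)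
*-enclosed {x} {y} {a} {b} {c} {d} X Y = record
  { 0<lower = *-pos 0<a 0<c
  ; lower≤upper = *-mono-≤ (<⇒≤ 0<a) (<⇒≤ 0<c) a≤b c≤d
  ; lowerBound = lower
  ; upperBound = upper
  }
  where
  0<a = 0<lower X
  0<c = 0<lower Y
  0<b = 0<upper X
  0<d = 0<upper Y
  a≤b = lower≤upper X
  c≤d = lower≤upper Y
  lower : LB (x *ᶜ y) (a * c)
  -- Shrinking both lower ends by the factor 1 - s costs at most 2 s a c, kept within half of the
  -- gap. The upper ends may be crude, because the least of the four products is a′ c′.
  lower q p = go (small (a * c + a * c) (½ * (a * c - q)) (+-nonNeg (<⇒≤ 0<ac) (<⇒≤ 0<ac)) (midgap p))
    where
    0<ac = *-pos 0<a 0<c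
    go : ∃[ s ] (0ℚ < s × s ≤ ½ × s * (a * c + a * c) ≤ ½ * (a * c - q)) → L (x *ᶜ y) q
    go (s , 0<s , s≤½ , sM) = a′ , b + 1ℚ , c′ , d + 1ℚ
      , lowerBound X _ (<-diff (*-pos 0<s 0<a) (e₁ s a)) , upperBound X _ (<-diff 0<1 refl)
      , lowerBound Y _ (<-diff (*-pos 0<s 0<c) (e₁ s c)) , upperBound Y _ (<-diff 0<1 refl)
      , q<a′c′ , <-≤-trans q<a′c′ (*-monoˡ-≤ 0≤a′ c′≤) , <-≤-trans q<a′c′ (*-mono-≤ 0≤a′ 0≤c′ a′≤ ≤-refl)
      , <-≤-trans q<a′c′ (*-mono-≤ 0≤a′ 0≤c′ a′≤ c′≤)
      where
      a′ = (1ℚ - s) * a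
      c′ = (1ℚ - s) * c
      e₁ : ∀ s a → a ≡ (1ℚ - s) * a + s * a
      e₁ = solve-∀ ℚ-ring
      e₂ : ∀ s → 1ℚ - s ≡ ½ + (½ - s)
      e₂ = solve-∀ ℚ-ring
      e₃ : ∀ s a b → b + 1ℚ ≡ (1ℚ - s) * a + (b - a + (s * a + 1ℚ))
      e₃ = solve-∀ ℚ-ring
      e₄ : ∀ s a c q → (1ℚ - s) * a * ((1ℚ - s) * c) ≡ q + (½ * (a * c - q) + (½ * (a * c - q) - s * (a * c + a * c) + s * s * (a * c)))
      e₄ = solve-∀ ℚ-ring
      0≤1-s : 0ℚ ≤ 1ℚ - s
      0≤1-s = ≤-trans 0≤½ (≤-diff (≤⇒0≤- s≤½) (e₂ s))
      0≤a′ = *-nonNeg 0≤1-s (<⇒≤ 0<a)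
      0≤c′ = *-nonNeg 0≤1-s (<⇒≤ 0<c)
      a′≤ : a′ ≤ b + 1ℚ
      a′≤ = ≤-diff (+-nonNeg (≤⇒0≤- a≤b) (+-nonNeg (*-nonNeg (<⇒≤ 0<s) (<⇒≤ 0<a)) 0≤1)) (e₃ s a b)
      c′≤ : c′ ≤ d + 1ℚ
      c′≤ = ≤-diff (+-nonNeg (≤⇒0≤- c≤d) (+-nonNeg (*-nonNeg (<⇒≤ 0<s) (<⇒≤ 0<c)) 0≤1)) (e₃ s c d)
      q<a′c′ : q < a′ * c′
      q<a′c′ = <-diff (<-≤-trans (midgap p) (≤-diff (+-nonNeg (≤⇒0≤- sM) (*-nonNeg (square-nonNeg s) (<⇒≤ 0<ac))) refl)) (e₄ s a c q)
  upper : UB (x *ᶜ y) (b * d)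
  -- Raising both upper ends by s ≤ 1/2 costs at most s (b + d + 1).
  upper q p = go (small (b + d + 1ℚ) (½ * (q - b * d)) (+-nonNeg (+-nonNeg (<⇒≤ 0<b) (<⇒≤ 0<d)) 0≤1) (midgap p))
    where
    go : ∃[ s ] (0ℚ < s × s ≤ ½ × s * (b + d + 1ℚ) ≤ ½ * (q - b * d)) → U (x *ᶜ y) q
    go (s , 0<s , s≤½ , sM) = ½ * a , b′ , ½ * c , d′
      , lowerBound X _ (<-diff (*-pos 0<½ 0<a) (e₁ a)) , upperBound X _ (<-diff 0<s refl)
      , lowerBound Y _ (<-diff (*-pos 0<½ 0<c) (e₁ c)) , upperBound Y _ (<-diff 0<s refl)
      , ≤-<-trans (*-mono-≤ 0≤a′ 0≤c′ a′≤ c′≤) b′d′<q , ≤-<-trans (*-mono-≤ 0≤a′ 0≤d′ a′≤ ≤-refl) b′d′<q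
      , ≤-<-trans (*-monoˡ-≤ 0≤b′ c′≤) b′d′<q , b′d′<q
      where
      b′ = b + s
      d′ = d + s
      e₁ : ∀ a → a ≡ ½ * a + ½ * a
      e₁ = solve-∀ ℚ-ring
      e₂ : ∀ s a b → b + s ≡ ½ * a + (b - a + (½ * a + s))
      e₂ = solve-∀ ℚ-ring
      e₃ : ∀ s b d q → q ≡ (b + s) * (d + s) + (½ * (q - b * d) + (½ * (q - b * d) - s * (b + d + 1ℚ) + s * (½ - s + ½)))
      e₃ = solve-∀ ℚ-ring
      0≤a′ = *-nonNeg 0≤½ (<⇒≤ 0<a)
      0≤c′ = *-nonNeg 0≤½ (<⇒≤ 0<c)
      0≤b′ = +-nonNeg (<⇒≤ 0<b) (<⇒≤ 0<s)
      0≤d′ = +-nonNeg (<⇒≤ 0<d) (<⇒≤ 0<s)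
      a′≤ : ½ * a ≤ b′
      a′≤ = ≤-diff (+-nonNeg (≤⇒0≤- a≤b) (+-nonNeg 0≤a′ (<⇒≤ 0<s))) (e₂ s a b)
      c′≤ : ½ * c ≤ d′
      c′≤ = ≤-diff (+-nonNeg (≤⇒0≤- c≤d) (+-nonNeg 0≤c′ (<⇒≤ 0<s))) (e₂ s c d)
      b′d′<q : b′ * d′ < q
      b′d′<q = <-diff (<-≤-trans (midgap p) (≤-diff (+-nonNeg (≤⇒0≤- sM)
        (*-nonNeg (<⇒≤ 0<s) (+-nonNeg (≤⇒0≤- s≤½) 0≤½))) refl)) (e₃ s b d q)

^-enclosed : ∀ {x a b} → Enclosed x a b → ∀ n → Enclosed (x ^ᶜ n) (a ^ n) (b ^ n)
^-enclosed X zero    = fromℚ-enclosed 0<1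
^-enclosed X (suc n) = *-enclosed X (^-enclosed X n)

inv-enclosed : ∀ {x a b a⁻¹ b⁻¹} → Enclosed x a b → 0ℚ < a⁻¹ → a⁻¹ * a ≡ 1ℚ → 0ℚ < b⁻¹ → b⁻¹ * b ≡ 1ℚ →
  Enclosed (inv x) b⁻¹ a⁻¹
inv-enclosed {x} {a} {b} {a⁻¹} {b⁻¹} X 0<a⁻¹ a⁻¹a 0<b⁻¹ b⁻¹b = record
  { 0<lower = 0<b⁻¹
  ; lower≤upper = *-cancelˡ-≤ (*-pos 0<a 0<b) (subst₂ _≤_
      (trans (sym (*-identityʳ a)) (trans (cong (a *_) (sym b⁻¹b)) (e₁ a b b⁻¹)))
      (trans (sym (*-identityʳ b)) (trans (cong (b *_) (sym a⁻¹a)) (e₂ a b a⁻¹)))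
      (lower≤upper X))
  ; lowerBound = lower
  ; upperBound = upper
  }
  where
  0<a = 0<lower X
  0<b = 0<upper X
  e₁ : ∀ a b c → a * (c * b) ≡ a * b * c
  e₁ = solve-∀ ℚ-ring
  e₂ : ∀ a b c → b * (c * a) ≡ a * b * c
  e₂ = solve-∀ ℚ-ring
  lower : LB (inv x) b⁻¹
  lower q p = go (small b⁻¹ (½ * (1ℚ - q * b)) (<⇒≤ 0<b⁻¹) (midgap qb<1))
    where
    qb<1 : q * b < 1ℚ
    qb<1 = subst (q * b <_) b⁻¹b (*-monoˡ-<-pos b {{positive 0<b}} p)
    go : ∃[ s ] (0ℚ < s × s ≤ ½ × s * b⁻¹ ≤ ½ * (1ℚ - q * b)) → L (inv x) q
    go (s , 0<s , _ , sM) = b + s , upperBound X _ (<-diff 0<s refl)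
      , <-diff (<-≤-trans (midgap qb<1) (≤-diff (+-nonNeg (≤⇒0≤- sM) (*-nonNeg (<⇒≤ 0<s) (≤⇒0≤- (<⇒≤ p)))) refl)) (e₃ q b b⁻¹ s)
      where
      e₃ : ∀ q b c s → 1ℚ ≡ q * (b + s) + (½ * (1ℚ - q * b) + (½ * (1ℚ - q * b) - s * c + s * (c - q)))
      e₃ = solve-∀ ℚ-ring
  upper : UB (inv x) a⁻¹
  upper q p = go (small (q * a) (½ * (q * a - 1ℚ)) (<⇒≤ (<-trans 0<1 1<qa)) (midgap 1<qa))
    where
    1<qa : 1ℚ < q * a
    1<qa = subst (_< q * a) a⁻¹a (*-monoˡ-<-pos a {{positive 0<a}} p)
    go : ∃[ s ] (0ℚ < s × s ≤ ½ × s * (q * a) ≤ ½ * (q * a - 1ℚ)) → U (inv x) q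
    go (s , 0<s , s≤½ , sM) = (1ℚ - s) * a , *-pos (<-≤-trans 0<½ (≤-diff (≤⇒0≤- s≤½) (e₄ s))) 0<a
      , lowerBound X _ (<-diff (*-pos 0<s 0<a) (e₅ s a))
      , <-diff (<-≤-trans (midgap 1<qa) (≤-diff (≤⇒0≤- sM) refl)) (e₆ q a s)
      where
      e₄ : ∀ s → 1ℚ - s ≡ ½ + (½ - s)
      e₄ = solve-∀ ℚ-ring
      e₅ : ∀ s a → a ≡ (1ℚ - s) * a + s * a
      e₅ = solve-∀ ℚ-ring
      e₆ : ∀ q a s → q * ((1ℚ - s) * a) ≡ 1ℚ + (½ * (q * a - 1ℚ) + (½ * (q * a - 1ℚ) - s * (q * a)))
      e₆ = solve-∀ ℚ-ring

enclosed-≤ᶜ : ∀ {x a b} → Enclosed x a b → ∀ p → x ≤ᶜ fromℚ p → a ≤ p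
enclosed-≤ᶜ X p x≤p = ≮⇒≥ (λ p<a → <-irrefl refl (x≤p p (lowerBound X p p<a)))

0≤1/suc : ∀ k → 0ℚ ≤ + 1 / suc k
0≤1/suc k = nonNegative⁻¹ _ {{normalize-nonNeg 1 (suc k)}}

1/suc≤1 : ∀ k → + 1 / suc k ≤ 1ℚ
1/suc≤1 k = begin
  + 1 / suc k                        ≤⟨ ≤-diff (*-nonNeg (0≤1/suc k) (fromNat-nonNeg k)) (eq (+ 1 / suc k) (fromNat k)) ⟩
  + 1 / suc k * (1ℚ + fromNat k)     ≡⟨ cong (+ 1 / suc k *_) (fromNat-suc k) ⟨
  + 1 / suc k * fromNat (suc k)      ≡⟨ /-*-cancel 1 k ⟩
  1ℚ                                 ∎
  where
  open ≤-Reasoning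
  eq : ∀ r n → r * (1ℚ + n) ≡ r + r * n
  eq = solve-∀ ℚ-ring

expTerm-bounds : ∀ k → 0ℚ ≤ expTerm ½ k × expTerm ½ k ≤ ½ ^ k
expTerm-bounds zero = 0≤1 , ≤-refl
expTerm-bounds (suc k) = *-nonNeg (*-nonNeg lo 0≤½) (0≤1/suc k)
  , ≤-trans (*-mono-≤ (*-nonNeg lo 0≤½) (0≤1/suc k) (*-mono-≤ lo 0≤½ hi ≤-refl) (1/suc≤1 k)) (≤-reflexive (eq (½ ^ k)))
  where
  lo = proj₁ (expTerm-bounds k)
  hi = proj₂ (expTerm-bounds k)
  eq : ∀ p → p * ½ * 1ℚ ≡ ½ * p
  eq = solve-∀ ℚ-ring

-- The terms are dominated by a geometric series; ½ⁿ + ½ⁿ is its remaining tail, included so that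
-- the induction closes.
expSum-bound : ∀ n → expSum ½ n + (½ ^ n + ½ ^ n) ≤ fromNat 2
expSum-bound zero = ≤-refl
expSum-bound (suc n) = ≤-trans (≤-diff (≤⇒0≤- (proj₂ (expTerm-bounds n))) (eq (expSum ½ n) (expTerm ½ n) (½ ^ n))) (expSum-bound n)
  where
  eq : ∀ s t p → s + (p + p) ≡ s + t + (½ * p + ½ * p) + (p - t)
  eq = solve-∀ ℚ-ring

-- 79/48 is 1 + 1/2 + 1/8 + 1/48. The upper bound may be crude: the lower cut of a product of
-- positive factors only asks that some upper approximations exist.
exp½-enclosed : Enclosed (exp ½) (+ 79 / 48) (fromNat 2)
exp½-enclosed = record
  { 0<lower = positive⁻¹ (+ 79 / 48)
  ; lower≤upper = toWitness {a? = + 79 / 48 ≤? fromNat 2} _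
  ; lowerBound = λ q p → 4 , p
  ; upperBound = λ q p → fromNat 2 , p
      , λ n → ≤-trans (≤-diff (+-nonNeg (^-nonNeg 0≤½ n) (^-nonNeg 0≤½ n)) refl) (expSum-bound n)
  }

module Real {x : Cut} (R : IsReal x) where
  open IsReal R

  L<U : ∀ {a b} → L x a → U x b → a < b
  L<U {a} {b} p q = ≰⇒> (λ b≤a → disjoint a (p , U-closed′ b≤a))
    where
    U-closed′ : b ≤ a → U x a
    U-closed′ b≤a = go (b <? a)
      where
      go : Dec (b < a) → U x a
      go (yes b<a) = U-closed a b b<a q
      go (no ¬b<a) = subst (U x) (≤-antisym b≤a (≮⇒≥ ¬b<a)) q

  enclosed : ∀ {a b} → 0ℚ < a → L x a → U x b → Enclosed x a b
  enclosed {a} {b} 0<a p q = record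
    { 0<lower = 0<a
    ; lower≤upper = <⇒≤ (L<U p q)
    ; lowerBound = λ r r<a → L-closed r a r<a p
    ; upperBound = λ r b<r → U-closed r b b<r q
    }

  -- Locatedness between p + s and p + 2s either raises the lower bound by s or stops with an upper
  -- bound 2s above the current one; x ≤ 1 limits the number of steps.
  search : ∀ {s} → 0ℚ < s → x ≤ᶜ fromℕ 1 → ∀ M p → L x p → 1ℚ ≤ p + fromNat M * s →
    ∃[ a ] ∃[ b ] (L x a × U x b × p ≤ a × b ≤ a + (s + s))
  search {s} 0<s x≤1 zero p Lp end = contradiction (<-≤-trans (x≤1 p Lp) (≤-trans end (≤-reflexive (eq p s)))) (<-irrefl refl)
    where
    eq : ∀ p s → p + 0ℚ * s ≡ p
    eq = solve-∀ ℚ-ring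
  search {s} 0<s x≤1 (suc M) p Lp end = go (located (p + s) (p + (s + s)) (<-diff 0<s (sym (+-assoc p s s))))
    where
    Result : ℚ → Set
    Result p = ∃[ a ] ∃[ b ] (L x a × U x b × p ≤ a × b ≤ a + (s + s))
    eq : ∀ p s m → p + (1ℚ + m) * s ≡ p + s + m * s
    eq = solve-∀ ℚ-ring
    weaken : Result (p + s) → Result p
    weaken (a , b , La , Ub , p≤a , b≤) = a , b , La , Ub , ≤-trans (≤-diff (<⇒≤ 0<s) refl) p≤a , b≤
    go : L x (p + s) ⊎ U x (p + (s + s)) → Result p
    go (inj₁ Lp′) = weaken (search 0<s x≤1 M (p + s) Lp′
      (≤-trans end (≤-reflexive (trans (cong (λ z → p + z * s) (fromNat-suc M)) (eq p s (fromNat M))))))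
    go (inj₂ Up) = p , p + (s + s) , Lp , Up , ≤-refl , ≤-refl

  approximate : fromℕ 0 <ᶜ x → x ≤ᶜ fromℕ 1 → ∃[ a ] ∃[ b ] (0ℚ < a × L x a × U x b × fromNat 1000 * b ≤ fromNat 1001 * a)
  approximate (p , 0<p , Lp) x≤1 = go (reciprocal 0<s)
    where
    -- An interval of length at most 2s = p/1000 that starts at a ≥ p has end ratio at most
    -- 1001/1000.
    s = + 1 / 2000 * p
    0<s : 0ℚ < s
    0<s = *-pos (positive⁻¹ (+ 1 / 2000)) 0<p
    go : ∃[ r ] (0ℚ < r × r * s ≡ 1ℚ) → _
    go (r , _ , rs) = go₂ (archimedean r)
      where
      go₂ : ∃[ M ] (r ≤ fromNat M) → _
      go₂ (M , r≤M) = go₃ (search 0<s x≤1 M p Lp (subst (_≤ p + fromNat M * s) rs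
          (≤-trans (*-monoʳ-≤-nonNeg s {{nonNegative (<⇒≤ 0<s)}} r≤M) (≤-diff (<⇒≤ 0<p) (+-comm p _)))))
        where
        go₃ : ∃[ a ] ∃[ b ] (L x a × U x b × p ≤ a × b ≤ a + (s + s)) → _
        go₃ (a , b , La , Ub , p≤a , b≤) = a , b , <-≤-trans 0<p p≤a , La , Ub
          , ≤-diff (+-nonNeg (*-nonNeg (fromNat-nonNeg 1000) (≤⇒0≤- b≤)) (≤⇒0≤- p≤a)) (eq a b p)
          where
          eq : ∀ a b p → fromNat 1001 * a ≡ fromNat 1000 * b + (fromNat 1000 * (a + (+ 1 / 2000 * p + + 1 / 2000 * p) - b) + (a - p))
          eq = solve-∀ ℚ-ring

reciprocal-enclosed : ∀ {x a b} → Enclosed x a b →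
  ∃[ a⁻¹ ] ∃[ b⁻¹ ] (0ℚ < b⁻¹ × a⁻¹ * a ≡ 1ℚ × b⁻¹ * b ≡ 1ℚ × Enclosed (inv x) b⁻¹ a⁻¹)
reciprocal-enclosed {x} {a} {b} X = go (reciprocal (0<lower X)) (reciprocal (0<upper X))
  where
  go : ∃[ a⁻¹ ] (0ℚ < a⁻¹ × a⁻¹ * a ≡ 1ℚ) → ∃[ b⁻¹ ] (0ℚ < b⁻¹ × b⁻¹ * b ≡ 1ℚ) → _
  go (a⁻¹ , p , q) (b⁻¹ , p′ , q′) = a⁻¹ , b⁻¹ , p′ , q , q′ , inv-enclosed X p q p′ q′

fromℕ-enclosed : ∀ n → 0 ℕ.< n → Enclosed (fromℕ n) (fromNat n) (fromNat n)
fromℕ-enclosed n p = fromℚ-enclosed (fromNat-mono-< p)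

-- The constant 13/64 exceeds 1/(3 √e) slightly: 3 √e ≥ 79/16 by four terms of the exponential series, and
-- 79/16 · 13/64 = 1027/1024 leaves room to replace ε by a rational e < ε with ε ≤ 1001/1000 e.
record Tolerance (ε : Cut) (k : ℕ) : Set where
  field
    e β     : ℚ
    Lε      : L ε e
    0<e     : 0ℚ < e
    β-def   : (1ℚ + e) * β ≡ e
    β≤½     : β ≤ ½
    0<β     : 0ℚ < β
    1≤β²k   : 1ℚ ≤ + 13 / 64 * (β * β * fromNat k)
    0<k     : 0 ℕ.< k

pivot-bound : ∀ {b⁻¹ a⁻¹} k {ε} → Enclosed (inv ε) b⁻¹ a⁻¹ →
  fromℕ 3 *ᶜ exp ½ *ᶜ (fromℕ 1 +ᶜ fromℕ 1 /ᶜ ε) ^ᶜ 2 ≤ᶜ fromℕ k →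
  + 79 / 16 * ((1ℚ + b⁻¹) * (1ℚ + b⁻¹)) ≤ fromNat k
pivot-bound {b⁻¹} k I ceil = subst (_≤ fromNat k) (eq b⁻¹) (enclosed-≤ᶜ
  (*-enclosed (*-enclosed (fromℕ-enclosed 3 (ℕ.s≤s ℕ.z≤n)) exp½-enclosed)
    (^-enclosed (+-enclosed (fromℕ-enclosed 1 (ℕ.s≤s ℕ.z≤n)) (*-enclosed (fromℕ-enclosed 1 (ℕ.s≤s ℕ.z≤n)) I)) 2)) (fromNat k) ceil)
  where
  eq : ∀ b → fromNat 3 * (+ 79 / 48) * ((fromNat 1 + fromNat 1 * b) * ((fromNat 1 + fromNat 1 * b) * 1ℚ)) ≡
    + 79 / 16 * ((1ℚ + b) * (1ℚ + b))
  eq = solve-∀ ℚ-ring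

tolerance : ∀ {ε} → IsReal ε → fromℕ 0 <ᶜ ε → ε ≤ᶜ fromℕ 1 → ∀ {k} →
  fromℕ 3 *ᶜ exp ½ *ᶜ (fromℕ 1 +ᶜ fromℕ 1 /ᶜ ε) ^ᶜ 2 ≤ᶜ fromℕ k → Tolerance ε k
tolerance {ε} R 0<ε ε≤1 {k} ceil = go (Real.approximate R 0<ε ε≤1)
  where
  go : ∃[ a ] ∃[ b ] (0ℚ < a × L ε a × U ε b × fromNat 1000 * b ≤ fromNat 1001 * a) → Tolerance ε k
  go (e , b , 0<e , Le , Ub , close) = go₂ (reciprocal-enclosed E) (reciprocal (+-pos 0<1 0<e))
    where
    E = Real.enclosed R 0<e Le Ub
    0<b = 0<upper E
    go₂ : ∃[ e⁻¹ ] ∃[ b⁻¹ ] (0ℚ < b⁻¹ × e⁻¹ * e ≡ 1ℚ × b⁻¹ * b ≡ 1ℚ × Enclosed (inv ε) b⁻¹ e⁻¹) →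
          ∃[ ι ] (0ℚ < ι × ι * (1ℚ + e) ≡ 1ℚ) → Tolerance ε k
    go₂ (e⁻¹ , b⁻¹ , 0<b⁻¹ , _ , b⁻¹b , I) (ι , 0<ι , ι[1+e]) = record
      { e = e ; β = β ; Lε = Le ; 0<e = 0<e
      ; β-def = trans (e₁ e ι) (trans (cong (e *_) ι[1+e]) (*-identityʳ e))
      ; β≤½ = ≤-diff (*-nonNeg (*-nonNeg 0≤½ (<⇒≤ 0<ι)) (≤⇒0≤- (<⇒≤ (ε≤1 e Le))))
                (trans (trans (sym (*-identityʳ ½)) (cong (½ *_) (sym ι[1+e]))) (e₂ e ι))
      ; 0<β = *-pos 0<e 0<ι
      ; 1≤β²k = 1≤β²k
      ; 0<k = fromNat-cancel-< {0} {k} (<-≤-trans (*-pos {+ 79 / 16} (positive⁻¹ (+ 79 / 16)) (*-pos {1ℚ + b⁻¹} 0<1+b⁻¹ 0<1+b⁻¹)) large)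
      }
      where
      open ≤-Reasoning
      β = e * ι
      0<1+b⁻¹ = +-pos 0<1 0<b⁻¹
      large : + 79 / 16 * ((1ℚ + b⁻¹) * (1ℚ + b⁻¹)) ≤ fromNat k
      large = pivot-bound k {ε} I ceil
      e₁ : ∀ e ι → (1ℚ + e) * (e * ι) ≡ e * (ι * (1ℚ + e))
      e₁ = solve-∀ ℚ-ring
      e₂ : ∀ e ι → ½ * (ι * (1ℚ + e)) ≡ e * ι + ½ * ι * (1ℚ - e)
      e₂ = solve-∀ ℚ-ring
      -- This would be 1 if e were equal to b; their closeness keeps it at least 1000/1001.
      y = β * (1ℚ + b⁻¹)
      e₃ : ∀ e ι b c → b * (e * ι * (1ℚ + c)) ≡ ι * e * (b + c * b)
      e₃ = solve-∀ ℚ-ring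
      e₄ : ∀ e ι b → ι * e * (b + 1ℚ) ≡ b * (+ 1000 / 1001) * (ι * (1ℚ + e))
                      + ι * (+ 1 / 1001 * (e * b + (fromNat 1001 * e - fromNat 1000 * b)))
      e₄ = solve-∀ ℚ-ring
      e₅ : ∀ β c k → + 13 / 64 * (β * β * k) ≡ + 1027 / 1024 * (β * (1ℚ + c) * (β * (1ℚ + c)))
                      + + 13 / 64 * (β * β * (k - + 79 / 16 * ((1ℚ + c) * (1ℚ + c))))
      e₅ = solve-∀ ℚ-ring
      y-bound : + 1000 / 1001 ≤ y
      y-bound = *-cancelˡ-≤ 0<b (begin
        b * (+ 1000 / 1001)                           ≡⟨ trans (sym (*-identityʳ _)) (cong (b * (+ 1000 / 1001) *_) (sym ι[1+e])) ⟩
        b * (+ 1000 / 1001) * (ι * (1ℚ + e))          ≤⟨ ≤-diff (*-nonNeg (<⇒≤ 0<ι) (*-nonNeg (nonNegative⁻¹ (+ 1 / 1001))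
                                                           (+-nonNeg (*-nonNeg (<⇒≤ 0<e) (<⇒≤ 0<b)) (≤⇒0≤- close)))) (e₄ e ι b) ⟩
        ι * e * (b + 1ℚ)                              ≡⟨ cong (λ z → ι * e * (b + z)) b⁻¹b ⟨
        ι * e * (b + b⁻¹ * b)                         ≡⟨ e₃ e ι b b⁻¹ ⟨
        b * y                                         ∎)
      0≤c : 0ℚ ≤ + 1000 / 1001
      0≤c = nonNegative⁻¹ (+ 1000 / 1001)
      1≤β²k : 1ℚ ≤ + 13 / 64 * (β * β * fromNat k)
      1≤β²k = begin
        1ℚ                                                  ≤⟨ toWitness {a? = 1ℚ ≤? + 1027 / 1024 * (+ 1000 / 1001 * (+ 1000 / 1001))} _ ⟩
        + 1027 / 1024 * (+ 1000 / 1001 * (+ 1000 / 1001))   ≤⟨ *-monoˡ-≤ (nonNegative⁻¹ (+ 1027 / 1024)) (*-mono-≤ 0≤c 0≤c y-bound y-bound) ⟩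
        + 1027 / 1024 * (y * y)                             ≤⟨ ≤-diff (*-nonNeg (nonNegative⁻¹ (+ 13 / 64)) (*-nonNeg (square-nonNeg β) (≤⇒0≤- large))) (e₅ β b⁻¹ (fromNat k)) ⟩
        + 13 / 64 * (β * β * fromNat k)                     ∎

accept-sound : ∀ {ε e} → IsReal ε → 0ℚ < e → L ε e → ∀ N v → T (accept e (fromNat N) v) → Within ε N v
accept-sound {ε} {e} R 0<e Le N (just c) t = lower , upper
  where
  open IsReal R
  M = fromNat N
  0≤M = fromNat-nonNeg N
  split : ∀ {a b} → T (a ∧ b) → T a × T b
  split {true} {true} _ = _ , _
  M≤ : M ≤ (1ℚ + e) * c
  M≤ = does⇒ (M ≤? (1ℚ + e) * c) (proj₁ (split t))
  c≤ : c ≤ (1ℚ + e) * M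
  c≤ = does⇒ (c ≤? (1ℚ + e) * M) (proj₂ (split {does (M ≤? (1ℚ + e) * c)} t))
  0<1+e = +-pos 0<1 0<e
  0≤c : 0ℚ ≤ c
  0≤c = *-cancelˡ-≤ 0<1+e (subst (_≤ (1ℚ + e) * c) (sym (*-zeroʳ (1ℚ + e))) (≤-trans 0≤M M≤))

  lower : inv (fromℕ 1 +ᶜ ε) *ᶜ fromℕ N ≤ᶜ fromℚ c
  lower q (a , _ , m , d , (u , (x , y , 1<x , Uy , u≡) , au<1) , _ , m<M , M<d , q<am , q<ad , _) = go (≤-total 0ℚ a)
    where
    open ≤-Reasoning
    go : 0ℚ ≤ a ⊎ a ≤ 0ℚ → q < c
    go (inj₁ 0≤a) = begin-strict
      q                  <⟨ q<am ⟩
      a * m              ≤⟨ *-monoˡ-≤ 0≤a (<⇒≤ m<M) ⟩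
      a * M              ≤⟨ *-monoˡ-≤ 0≤a M≤ ⟩
      a * ((1ℚ + e) * c) ≡⟨ *-assoc a (1ℚ + e) c ⟨
      a * (1ℚ + e) * c   ≤⟨ *-monoʳ-≤-nonNeg c {{nonNegative 0≤c}} (≤-trans (*-monoˡ-≤ 0≤a 1+e≤u) (<⇒≤ au<1)) ⟩
      1ℚ * c             ≡⟨ *-identityˡ c ⟩
      c                  ∎
      where
      1+e≤u : 1ℚ + e ≤ u
      1+e≤u = subst (1ℚ + e ≤_) (sym u≡) (+-mono-≤ (<⇒≤ 1<x) (<⇒≤ (Real.L<U R Le Uy)))
    go (inj₂ a≤0) = <-≤-trans q<ad (≤-trans (≤-diff (*-nonNeg (≤⇒0≤- a≤0) (≤-trans 0≤M (<⇒≤ M<d))) (eq a d)) 0≤c)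
      where
      eq : ∀ a d → 0ℚ ≡ a * d + (0ℚ - a) * d
      eq = solve-∀ ℚ-ring

  upper : fromℚ c ≤ᶜ (fromℕ 1 +ᶜ ε) *ᶜ fromℕ N
  upper q q<c = go (L-rounded e Le) U-inhabited
    where
    p : q < (1ℚ + e) * M
    p = <-≤-trans q<c c≤
    go : ∃[ r ] (e < r × L ε r) → ∃[ y ] U ε y → L ((fromℕ 1 +ᶜ ε) *ᶜ fromℕ N) q
    go (r , e<r , Lr) (y , Uy) = go₂ (small b (½ * (a * M - q)) 0≤b (midgap p))
      where
      a = 1ℚ + e
      b = fromNat 2 + y
      e<y : e < y
      e<y = Real.L<U R Le Uy
      a≤b : a ≤ b
      a≤b = +-mono-≤ (toWitness {a? = 1ℚ ≤? fromNat 2} _) (<⇒≤ e<y)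
      0≤b : 0ℚ ≤ b
      0≤b = ≤-trans (<⇒≤ 0<1+e) a≤b
      go₂ : ∃[ s ] (0ℚ < s × s ≤ ½ × s * b ≤ ½ * (a * M - q)) → L ((fromℕ 1 +ᶜ ε) *ᶜ fromℕ N) q
      -- `M` may be 0, so M - s may be negative and b (M - s) the least product; hence `s` is
      -- measured against the larger factor `b`. The end 1 + e lies in the lower cut of 1 + ε, since
      -- r - e can be moved from the summand 1 to the summand e.
      go₂ (s , 0<s , _ , sb) = a , b , M - s , M + 1ℚ
        , (1ℚ - (r - e) , r , <-diff (<⇒0<- e<r) (e₁ e r) , Lr , e₂ e r)
        , (fromNat 2 , y , toWitness {a? = 1ℚ <? fromNat 2} _ , Uy , refl)
        , <-diff 0<s (e₃ M s) , <-diff 0<1 refl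
        , <-diff (<-≤-trans (midgap p) (≤-diff (+-nonNeg (≤⇒0≤- sb) (*-nonNeg (<⇒≤ 0<s) (≤⇒0≤- a≤b))) refl)) (e₄ a b M s q)
        , <-diff (+-pos (<⇒0<- p) 0<1+e) (e₅ a M q)
        , <-diff (<-≤-trans (midgap p) (≤-diff (+-nonNeg (≤⇒0≤- sb) (*-nonNeg 0≤M (≤⇒0≤- a≤b))) refl)) (e₆ a b M s q)
        , <-diff (<-≤-trans (+-pos (<⇒0<- p) 0<1+e) (≤-diff (*-nonNeg (+-nonNeg 0≤M 0≤1) (≤⇒0≤- a≤b)) refl)) (e₇ a b M q)
        where
        e₁ : ∀ e r → 1ℚ ≡ 1ℚ - (r - e) + (r - e)
        e₁ = solve-∀ ℚ-ring
        e₂ : ∀ e r → 1ℚ + e ≡ 1ℚ - (r - e) + r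
        e₂ = solve-∀ ℚ-ring
        e₃ : ∀ M s → M ≡ M - s + s
        e₃ = solve-∀ ℚ-ring
        e₄ : ∀ a b M s q → a * (M - s) ≡ q + (½ * (a * M - q) + (½ * (a * M - q) - s * b + s * (b - a)))
        e₄ = solve-∀ ℚ-ring
        e₅ : ∀ a M q → a * (M + 1ℚ) ≡ q + (a * M - q + a)
        e₅ = solve-∀ ℚ-ring
        e₆ : ∀ a b M s q → b * (M - s) ≡ q + (½ * (a * M - q) + (½ * (a * M - q) - s * b + M * (b - a)))
        e₆ = solve-∀ ℚ-ring
        e₇ : ∀ a b M q → b * (M + 1ℚ) ≡ q + (a * M - q + a + (M + 1ℚ) * (b - a))
        e₇ = solve-∀ ℚ-ring

-- The logarithm and the number of repetitions

^-flip : ∀ x m n → (x ^ m) ^ n ≡ (x ^ n) ^ m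
^-flip x m n = trans (^-assocʳ x m n) (trans (cong (x ^_) (ℕ.*-comm m n)) (sym (^-assocʳ x n m)))

bernoulli : ∀ {σ} → 0ℚ ≤ σ → ∀ n → 1ℚ + fromNat n * σ ≤ (1ℚ + σ) ^ n
bernoulli {σ} 0≤σ zero = ≤-reflexive (eq σ)
  where
  eq : ∀ σ → 1ℚ + 0ℚ * σ ≡ 1ℚ
  eq = solve-∀ ℚ-ring
bernoulli {σ} 0≤σ (suc n) = ≤-trans
  (≤-diff (*-nonNeg (fromNat-nonNeg n) (square-nonNeg σ))
    (trans (eq σ (fromNat n)) (cong (λ z → 1ℚ + z * σ + fromNat n * (σ * σ)) (sym (fromNat-suc n)))))
  (*-monoˡ-≤ (+-nonNeg 0≤1 0≤σ) (bernoulli 0≤σ n))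
  where
  eq : ∀ σ n → (1ℚ + σ) * (1ℚ + n * σ) ≡ 1ℚ + (1ℚ + n) * σ + n * (σ * σ)
  eq = solve-∀ ℚ-ring

n<2^n : ∀ n → n ℕ.< 2 ℕ.^ n
n<2^n zero = ℕ.s≤s ℕ.z≤n
n<2^n (suc n) = ℕ.≤-<-trans (n<2^n n) (ℕ.m<m+n (2 ℕ.^ n) (subst (0 ℕ.<_) (sym (ℕ.+-identityʳ (2 ℕ.^ n))) (ℕ.≤-<-trans ℕ.z≤n (n<2^n n))))

fromNat-injective : ∀ {m n} → fromNat m ≡ fromNat n → m ≡ n
fromNat-injective {m} {n} eq = ℕ.≤-antisym (fromNat-cancel-≤ {m} {n} (≤-reflexive eq)) (fromNat-cancel-≤ {n} {m} (≤-reflexive (sym eq)))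

-- Bernoulli's inequality for the ratio Y/A. The factor 2 gained turns a strict inequality 2ᵗ < y³⁵
-- into one with a larger rational exponent: for some M, 2 to the power tM + 1 is below y to the
-- power 35M.
exceed-power : ∀ {A Y} → 0ℚ < A → A < Y → ∃[ m ] (fromNat 2 * A ^ suc m < Y ^ suc m)
exceed-power {A} {Y} 0<A A<Y = go (reciprocal 0<A)
  where
  go : ∃[ A⁻¹ ] (0ℚ < A⁻¹ × A⁻¹ * A ≡ 1ℚ) → ∃[ m ] (fromNat 2 * A ^ suc m < Y ^ suc m)
  go (A⁻¹ , 0<A⁻¹ , A⁻¹A) = go₂ (reciprocal 0<σ)
    where
    σ = A⁻¹ * (Y - A)
    0<σ : 0ℚ < σ
    0<σ = *-pos 0<A⁻¹ (<⇒0<- A<Y)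
    e₁ : ∀ A B Y → A * (1ℚ + B * (Y - A)) ≡ A + B * A * (Y - A)
    e₁ = solve-∀ ℚ-ring
    e₂ : ∀ A Y → A + 1ℚ * (Y - A) ≡ Y
    e₂ = solve-∀ ℚ-ring
    Y≡ : A * (1ℚ + σ) ≡ Y
    Y≡ = trans (e₁ A A⁻¹ Y) (trans (cong (λ z → A + z * (Y - A)) A⁻¹A) (e₂ A Y))
    go₂ : ∃[ r ] (0ℚ < r × r * σ ≡ 1ℚ) → ∃[ m ] (fromNat 2 * A ^ suc m < Y ^ suc m)
    go₂ (r , _ , rσ) = go₃ (archimedean r)
      where
      go₃ : ∃[ m ] (r ≤ fromNat m) → ∃[ m ] (fromNat 2 * A ^ suc m < Y ^ suc m)
      go₃ (m , r≤m) = m , subst₂ _<_ (*-comm (A ^ suc m) (fromNat 2))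
          (trans (sym (^-distrib-* A (1ℚ + σ) (suc m))) (cong (_^ suc m) Y≡))
          (*-monoʳ-< (^-pos 0<A (suc m)) (<-≤-trans 2< (bernoulli (<⇒≤ 0<σ) (suc m))))
        where
        e₃ : ∀ m σ → 1ℚ + (1ℚ + m) * σ ≡ fromNat 2 + (σ + (m * σ - 1ℚ))
        e₃ = solve-∀ ℚ-ring
        1≤mσ : 1ℚ ≤ fromNat m * σ
        1≤mσ = subst (_≤ fromNat m * σ) rσ (*-monoʳ-≤-nonNeg σ {{nonNegative (<⇒≤ 0<σ)}} r≤m)
        2< : fromNat 2 < 1ℚ + fromNat (suc m) * σ
        2< = <-diff (<-≤-trans 0<σ (≤-diff (≤⇒0≤- 1≤mσ) refl)) (trans (cong (λ z → 1ℚ + z * σ) (fromNat-suc m)) (e₃ (fromNat m) σ))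

-- The exponents p / suc s are compared after clearing denominators: 2ᵖ < yˢ⁺¹ gives the same inequality for the reduced fraction.
L-log₂ : ∀ {x y z} → Enclosed x y z → ∀ r → 0ℚ ≤ r → ∀ p s → r * fromNat (suc s) ≡ fromNat p →
  fromNat 2 ^ p < y ^ suc s → L (log₂ x) r
L-log₂ E r@(mkℚ -[1+ _ ] _ _) 0≤r p s eq lt = contradiction (<-≤-trans (negative⁻¹ r) 0≤r) (<-irrefl refl)
L-log₂ {x} {y} E r@(mkℚ (+ u) d _) 0≤r p s eq lt = go (<-dense 2ᵘ<yᵈ)
  where
  r[1+d]≡u : r * fromNat (suc d) ≡ fromNat u
  r[1+d]≡u = trans (cong (_* fromNat (suc d)) (sym (↥p/↧p≡p r))) (/-*-cancel u d)
  cross : u ℕ.* suc s ≡ p ℕ.* suc d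
  cross = fromNat-injective (begin
    fromNat (u ℕ.* suc s)                   ≡⟨ fromNat-* u (suc s) ⟩
    fromNat u * fromNat (suc s)             ≡⟨ cong (_* fromNat (suc s)) r[1+d]≡u ⟨
    r * fromNat (suc d) * fromNat (suc s)   ≡⟨ swap r (fromNat (suc d)) (fromNat (suc s)) ⟩
    r * fromNat (suc s) * fromNat (suc d)   ≡⟨ cong (_* fromNat (suc d)) eq ⟩
    fromNat p * fromNat (suc d)             ≡⟨ fromNat-* p (suc d) ⟨
    fromNat (p ℕ.* suc d)                   ∎)
    where
    open ≡-Reasoning
    swap : ∀ a b c → a * b * c ≡ a * c * b
    swap = solve-∀ ℚ-ring
  0≤2 : 0ℚ ≤ fromNat 2
  0≤2 = fromNat-nonNeg 2
  2ᵘ<yᵈ : fromNat (2 ℕ.^ u) < y ^ suc d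
  2ᵘ<yᵈ = subst (_< y ^ suc d) (sym (fromNat-^ 2 u)) (^-cancel-< (^-nonNeg (<⇒≤ (0<lower E)) (suc d)) (suc s)
    (subst₂ _<_ (trans (^-assocʳ (fromNat 2) p (suc d)) (trans (cong (fromNat 2 ^_) (sym cross)) (sym (^-assocʳ (fromNat 2) u (suc s)))))
      (^-flip y (suc s) (suc d)) (^-mono-< (^-nonNeg 0≤2 p) lt d)))
  go : ∃[ q ] (fromNat (2 ℕ.^ u) < q × q < y ^ suc d) → L (log₂ x) r
  go (q , lo , hi) = q , lo , lowerBound (^-enclosed E (suc d)) q hi

-- A crude bound through D < 2ᴰ, supplying the upper approximation that the lower cut of the product
-- 35 · log₂ asks for.
U-log₂ : ∀ {x y z} → Enclosed x y z → ∀ D → z ≤ fromNat D → U (log₂ x) (fromNat D)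
-- The cut of `log₂` reads off numerator and denominator, so `fromNat D` is first rewritten as a
-- reduced fraction.
U-log₂ {x} {y} {z} E D z≤D = subst (U (log₂ x)) (sym (normalize-coprime coprime)) (go (<-dense z<2ᴰ))
  where
  coprime : Coprime D 1
  coprime = Coprime.sym (1-coprimeTo D)
  z<2ᴰ : z * 1ℚ < fromNat (2 ℕ.^ D)
  z<2ᴰ = subst (_< fromNat (2 ℕ.^ D)) (sym (*-identityʳ z)) (≤-<-trans z≤D (fromNat-mono-< (n<2^n D)))
  go : ∃[ q ] (z * 1ℚ < q × q < fromNat (2 ℕ.^ D)) → U (log₂ x) (mkℚ (+ D) 0 coprime)
  go (q , lo , hi) = q , upperBound (^-enclosed E 1) q lo , hi

-- The claim compares rationals, so it may be proved by refutation: its failure yields, through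
-- `exceed-power`, a rational r below log₂ (3/δ) with t < 35 r, which the ceiling excludes.
iterations-bound : ∀ {δ l d} → Enclosed δ l d → ∀ t → fromℕ 35 *ᶜ log₂ (fromℕ 3 /ᶜ δ) ≤ᶜ fromℕ t →
  fromNat 3 ^ 35 ≤ fromNat 2 ^ t * d ^ 35
iterations-bound {δ} {l} {d} E t ceil = ≮⇒≥ (λ few → go few (reciprocal-enclosed E))
  where
  A = fromNat 2 ^ t
  0<A : 0ℚ < A
  0<A = ^-pos (positive⁻¹ (fromNat 2)) t
  go : A * d ^ 35 < fromNat 3 ^ 35 →
    ∃[ l⁻¹ ] ∃[ d⁻¹ ] (0ℚ < d⁻¹ × l⁻¹ * l ≡ 1ℚ × d⁻¹ * d ≡ 1ℚ × Enclosed (inv δ) d⁻¹ l⁻¹) → ⊥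
  go few (l⁻¹ , d⁻¹ , 0<d⁻¹ , _ , d⁻¹d , I) = go₂ (exceed-power 0<A A<Y)
    where
    open ≡-Reasoning
    y = fromNat 3 * d⁻¹
    z = fromNat 3 * l⁻¹
    X : Enclosed (fromℕ 3 /ᶜ δ) y z
    X = *-enclosed (fromℕ-enclosed 3 (ℕ.s≤s ℕ.z≤n)) I
    cancel : A * d ^ 35 * d⁻¹ ^ 35 ≡ A
    cancel = begin
      A * d ^ 35 * d⁻¹ ^ 35    ≡⟨ *-assoc A (d ^ 35) (d⁻¹ ^ 35) ⟩
      A * (d ^ 35 * d⁻¹ ^ 35)  ≡⟨ cong (A *_) (^-distrib-* d d⁻¹ 35) ⟨
      A * (d * d⁻¹) ^ 35       ≡⟨ cong (λ w → A * w ^ 35) (trans (*-comm d d⁻¹) d⁻¹d) ⟩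
      A * 1ℚ ^ 35              ≡⟨ cong (A *_) (1^ 35) ⟩
      A * 1ℚ                   ≡⟨ *-identityʳ A ⟩
      A                        ∎
    A<Y : A < y ^ 35
    A<Y = subst₂ _<_ cancel (sym (^-distrib-* (fromNat 3) d⁻¹ 35)) (*-monoˡ-<-pos (d⁻¹ ^ 35) {{positive (^-pos 0<d⁻¹ 35)}} few)
    go₂ : ∃[ m ] (fromNat 2 * A ^ suc m < (y ^ 35) ^ suc m) → ⊥
    go₂ (m , lt) = go₃ (archimedean z) (archimedean r)
      where
      M = suc m
      -- Chosen so that `suc s` is 35 M by definition.
      s = m ℕ.+ 34 ℕ.* M
      r = + suc (t ℕ.* M) / suc s
      0≤r : 0ℚ ≤ r
      0≤r = nonNegative⁻¹ r {{normalize-nonNeg (suc (t ℕ.* M)) (suc s)}}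
      r-def : r * fromNat (suc s) ≡ fromNat (suc (t ℕ.* M))
      r-def = /-*-cancel (suc (t ℕ.* M)) s
      Lr : L (log₂ (fromℕ 3 /ᶜ δ)) r
      Lr = L-log₂ X r 0≤r (suc (t ℕ.* M)) s r-def
        (subst₂ _<_ (cong (fromNat 2 *_) (^-assocʳ (fromNat 2) t M)) (^-assocʳ y 35 M) lt)
      t<35r : fromNat t < fromNat 35 * r
      t<35r = *-cancelˡ-< (fromNat-nonNeg M) (<-diff 0<1 (begin
        fromNat M * (fromNat 35 * r)        ≡⟨ e₁ (fromNat M) (fromNat 35) r ⟩
        r * (fromNat 35 * fromNat M)        ≡⟨ cong (r *_) (fromNat-* 35 M) ⟨
        r * fromNat (suc s)                 ≡⟨ r-def ⟩
        fromNat (suc (t ℕ.* M))             ≡⟨ fromNat-suc (t ℕ.* M) ⟩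
        1ℚ + fromNat (t ℕ.* M)              ≡⟨ cong (1ℚ Data.Rational.Base.+_) (fromNat-* t M) ⟩
        1ℚ + fromNat t * fromNat M          ≡⟨ e₂ (fromNat t) (fromNat M) ⟩
        fromNat M * fromNat t + 1ℚ          ∎))
        where
        e₁ : ∀ a b c → a * (b * c) ≡ c * (b * a)
        e₁ = solve-∀ ℚ-ring
        e₂ : ∀ a b → 1ℚ + a * b ≡ b * a + 1ℚ
        e₂ = solve-∀ ℚ-ring
      go₃ : ∃[ D₁ ] (z ≤ fromNat D₁) → ∃[ D₂ ] (r ≤ fromNat D₂) → ⊥
      go₃ (D₁ , z≤) (D₂ , r≤) = go₄ (small r (½ * (fromNat 35 * r - fromNat t)) 0≤r (midgap t<35r))
        where
        D = D₁ ℕ.+ D₂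
        z≤D : z ≤ fromNat D
        z≤D = ≤-trans z≤ (fromNat-mono-≤ (ℕ.m≤m+n D₁ D₂))
        r≤D : r ≤ fromNat D
        r≤D = ≤-trans r≤ (fromNat-mono-≤ (ℕ.m≤n+m D₂ D₁))
        go₄ : ∃[ h ] (0ℚ < h × h ≤ ½ × h * r ≤ ½ * (fromNat 35 * r - fromNat t)) → ⊥
        go₄ (h , 0<h , h≤½ , hr) = <-irrefl refl (ceil (fromNat t)
          ( a , fromNat 36 , r , fromNat D
          , <-diff 0<h (e₁ h) , toWitness {a? = fromNat 35 <? fromNat 36} _ , Lr , U-log₂ X D z≤D
          , t<ar , <-≤-trans t<ar (*-monoˡ-≤ 0≤a r≤D) , <-≤-trans t<ar (*-mono-≤ 0≤a 0≤r a≤36 ≤-refl)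
          , <-≤-trans t<ar (*-mono-≤ 0≤a 0≤r a≤36 r≤D)))
          where
          a = fromNat 35 - h
          e₁ : ∀ h → fromNat 35 ≡ fromNat 35 - h + h
          e₁ = solve-∀ ℚ-ring
          e₂ : ∀ h → fromNat 35 - h ≡ + 69 / 2 + (½ - h)
          e₂ = solve-∀ ℚ-ring
          e₃ : ∀ h → fromNat 36 ≡ fromNat 35 - h + (1ℚ + h)
          e₃ = solve-∀ ℚ-ring
          e₄ : ∀ h r t → (fromNat 35 - h) * r ≡ t + (½ * (fromNat 35 * r - t) + (½ * (fromNat 35 * r - t) - h * r))
          e₄ = solve-∀ ℚ-ring
          0≤a : 0ℚ ≤ a
          0≤a = ≤-trans (nonNegative⁻¹ (+ 69 / 2)) (≤-diff (≤⇒0≤- h≤½) (e₂ h))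
          a≤36 : a ≤ fromNat 36
          a≤36 = ≤-diff (+-nonNeg 0≤1 (<⇒≤ 0<h)) (e₃ h)
          t<ar : fromNat t < a * r
          t<ar = <-diff (<-≤-trans (midgap t<35r) (≤-diff (≤⇒0≤- hr) refl)) (e₄ h r (fromNat t))

-- This is where the factor 35 in the number of repetitions comes from.
repetition-rate : fromNat 2 * (+ 49 / 50) ^ 35 ≤ 1ℚ
repetition-rate = begin
  fromNat 2 * (+ 49 / 50) ^ 35        ≡⟨ cong (fromNat 2 *_) (^-assocʳ (+ 49 / 50) 5 7) ⟨
  fromNat 2 * ((+ 49 / 50) ^ 5) ^ 7   ≤⟨ *-monoˡ-≤ (fromNat-nonNeg 2) (^-mono-≤ (nonNegative⁻¹ ((+ 49 / 50) ^ 5))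
                                           (toWitness {a? = (+ 49 / 50) ^ 5 ≤? + 113 / 125} _) 7) ⟩
  fromNat 2 * (+ 113 / 125) ^ 7       ≤⟨ toWitness {a? = fromNat 2 * (+ 113 / 125) ^ 7 ≤? 1ℚ} _ ⟩
  1ℚ                                  ∎
  where open ≤-Reasoning

-- The 35th power removes the logarithm, and `repetition-rate` pays for each of the t factors 2. The
-- argument bounds even three times (49/50)ᵗ by d: of the three shares in 3/δ, the two errors take
-- two.
failure-bound : ∀ {d} → 0ℚ < d → ∀ t → fromNat 3 ^ 35 ≤ fromNat 2 ^ t * d ^ 35 → (+ 49 / 50) ^ t + (+ 49 / 50) ^ t ≤ d
failure-bound {d} 0<d t p = ≤-trans (≤-diff 0≤q (e₁ q)) (^-cancel-≤ (<⇒≤ 0<d) 34 (begin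
  (fromNat 3 * q) ^ 35                      ≡⟨ ^-distrib-* (fromNat 3) q 35 ⟩
  fromNat 3 ^ 35 * q ^ 35                   ≤⟨ *-monoʳ-≤-nonNeg (q ^ 35) {{nonNegative (^-nonNeg 0≤q 35)}} p ⟩
  fromNat 2 ^ t * d ^ 35 * q ^ 35           ≡⟨ cong (fromNat 2 ^ t * d ^ 35 *_) (^-flip (+ 49 / 50) t 35) ⟩
  fromNat 2 ^ t * d ^ 35 * ((+ 49 / 50) ^ 35) ^ t   ≡⟨ e₂ (fromNat 2 ^ t) (d ^ 35) (((+ 49 / 50) ^ 35) ^ t) ⟩
  d ^ 35 * (fromNat 2 ^ t * ((+ 49 / 50) ^ 35) ^ t) ≡⟨ cong (d ^ 35 *_) (^-distrib-* (fromNat 2) ((+ 49 / 50) ^ 35) t) ⟨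
  d ^ 35 * (fromNat 2 * (+ 49 / 50) ^ 35) ^ t       ≤⟨ *-monoˡ-≤ (^-nonNeg (<⇒≤ 0<d) 35)
                                               (^-mono-≤ (*-nonNeg (fromNat-nonNeg 2) (^-nonNeg 0≤49/50 35)) repetition-rate t) ⟩
  d ^ 35 * 1ℚ ^ t                           ≡⟨ trans (cong (d ^ 35 *_) (1^ t)) (*-identityʳ (d ^ 35)) ⟩
  d ^ 35                                    ∎))
  where
  open ≤-Reasoning
  0≤49/50 : 0ℚ ≤ + 49 / 50
  0≤49/50 = nonNegative⁻¹ (+ 49 / 50)
  q = (+ 49 / 50) ^ t
  0≤q = ^-nonNeg 0≤49/50 t
  e₁ : ∀ q → fromNat 3 * q ≡ q + q + q
  e₁ = solve-∀ ℚ-ring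
  e₂ : ∀ a b c → a * b * c ≡ b * (a * c)
  e₂ = solve-∀ ℚ-ring

theorem4p3p4 :
    (n : ℕ) (F : CNF n) (B : BoundedSAT n)
    (ε δ : Cut) → IsReal ε → IsReal δ →
    fromℕ 0 <ᶜ ε → ε ≤ᶜ fromℕ 1 →
    fromℕ 0 <ᶜ δ → δ ≤ᶜ fromℕ 1 →
    (pivot t : ℕ) → IsPivot ε pivot → IsIterations δ t →
    fromℕ 1 -ᶜ δ ≤ᶜ Pr (approxMC B F pivot t) (Within ε (# (fromCNF F)))
theorem4p3p4 n F B ε δ Rε Rδ 0<ε ε≤1 (l , 0<l , Ll) δ≤1 _ t (k , (_ , ceilε) , refl) (_ , ceilδ) q (a , b , a<1 , Ub , q≡) =
  -- A rational q below 1 - δ comes as a + b with a < 1 and -b above δ, so -b is the rational error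
  -- budget d, and `accept` is the decidable event inside the guarantee.
  accept e N , (λ v → accept-sound Rε 0<e Lε (# (fromCNF F)) v) , (begin-strict
    q
      ≡⟨ q≡ ⟩
    a + b
      <⟨ +-monoˡ-< b a<1 ⟩
    1ℚ + b
      ≤⟨ ≤-diff (≤⇒0≤- (failure-bound 0<d t (iterations-bound D t ceilδ))) (eq b (p ^ t)) ⟩
    1ℚ - (p ^ t + p ^ t)
      ≤⟨ amplification 0<e (approxMCCore B F (2 ℕ.* k)) t
           (subst (λ N → 𝔼 (approxMCCore B F (2 ℕ.* k)) (λ v → indicator (below e N v)) ≤ + 2 / 5) (card-solutions F) core-below)
           (subst (λ N → 𝔼 (approxMCCore B F (2 ℕ.* k)) (λ v → indicator (above e N v)) ≤ + 2 / 5) (card-solutions F) core-above) ⟩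
    prob (approxMC B F (2 ℕ.* k) t) (accept e N) ∎)
  where
  open ≤-Reasoning
  open Tolerance (tolerance Rε 0<ε ε≤1 {k} ceilε)
  open CoreBound B F k 0<k {e} {β} 0<e β-def β≤½ 0<β 1≤β²k using (core-below; core-above)
  N p : ℚ
  N = fromNat (# (fromCNF F))
  p = + 49 / 50
  D = Real.enclosed Rδ 0<l Ll Ub
  0<d = 0<upper D
  eq : ∀ b s → 1ℚ - (s + s) ≡ 1ℚ + b + (- b - (s + s))
  eq = solve-∀ ℚ-ring
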